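{- Let $k\ge1$ and let $G$ be the graph consisting of the graph $Q_4(M)$ with $m_{ij}=k$ for all $1\le i<j\le4$, together with $k$ additional vertices $v_1,\dots,v_k$ such that for each $1\le i\le k$ the vertex set $\{1,2,3,v_i\}$ spans a complete graph (i.e. $v_i$ is adjacent exactly to $1,2,3$). Then the graphic arrangement $\mathcal{A}_G$ is $(k+1)$-coaccurate but not $k$-coaccurate.
   Context: Let $\mathbb{K}$ be a field. For a simple graph $G$ with vertices $v_1,\dots,v_n$, the graphic arrangement in $\mathbb{K}^n$ is $\mathcal{A}_G=\{\ker(x_i-x_j):\{v_i,v_j\}\text{ an edge}\}$. $Q_4(M)$ is the complete graph on $\{1,2,3,4\}$ together with, for each pair $i<j$, $m_{ij}$ new vertices each adjacent exactly to $i$ and $j$. For a central arrangement $\mathcal{A}$ in $V=\mathbb{K}^n$: $L(\mathcal{A})$ is the set of intersections of subsets of $\mathcal{A}$ (including $V$); $\mathcal{A}^X=\{H\cap X:H\in\mathcal{A},X\not\subseteq H\}$; $\mathcal{A}$ is free if $D(\mathcal{A})=\{\theta\in\mathrm{Der}(S):\theta(\alpha_H)\in\alpha_HS\ \forall H\}$ is free over $S=\mathbb{K}[x_1,\dots,x_n]$, exponents being degrees of a homogeneous basis. If $\mathcal{A}$ is free with exponents $e_1\le\dots\le e_n$, a witness for accuracy is a tuple $(X_1,\dots,X_n)$ of flats in $L(\mathcal{A})$ with $\dim X_d=d$ and $\mathcal{A}^{X_d}$ free with exponents $(e_1,\dots,e_d)$ for each $d$. For $1\le j\le n-1$, $\mathcal{A}$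 is $j$-coaccurate if there is a witness for accuracy with $X_1\subseteq X_2\subseteq\dots\subseteq X_{n-j}$ (so $j$-coaccurate implies $(j+1)$-coaccurate, and $1$-coaccurate means flag-accurate). -}

module Defs where

open import Level using (Level; _⊔_; 0ℓ)
open import Algebra.Bundles using (CommutativeRing)
open import Data.Nat as ℕ using (ℕ; zero; suc; _≤_; _<_; _∸_)
open import Data.Fin as Fin using (Fin; toℕ; inject≤; splitAt; remQuot)
open import Data.Fin.Properties using (toℕ<n)
open import Data.Vec as Vec using (Vec; zipWith; replicate; _[_]≔_)
open import Data.Vec.Properties using (≡-dec)
open import Data.List as List using (List; []; _∷_; _++_; concat; concatMap; allFin)
open import Data.Product using (Σ; ∃; _×_; _,_)
open import Data.Sum using (_⊎_; inj₁; inj₂)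
open import Data.Empty using (⊥)
open import Data.Bool using (Bool; T)
open import Relation.Nullary using (¬_; yes; no)
open import Relation.Binary.PropositionalEquality using (_≡_; _≢_)

record Field (c ℓ : Level) : Set (Level.suc (c ⊔ ℓ)) where
  field
    commutativeRing : CommutativeRing c ℓ
  open CommutativeRing commutativeRing public
  field
    0≉1     : ¬ (0# ≈ 1#)
    inverse : ∀ x → ¬ (x ≈ 0#) → ∃ λ y → x * y ≈ 1#

module _ {c ℓ : Level} (K : Field c ℓ) where
  open Field K renaming (Carrier to 𝕂; _+_ to _+K_; _*_ to _*K_; -_ to -K_)

  Mon : ℕ → Set
  Mon d = Vec ℕ d

  Poly : ℕ → Set c
  Poly d = List (𝕂 × Mon d)

  coeff : ∀ {d} → Poly d → Mon d → 𝕂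
  coeff [] m = 0#
  coeff ((a , m′) ∷ p) m with ≡-dec ℕ._≟_ m′ m
  ... | yes _ = a +K coeff p m
  ... | no  _ = coeff p m

  _≈P_ : ∀ {d} → Poly d → Poly d → Set ℓ
  p ≈P q = ∀ m → coeff p m ≈ coeff q m

  0P : ∀ {d} → Poly d
  0P = []

  _+P_ : ∀ {d} → Poly d → Poly d → Poly d
  p +P q = p ++ q

  -P_ : ∀ {d} → Poly d → Poly d
  -P p = List.map (λ { (a , m) → (-K a , m) }) p

  _-P_ : ∀ {d} → Poly d → Poly d → Poly d
  p -P q = p +P (-P q)

  _*P_ : ∀ {d} → Poly d → Poly d → Poly d
  p *P q = concatMap (λ { (a , m) → List.map (λ { (b , m′) → (a *K b , zipWith ℕ._+_ m m′) }) q }) p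

  var : ∀ {d} → Fin d → Poly d
  var {d} i = (1# , (replicate d 0 [ i ]≔ 1)) ∷ []

  -- p is homogeneous of degree e (the zero polynomial is homogeneous of every degree)
  Homogeneous : ∀ {d} → ℕ → Poly d → Set ℓ
  Homogeneous e p = ∀ m → Vec.sum m ≢ e → coeff p m ≈ 0#

  -- A derivation θ ∈ Der(S) = ⊕ S ∂_i, determined by θ(y_i).
  Der : ℕ → Set c
  Der d = Fin d → Poly d

  -- An arrangement all of whose hyperplanes are of the form ker(y_a - y_b),
  -- given by the relation R (R a b means ker(y_a - y_b) belongs to it).
  -- θ ∈ D(A) iff θ(y_a - y_b) = θ_a - θ_b ∈ (y_a - y_b) S for all hyperplanes.
  InD : ∀ {d} → (Fin d → Fin d → Set) → Der d → Set (c ⊔ ℓ)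
  InD R θ = ∀ a b → R a b → Σ (Poly _) λ h → (θ a -P θ b) ≈P ((var a -P var b) *P h)

  lin : ∀ {d} → (Fin d → Poly d) → (Fin d → Der d) → Der d
  lin {d} g θ i = concat (List.map (λ a → g a *P θ a i) (allFin d))

  FreeWithExps : ∀ {d} → (Fin d → Fin d → Set) → (Fin d → ℕ) → Set (c ⊔ ℓ)
  FreeWithExps {d} R e =
    Σ (Fin d → Der d) λ θ →
      (∀ a → InD R (θ a)) ×
      (∀ a i → Homogeneous (e a) (θ a i)) ×
      (∀ φ → InD R φ → Σ (Fin d → Poly d) λ g → ∀ i → φ i ≈P lin g θ i) ×
      (∀ g → (∀ i → lin g θ i ≈P 0P) → ∀ a → g a ≈P 0P)

  -- Graphic arrangements.  A simple graph on vertices Fin n given by an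
  -- adjacency relation Adj; A_G = { ker(x_i - x_j) : Adj i j } in K^n.

  module _ {n : ℕ} (Adj : Fin n → Fin n → Set) where

    -- A flat X ∈ L(A_G) of dimension d, presented by a surjection
    -- π : Fin n → Fin d such that X = { x : π i ≡ π j → x_i = x_j }
    -- (so X ≅ K^d via y ↦ y ∘ π), together with a subset S ⊆ A_G whose
    -- intersection is exactly X.
    record Flat (d : ℕ) : Set (c ⊔ ℓ) where
      field
        π      : Fin n → Fin d
        surj   : ∀ b → ∃ λ i → π i ≡ b
        S      : Fin n → Fin n → Bool
        S⊆A    : ∀ i j → T (S i j) → Adj i j
        ∩S⊆X   : ∀ (x : Fin n → 𝕂) → (∀ i j → T (S i j) → x i ≈ x j) → (∀ i j → π i ≡ π j → x i ≈ x j)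
        X⊆∩S   : ∀ (x : Fin n → 𝕂) → (∀ i j → π i ≡ π j → x i ≈ x j) → (∀ i j → T (S i j) → x i ≈ x j)

    _∈F_ : ∀ {d} → (Fin n → 𝕂) → Flat d → Set ℓ
    x ∈F X = ∀ i j → Flat.π X i ≡ Flat.π X j → x i ≈ x j

    _⊆F_ : ∀ {d d′} → Flat d → Flat d′ → Set (c ⊔ ℓ)
    X ⊆F Y = ∀ x → x ∈F X → x ∈F Y

    -- The restriction A^X, written in the coordinates y of X ≅ K^d:
    -- H = ker(x_i - x_j) with X ⊄ H (i.e. π i ≢ π j) restricts to ker(y_{π i} - y_{π j}).
    Restr : ∀ {d} → Flat d → Fin d → Fin d → Set
    Restr X a b = Σ (Fin n) λ i → Σ (Fin n) λ j →
      Adj i j × Flat.π X i ≡ a × Flat.π X j ≡ b × a ≢ b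

    -- j-coaccuracy: A_G is free with exponents e_1 ≤ … ≤ e_n and there is a
    -- witness for accuracy (X_1,…,X_n) (X_{a+1} indexed by a : Fin n) with
    -- X_1 ⊆ X_2 ⊆ … ⊆ X_{n-j}.
    Coaccurate : ℕ → Set (c ⊔ ℓ)
    Coaccurate jj =
      Σ (Fin n → ℕ) λ e →
        (∀ a b → toℕ a ≤ toℕ b → e a ≤ e b) ×
        FreeWithExps Adj e ×
        Σ ((a : Fin n) → Flat (suc (toℕ a))) λ X →
          (∀ a → FreeWithExps (Restr (X a)) (λ b → e (inject≤ b (toℕ<n a)))) ×
          (∀ a b → toℕ a ≤ toℕ b → suc (toℕ b) ≤ n ∸ jj → X a ⊆F X b)

-- The graph of Theorem 6.12.  Vertices Fin (4 + (6 * k + k)):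
--   core a   (a : Fin 4)            : the vertices 1,2,3,4 of K_4
--   mid p t  (p : Fin 6, t : Fin k) : the k vertices for the pair p = {i,j}
--   extra t  (t : Fin k)            : v_{t+1}, adjacent exactly to 1,2,3

data Label (k : ℕ) : Set where
  core  : Fin 4 → Label k
  mid   : Fin 6 → Fin k → Label k
  extra : Fin k → Label k

pairFst pairSnd : Fin 6 → Fin 4
pairFst Fin.zero = Fin.zero
pairFst (Fin.suc Fin.zero) = Fin.zero
pairFst (Fin.suc (Fin.suc Fin.zero)) = Fin.zero
pairFst (Fin.suc (Fin.suc (Fin.suc Fin.zero))) = Fin.suc Fin.zero
pairFst (Fin.suc (Fin.suc (Fin.suc (Fin.suc Fin.zero)))) = Fin.suc Fin.zero
pairFst (Fin.suc (Fin.suc (Fin.suc (Fin.suc (Fin.suc Fin.zero))))) = Fin.suc (Fin.suc Fin.zero)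
pairSnd Fin.zero = Fin.suc Fin.zero
pairSnd (Fin.suc Fin.zero) = Fin.suc (Fin.suc Fin.zero)
pairSnd (Fin.suc (Fin.suc Fin.zero)) = Fin.suc (Fin.suc (Fin.suc Fin.zero))
pairSnd (Fin.suc (Fin.suc (Fin.suc Fin.zero))) = Fin.suc (Fin.suc Fin.zero)
pairSnd (Fin.suc (Fin.suc (Fin.suc (Fin.suc Fin.zero)))) = Fin.suc (Fin.suc (Fin.suc Fin.zero))
pairSnd (Fin.suc (Fin.suc (Fin.suc (Fin.suc (Fin.suc Fin.zero))))) = Fin.suc (Fin.suc (Fin.suc Fin.zero))

LAdj : ∀ {k} → Label k → Label k → Set
LAdj (core a)  (core b)  = a ≢ b
LAdj (core a)  (mid p _) = a ≡ pairFst p ⊎ a ≡ pairSnd p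
LAdj (mid p _) (core a)  = a ≡ pairFst p ⊎ a ≡ pairSnd p
LAdj (core a)  (extra _) = toℕ a < 3
LAdj (extra _) (core a)  = toℕ a < 3
LAdj _ _ = ⊥

decode : ∀ k → Fin (4 ℕ.+ (6 ℕ.* k ℕ.+ k)) → Label k
decode k i with splitAt 4 i
... | inj₁ a = core a
... | inj₂ r with splitAt (6 ℕ.* k) r
...   | inj₁ q = let (p , t) = remQuot {6} k q in mid p t
...   | inj₂ t = extra t

GAdj : ∀ k → Fin (4 ℕ.+ (6 ℕ.* k ℕ.+ k)) → Fin (4 ℕ.+ (6 ℕ.* k ℕ.+ k)) → Set
GAdj k i j = LAdj (decode k i) (decode k j)

{-# OPTIONS --safe #-}
module Submission where

-- All graphs that occur consist of a clique of hubs and leaves attached to hubs.  Newton's polynomials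
-- P_a(t) = ∏_{u∈N(a)} (t − x_u), with N(a) the earlier neighbours of a, give a basis of D: a hub a
-- yields x_i ↦ P_a(x_i) for every i, a leaf a yields P_a(x_a)∂_a.  Hence 𝒜_G has the exponents
-- 0, 1, 2^{6k+1}, 3^{k+1}.
--
-- For the witness, contract the edge 12 together with the k vertices attached to it: K₃ with 6k
-- vertices of degree 2 remains, with exponents 0, 1, 2^{6k+1}, and its vertices can be contracted one
-- at a time.  In the higher dimensions contract extra vertices only.
--
-- Conversely, take a subgraph consisting of a clique with leaves, and suppose that m of its basis
-- elements of degree s lie in D.  Comparing constant terms of base changes shows that every basis of
-- D has at least m elements of degree s.  Let X ⊆ Y be the flats of dimensions 6k+3 and 6k+4 in a
-- chain.  No exponent of X is 3, so X collapses an edge ij of K₄; only one exponent is 1, so no vertex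
-- attached to ij may remain pendant, and this uses up the codimension k+1 of X.  Y has too small a
-- codimension to collapse an edge of K₄, and since Y ⊇ X its extra vertices are untouched: K₄ and an
-- extra vertex give Y two exponents 3 instead of one.

open import Defs
open import Level using (Level; _⊔_)
open import Algebra.Bundles using (CommutativeRing)
open import Algebra.Structures using (IsCommutativeRing)
open import Data.Nat as ℕ using (ℕ; zero; suc; _≤_; _<_; _∸_; s≤s; z≤n)
import Data.Nat.Properties as ℕₚ
open import Data.Fin as Fin using (Fin; zero; suc; toℕ; #_)
import Data.Fin.Properties as Finₚ
open import Data.Vec as Vec using (Vec; zipWith; replicate; lookup; _[_]≔_)
import Data.Vec.Properties as Vecₚ
open import Data.List as List using (List; []; _∷_; _++_; concat; length; tabulate)
import Data.List.Properties as Listₚ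
open import Data.Product using (Σ; ∃; _×_; _,_; proj₁; proj₂)
open import Data.Sum as Sum using (_⊎_; inj₁; inj₂)
open import Data.Empty using (⊥; ⊥-elim)
open import Function using (_∘_; id)
open import Relation.Nullary using (¬_; yes; no; Dec)
open import Relation.Binary.PropositionalEquality as ≡ using (_≡_; _≢_)
open import Data.List.Membership.Propositional using (_∈_; _∉_)
open import Data.List.Membership.Propositional.Properties using (∈-map⁺; ∈-map⁻; ∈-allFin)
open import Data.List.Relation.Unary.Any using (here; there)
open import Data.List.Relation.Unary.All as All using (All; []; _∷_)
open import Data.List.Relation.Unary.Unique.Propositional using (Unique)
import Data.List.Relation.Unary.Unique.Propositional.Properties as Uniqueₚ
open import Data.List.Relation.Unary.AllPairs using ([]; _∷_)
open import Data.Fin.Permutation as Perm using (Permutation; _⟨$⟩ʳ_; _⟨$⟩ˡ_)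
open import Data.Unit using (⊤; tt)
open import Relation.Nullary.Decidable using (decidable-stable; ¬?; _⊎-dec_; _×-dec_; ⌊_⌋; toWitness; fromWitness)
open import Data.Bool using (T)

-- The construction rests on an exact balance. There are 6k + 3 exponents at most 2, and this
-- dimension has codimension k + 1, the price of collapsing one edge of K₄ with its k attached
-- vertices. The edge is chosen inside {1,2,3} so that every extra vertex loses a neighbour: the k
-- extra vertices then replace the k absorbed ones as leaves of degree 2.
--
-- In the negative part neither the exponents nor the flats are given explicitly, and the
-- restrictions may be complicated graphs. The comparison of bases is therefore one-sided. Passing
-- to a subgraph enlarges D, so a basis of D always expands in the Newton basis of the subgraph,
-- while only those Newton elements that are known to lie in D are expanded back.
--
-- Equality in K may be undecidable. Linear dependence up to double negation suffices, because it
-- only serves to derive contradictions; equalities of numbers and of classes, which are decidable,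
-- are recovered from these.

-- Identities for division by a difference

module DivisionIdentities {c ℓ : Level} (R : CommutativeRing c ℓ) where
  open CommutativeRing R
  open import Algebra.Properties.Ring ring using (-‿distribʳ-*)
  open import Algebra.Properties.CommutativeSemigroup +-commutativeSemigroup
    using () renaming (interchange to +-interchange)
  open import Algebra.Properties.CommutativeSemigroup *-commutativeSemigroup
    using () renaming (x∙yz≈y∙xz to x*yz≈y*xz)
  open import Relation.Binary.Reasoning.Setoid setoid

  x≈x-y+y : ∀ x y → x ≈ (x - y) + y
  x≈x-y+y x y = begin
    x                ≈⟨ +-identityʳ x ⟨
    x + 0#           ≈⟨ +-congˡ (-‿inverseˡ y) ⟨
    x + (- y + y)    ≈⟨ +-assoc x (- y) y ⟨
    (x - y) + y      ∎

  x-z≈[x-y]+[y-z] : ∀ x y z → x - z ≈ (x - y) + (y - z)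
  x-z≈[x-y]+[y-z] x y z = trans (+-congʳ (x≈x-y+y x y)) (+-assoc _ _ _)

  -- A factor `a` in front of the remainder is rewritten as (a - w) + w, so the new remainder
  -- `w * r` acquires no further `a`. This is the inductive step of division on the exponent of a
  -- variable.
  division-*var : ∀ a w {p} h r → p ≈ (a - w) * h + r →
                  a * p ≈ (a - w) * (a * h + r) + w * r
  division-*var a w {p} h r eq = begin
    a * p                                     ≈⟨ *-congˡ eq ⟩
    a * ((a - w) * h + r)                     ≈⟨ distribˡ _ _ _ ⟩
    a * ((a - w) * h) + a * r                 ≈⟨ +-cong (x*yz≈y*xz _ _ _) (*-congʳ (x≈x-y+y a w)) ⟩
    (a - w) * (a * h) + ((a - w) + w) * r     ≈⟨ +-congˡ (distribʳ _ _ _) ⟩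
    (a - w) * (a * h) + ((a - w) * r + w * r) ≈⟨ +-assoc _ _ _ ⟨
    ((a - w) * (a * h) + (a - w) * r) + w * r ≈⟨ +-congʳ (distribˡ _ _ _) ⟨
    (a - w) * (a * h + r) + w * r             ∎

  division-+ : ∀ {D p p′ h h′ r r′} → p ≈ D * h + r → p′ ≈ D * h′ + r′ →
               p + p′ ≈ D * (h + h′) + (r + r′)
  division-+ {D} {p} {p′} {h} {h′} {r} {r′} eq eq′ = begin
    p + p′                          ≈⟨ +-cong eq eq′ ⟩
    (D * h + r) + (D * h′ + r′)     ≈⟨ +-interchange _ _ _ _ ⟩
    (D * h + D * h′) + (r + r′)     ≈⟨ +-congʳ (distribˡ _ _ _) ⟨
    D * (h + h′) + (r + r′)         ∎

  -- The factor a - u in front of `r` is split as (a - w) + (w - u). When the variable `a` does not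
  -- occur in `r`, the left side is free of it while the right side is a multiple of a - w, which
  -- will force both to vanish.
  remainder-multiple : ∀ a u w {h q k r} → h ≈ (a - w) * k + r → (a - u) * h ≈ (a - w) * q →
                       (w - u) * r ≈ (a - w) * (q - ((a - u) * k + r))
  remainder-multiple a u w {h} {q} {k} {r} eq eq′ = sym (begin
    (a - w) * (q - ((a - u) * k + r))                ≈⟨ distribˡ _ _ _ ⟩
    (a - w) * q + (a - w) * - ((a - u) * k + r)      ≈⟨ +-cong lhs (sym (-‿distribʳ-* _ _)) ⟩
    ((w - u) * r + E) - E                            ≈⟨ +-assoc _ _ _ ⟩
    (w - u) * r + (E - E)                            ≈⟨ +-congˡ (-‿inverseʳ E) ⟩
    (w - u) * r + 0#                                 ≈⟨ +-identityʳ _ ⟩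
    (w - u) * r                                      ∎)
    where
    E : Carrier
    E = (a - w) * ((a - u) * k + r)
    lhs : (a - w) * q ≈ (w - u) * r + E
    lhs = begin
      (a - w) * q                                              ≈⟨ eq′ ⟨
      (a - u) * h                                              ≈⟨ *-congˡ eq ⟩
      (a - u) * ((a - w) * k + r)                              ≈⟨ distribˡ _ _ _ ⟩
      (a - u) * ((a - w) * k) + (a - u) * r                    ≈⟨ +-cong (x*yz≈y*xz _ _ _) (*-congʳ (x-z≈[x-y]+[y-z] a w u)) ⟩
      (a - w) * ((a - u) * k) + ((a - w) + (w - u)) * r        ≈⟨ +-congˡ (distribʳ _ _ _) ⟩
      (a - w) * ((a - u) * k) + ((a - w) * r + (w - u) * r)    ≈⟨ +-assoc _ _ _ ⟨
      ((a - w) * ((a - u) * k) + (a - w) * r) + (w - u) * r    ≈⟨ +-congʳ (distribˡ _ _ _) ⟨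
      E + (w - u) * r                                          ≈⟨ +-comm _ _ ⟩
      (w - u) * r + E                                          ∎

-- Polynomials

module Polynomials {c ℓ : Level} (K : Field c ℓ) {d : ℕ} where
  open Field K renaming (Carrier to 𝕂)
  open import Algebra.Properties.Ring ring using (-‿distribˡ-*)
  open import Algebra.Properties.AbelianGroup +-abelianGroup
    using () renaming (⁻¹-∙-comm to -‿+-comm; ε⁻¹≈ε to -0#≈0#; ∙-cancelʳ to +-cancelʳ)
  open import Algebra.Properties.CommutativeSemigroup +-commutativeSemigroup
    using () renaming (interchange to +-interchange; x∙yz≈y∙xz to x+yz≈y+xz)
  open import Algebra.Properties.CommutativeSemigroup *-commutativeSemigroup
    using () renaming (x∙yz≈y∙xz to x*yz≈y*xz)
  open import Relation.Binary.Reasoning.Setoid setoid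

  S : Set c
  S = Poly K d

  M : Set
  M = Mon K d

  infixl 6 _⊕_
  _⊕_ : M → M → M
  _⊕_ = zipWith ℕ._+_

  𝟎 : M
  𝟎 = replicate d 0

  _≟M_ : (m m′ : M) → Dec (m ≡ m′)
  _≟M_ = Vecₚ.≡-dec ℕ._≟_

  ⊕-comm : ∀ m m′ → m ⊕ m′ ≡ m′ ⊕ m
  ⊕-comm = Vecₚ.zipWith-comm ℕₚ.+-comm

  ⊕-assoc : ∀ m m′ m″ → (m ⊕ m′) ⊕ m″ ≡ m ⊕ (m′ ⊕ m″)
  ⊕-assoc = Vecₚ.zipWith-assoc ℕₚ.+-assoc

  ⊕-identityˡ : ∀ m → 𝟎 ⊕ m ≡ m
  ⊕-identityˡ = Vecₚ.zipWith-identityˡ ℕₚ.+-identityˡ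

  ⊕-cancelˡ : ∀ m {m₁ m₂} → m ⊕ m₁ ≡ m ⊕ m₂ → m₁ ≡ m₂
  ⊕-cancelˡ = go
    where
    go : ∀ {n} (m : Vec ℕ n) {m₁ m₂} → zipWith ℕ._+_ m m₁ ≡ zipWith ℕ._+_ m m₂ → m₁ ≡ m₂
    go Vec.[] {Vec.[]} {Vec.[]} _ = ≡.refl
    go (x Vec.∷ m) {y Vec.∷ m₁} {z Vec.∷ m₂} eq =
      ≡.cong₂ Vec._∷_ (ℕₚ.+-cancelˡ-≡ x y z (Vecₚ.∷-injectiveˡ eq)) (go m (Vecₚ.∷-injectiveʳ eq))

  -- The linear form Σ a·m ↦ Σ a·f(m).  Every coefficient of a sum or product is such a
  -- form, and by ext-resp two polynomials are equal iff all these forms agree on them.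
  ext : (M → 𝕂) → S → 𝕂
  ext f []            = 0#
  ext f ((a , m) ∷ p) = a * f m + ext f p

  ext-cong : ∀ {f g} → (∀ m → f m ≈ g m) → ∀ p → ext f p ≈ ext g p
  ext-cong eq []            = refl
  ext-cong eq ((a , m) ∷ p) = +-cong (*-congˡ (eq m)) (ext-cong eq p)

  ext-++ : ∀ f p q → ext f (p ++ q) ≈ ext f p + ext f q
  ext-++ f []            q = sym (+-identityˡ _)
  ext-++ f ((a , m) ∷ p) q = trans (+-congˡ (ext-++ f p q)) (sym (+-assoc _ _ _))

  ext-0 : ∀ p → ext (λ _ → 0#) p ≈ 0#
  ext-0 []            = refl
  ext-0 ((a , m) ∷ p) = trans (+-cong (zeroʳ a) (ext-0 p)) (+-identityˡ 0#)

  ext-+ : ∀ f g p → ext (λ m → f m + g m) p ≈ ext f p + ext g p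
  ext-+ f g []            = sym (+-identityˡ 0#)
  ext-+ f g ((a , m) ∷ p) =
    trans (+-cong (distribˡ a (f m) (g m)) (ext-+ f g p)) (+-interchange _ _ _ _)

  ext-*ˡ : ∀ b f p → ext (λ m → b * f m) p ≈ b * ext f p
  ext-*ˡ b f []            = sym (zeroʳ b)
  ext-*ˡ b f ((a , m) ∷ p) =
    trans (+-cong (x*yz≈y*xz a b (f m)) (ext-*ˡ b f p)) (sym (distribˡ b _ _))

  ext-neg : ∀ f p → ext f (-P_ K p) ≈ - ext f p
  ext-neg f []            = sym -0#≈0#
  ext-neg f ((a , m) ∷ p) =
    trans (+-cong (sym (-‿distribˡ-* a (f m))) (ext-neg f p)) (-‿+-comm _ _)

  ext-*P : ∀ f p q → ext f (_*P_ K p q) ≈ ext (λ m → ext (λ m′ → f (m ⊕ m′)) q) p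
  ext-*P f []            q = refl
  ext-*P f ((a , m) ∷ p) q =
    trans (ext-++ f (List.map _ q) (_*P_ K p q)) (+-cong (scale q) (ext-*P f p q))
    where
    scale : ∀ q → ext f (List.map (λ { (b , m′) → (a * b , zipWith ℕ._+_ m m′) }) q)
                  ≈ a * ext (λ m′ → f (m ⊕ m′)) q
    scale []             = sym (zeroʳ a)
    scale ((b , m′) ∷ q) = trans (+-cong (*-assoc a b _) (scale q)) (sym (distribˡ a _ _))

  ext-swap : ∀ (F : M → M → 𝕂) p q →
             ext (λ m → ext (F m) q) p ≈ ext (λ m′ → ext (λ m → F m m′) p) q
  ext-swap F []            q = sym (ext-0 q)
  ext-swap F ((a , m) ∷ p) q =
    trans (+-cong (sym (ext-*ˡ a (F m) q)) (ext-swap F p q)) (sym (ext-+ _ _ q))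

  ind : M → M → 𝕂
  ind m m′ with m′ ≟M m
  ... | yes _ = 1#
  ... | no  _ = 0#

  ind-yes : ∀ {m m′} → m′ ≡ m → ind m m′ ≈ 1#
  ind-yes {m} {m′} eq with m′ ≟M m
  ... | yes _ = refl
  ... | no ne = ⊥-elim (ne eq)

  ind-no : ∀ {m m′} → m′ ≢ m → ind m m′ ≈ 0#
  ind-no {m} {m′} ne with m′ ≟M m
  ... | yes eq = ⊥-elim (ne eq)
  ... | no _   = refl

  coeff-ext : ∀ p m → coeff K p m ≈ ext (ind m) p
  coeff-ext []             m = refl
  coeff-ext ((a , m′) ∷ p) m with m′ ≟M m
  ... | yes _ = +-cong (sym (*-identityʳ a)) (coeff-ext p m)
  ... | no  _ = trans (coeff-ext p m) (sym (trans (+-congʳ (zeroʳ a)) (+-identityˡ _)))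

  coeff-++ : ∀ p q m → coeff K (p ++ q) m ≈ coeff K p m + coeff K q m
  coeff-++ p q m = begin
    coeff K (p ++ q) m              ≈⟨ coeff-ext (p ++ q) m ⟩
    ext (ind m) (p ++ q)            ≈⟨ ext-++ (ind m) p q ⟩
    ext (ind m) p + ext (ind m) q   ≈⟨ +-cong (coeff-ext p m) (coeff-ext q m) ⟨
    coeff K p m + coeff K q m       ∎

  coeff-neg : ∀ p m → coeff K (-P_ K p) m ≈ - coeff K p m
  coeff-neg p m = begin
    coeff K (-P_ K p) m     ≈⟨ coeff-ext (-P_ K p) m ⟩
    ext (ind m) (-P_ K p)   ≈⟨ ext-neg (ind m) p ⟩
    - ext (ind m) p         ≈⟨ -‿cong (coeff-ext p m) ⟨
    - coeff K p m           ∎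

  coeff-*P : ∀ p q m → coeff K (_*P_ K p q) m ≈ ext (λ m₁ → ext (λ m₂ → ind m (m₁ ⊕ m₂)) q) p
  coeff-*P p q m = trans (coeff-ext (_*P_ K p q) m) (ext-*P (ind m) p q)

  drop-term : M → S → S
  drop-term m []             = []
  drop-term m ((a , m′) ∷ p) with m′ ≟M m
  ... | yes _ = drop-term m p
  ... | no  _ = (a , m′) ∷ drop-term m p

  drop-term-length : ∀ m p → length (drop-term m p) ≤ length p
  drop-term-length m []             = z≤n
  drop-term-length m ((a , m′) ∷ p) with m′ ≟M m
  ... | yes _ = ℕₚ.m≤n⇒m≤1+n (drop-term-length m p)
  ... | no  _ = s≤s (drop-term-length m p)

  ext-drop-term : ∀ f m p → ext f p ≈ coeff K p m * f m + ext f (drop-term m p)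
  ext-drop-term f m []             = sym (trans (+-congʳ (zeroˡ _)) (+-identityˡ _))
  ext-drop-term f m ((a , m′) ∷ p) with m′ ≟M m
  ... | yes ≡.refl = begin
    a * f m + ext f p                                         ≈⟨ +-congˡ (ext-drop-term f m p) ⟩
    a * f m + (coeff K p m * f m + ext f (drop-term m p))     ≈⟨ +-assoc _ _ _ ⟨
    (a * f m + coeff K p m * f m) + ext f (drop-term m p)     ≈⟨ +-congʳ (distribʳ _ _ _) ⟨
    (a + coeff K p m) * f m + ext f (drop-term m p)           ∎
  ... | no _ = begin
    a * f m′ + ext f p                                        ≈⟨ +-congˡ (ext-drop-term f m p) ⟩
    a * f m′ + (coeff K p m * f m + ext f (drop-term m p))    ≈⟨ x+yz≈y+xz _ _ _ ⟩
    coeff K p m * f m + (a * f m′ + ext f (drop-term m p))    ∎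

  coeff-drop-term : ∀ m p → (∀ m′ → coeff K p m′ ≈ 0#) → ∀ m′ → coeff K (drop-term m p) m′ ≈ 0#
  coeff-drop-term m p p≈0 m′ = begin
    coeff K (drop-term m p) m′                              ≈⟨ coeff-ext (drop-term m p) m′ ⟩
    ext (ind m′) (drop-term m p)                            ≈⟨ +-identityˡ _ ⟨
    0# + ext (ind m′) (drop-term m p)                       ≈⟨ +-congʳ (trans (*-congʳ (p≈0 m)) (zeroˡ _)) ⟨
    coeff K p m * ind m′ m + ext (ind m′) (drop-term m p)   ≈⟨ ext-drop-term (ind m′) m p ⟨
    ext (ind m′) p                                          ≈⟨ coeff-ext p m′ ⟨
    coeff K p m′                                            ≈⟨ p≈0 m′ ⟩
    0#                                                      ∎

  -- A list with zero coefficients may still contain terms that cancel. All terms with the monomial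
  -- of the head are taken out together: they contribute `coeff K p m * f m`, which is zero, and the
  -- remaining list is shorter.
  ext-zero : ∀ f p → (∀ m → coeff K p m ≈ 0#) → ext f p ≈ 0#
  ext-zero f p = go (length p) p ℕₚ.≤-refl
    where
    go : ∀ n p → length p ≤ n → (∀ m → coeff K p m ≈ 0#) → ext f p ≈ 0#
    go n       []                _         p≈0 = refl
    go (suc n) p@((a , m) ∷ p′)  (s≤s len) p≈0 = begin
      ext f p                                      ≈⟨ ext-drop-term f m p ⟩
      coeff K p m * f m + ext f (drop-term m p)    ≈⟨ +-cong (trans (*-congʳ (p≈0 m)) (zeroˡ _))
                                                             (go n (drop-term m p) shorter (coeff-drop-term m p p≈0)) ⟩
      0# + 0#                                      ≈⟨ +-identityˡ 0# ⟩
      0#                                           ∎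
      where
      shorter : length (drop-term m p) ≤ n
      shorter with m ≟M m
      ... | yes _ = ℕₚ.≤-trans (drop-term-length m p′) len
      ... | no ne = ⊥-elim (ne ≡.refl)

  infix 4 _≋_
  -- A record, because `_≈P_` unfolds to a family of equations in the field, from which the two
  -- polynomials could not be inferred.
  record _≋_ (p q : S) : Set ℓ where
    constructor mk≋
    field at : _≈P_ K p q
  open _≋_ public

  ext-resp : ∀ {p q} → p ≋ q → ∀ f → ext f p ≈ ext f q
  ext-resp {p} {q} (mk≋ eq) f = begin
    ext f p                     ≈⟨ +-identityʳ _ ⟨
    ext f p + 0#                ≈⟨ +-congˡ (-‿inverseˡ _) ⟨
    ext f p + (- ext f q + ext f q)   ≈⟨ +-assoc _ _ _ ⟨
    (ext f p + - ext f q) + ext f q   ≈⟨ +-congʳ (+-congˡ (ext-neg f q)) ⟨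
    (ext f p + ext f (-P_ K q)) + ext f q   ≈⟨ +-congʳ (ext-++ f p (-P_ K q)) ⟨
    ext f (p ++ -P_ K q) + ext f q    ≈⟨ +-congʳ (ext-zero f (p ++ -P_ K q) diff) ⟩
    0# + ext f q                ≈⟨ +-identityˡ _ ⟩
    ext f q                     ∎
    where
    diff : ∀ m → coeff K (p ++ -P_ K q) m ≈ 0#
    diff m = begin
      coeff K (p ++ -P_ K q) m             ≈⟨ coeff-++ p (-P_ K q) m ⟩
      coeff K p m + coeff K (-P_ K q) m    ≈⟨ +-cong (eq m) (coeff-neg q m) ⟩
      coeff K q m + - coeff K q m          ≈⟨ -‿inverseʳ _ ⟩
      0#                                   ∎

  from-ext : ∀ {p q} → (∀ f → ext f p ≈ ext f q) → p ≋ q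
  from-ext {p} {q} eq .at m = trans (coeff-ext p m) (trans (eq (ind m)) (sym (coeff-ext q m)))

  1P : S
  1P = (1# , 𝟎) ∷ []

  ext-1P : ∀ f → ext f 1P ≈ f 𝟎
  ext-1P f = trans (+-identityʳ _) (*-identityˡ _)

  opaque
    -- The laws for products are tested on all forms `ext f`, where a product becomes an iterated
    -- form: commutativity is an exchange of summations, and congruence is `ext-resp` in each
    -- factor.
    poly-isCommutativeRing : IsCommutativeRing _≋_ (_+P_ K) (_*P_ K) (-P_ K) [] 1P
    poly-isCommutativeRing = record
      { isRing = record
        { +-isAbelianGroup = record
          { isGroup = record
            { isMonoid = record
              { isSemigroup = record
                { isMagma = record
                  { isEquivalence = record
                    { refl  = mk≋ λ m → refl
                    ; sym   = λ e → mk≋ λ m → sym (at e m)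
                    ; trans = λ e e′ → mk≋ λ m → trans (at e m) (at e′ m) }
                  ; ∙-cong = λ {p} {p′} {q} {q′} e e′ → mk≋ λ m →
                      trans (coeff-++ p q m) (trans (+-cong (at e m) (at e′ m)) (sym (coeff-++ p′ q′ m))) }
                ; assoc = λ p q r → mk≋ λ m → reflexive (≡.cong (λ z → coeff K z m) (Listₚ.++-assoc p q r)) }
              ; identity = (λ p → mk≋ λ m → refl)
                         , (λ p → mk≋ λ m → reflexive (≡.cong (λ z → coeff K z m) (Listₚ.++-identityʳ p))) }
            ; inverse = (λ p → mk≋ λ m → trans (coeff-++ (-P_ K p) p m) (trans (+-congʳ (coeff-neg p m)) (-‿inverseˡ _)))
                      , (λ p → mk≋ λ m → trans (coeff-++ p (-P_ K p) m) (trans (+-congˡ (coeff-neg p m)) (-‿inverseʳ _)))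
            ; ⁻¹-cong = λ {p} {q} e → mk≋ λ m →
                trans (coeff-neg p m) (trans (-‿cong (at e m)) (sym (coeff-neg q m))) }
          ; comm = λ p q → mk≋ λ m → trans (coeff-++ p q m) (trans (+-comm _ _) (sym (coeff-++ q p m))) }
        ; *-cong = λ {p} {p′} {q} {q′} e e′ → from-ext λ f →
            trans (ext-*P f p q) (trans (ext-resp e _)
            (trans (ext-cong (λ m → ext-resp e′ _) p′) (sym (ext-*P f p′ q′))))
        ; *-assoc = λ p q r → from-ext (*P-assoc p q r)
        ; *-identity = (λ p → from-ext (*P-identityˡ p))
                     , (λ p → from-ext λ f → trans (*P-comm p 1P f) (*P-identityˡ p f))
        ; distrib = (λ p q r → from-ext λ f → trans (*P-comm p (q ++ r) f) (trans (*P-distribʳ p q r f)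
                       (trans (ext-++ f (_*P_ K q p) _) (trans (+-cong (*P-comm q p f) (*P-comm r p f))
                       (sym (ext-++ f (_*P_ K p q) _))))))
                  , (λ p q r → from-ext (*P-distribʳ p q r)) }
      ; *-comm = λ p q → from-ext (*P-comm p q) }
      where
      *P-comm : ∀ p q f → ext f (_*P_ K p q) ≈ ext f (_*P_ K q p)
      *P-comm p q f = begin
        ext f (_*P_ K p q)                         ≈⟨ ext-*P f p q ⟩
        ext (λ m → ext (λ m′ → f (m ⊕ m′)) q) p    ≈⟨ ext-swap (λ m m′ → f (m ⊕ m′)) p q ⟩
        ext (λ m′ → ext (λ m → f (m ⊕ m′)) p) q    ≈⟨ ext-cong (λ m′ → ext-cong (λ m → reflexive (≡.cong f (⊕-comm m m′))) p) q ⟩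
        ext (λ m′ → ext (λ m → f (m′ ⊕ m)) p) q    ≈⟨ ext-*P f q p ⟨
        ext f (_*P_ K q p)                         ∎

      *P-assoc : ∀ p q r f → ext f (_*P_ K (_*P_ K p q) r) ≈ ext f (_*P_ K p (_*P_ K q r))
      *P-assoc p q r f = begin
        ext f (_*P_ K (_*P_ K p q) r)
          ≈⟨ ext-*P f (_*P_ K p q) r ⟩
        ext (λ m → ext (λ m″ → f (m ⊕ m″)) r) (_*P_ K p q)
          ≈⟨ ext-*P _ p q ⟩
        ext (λ m → ext (λ m′ → ext (λ m″ → f ((m ⊕ m′) ⊕ m″)) r) q) p
          ≈⟨ ext-cong (λ m → ext-cong (λ m′ → ext-cong (λ m″ → reflexive (≡.cong f (⊕-assoc m m′ m″))) r) q) p ⟩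
        ext (λ m → ext (λ m′ → ext (λ m″ → f (m ⊕ (m′ ⊕ m″))) r) q) p
          ≈⟨ ext-cong (λ m → ext-*P (λ n → f (m ⊕ n)) q r) p ⟨
        ext (λ m → ext (λ n → f (m ⊕ n)) (_*P_ K q r)) p
          ≈⟨ ext-*P f p (_*P_ K q r) ⟨
        ext f (_*P_ K p (_*P_ K q r)) ∎

      *P-identityˡ : ∀ p f → ext f (_*P_ K 1P p) ≈ ext f p
      *P-identityˡ p f = begin
        ext f (_*P_ K 1P p)                          ≈⟨ ext-*P f 1P p ⟩
        ext (λ m → ext (λ m′ → f (m ⊕ m′)) p) 1P     ≈⟨ ext-1P (λ m → ext (λ m′ → f (m ⊕ m′)) p) ⟩
        ext (λ m′ → f (𝟎 ⊕ m′)) p                    ≈⟨ ext-cong (λ m → reflexive (≡.cong f (⊕-identityˡ m))) p ⟩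
        ext f p                                      ∎

      *P-distribʳ : ∀ p q r f → ext f (_*P_ K (q ++ r) p) ≈ ext f (_*P_ K q p ++ _*P_ K r p)
      *P-distribʳ p q r f = begin
        ext f (_*P_ K (q ++ r) p)                     ≈⟨ ext-*P f (q ++ r) p ⟩
        ext (λ m → ext (λ m′ → f (m ⊕ m′)) p) (q ++ r) ≈⟨ ext-++ _ q r ⟩
        _                                             ≈⟨ +-cong (ext-*P f q p) (ext-*P f r p) ⟨
        ext f (_*P_ K q p) + ext f (_*P_ K r p)       ≈⟨ ext-++ f (_*P_ K q p) _ ⟨
        ext f (_*P_ K q p ++ _*P_ K r p)              ∎

  polyRing : CommutativeRing c ℓ
  polyRing = record
    { Carrier = S ; _≈_ = _≋_ ; _+_ = _+P_ K ; _*_ = _*P_ K ; -_ = -P_ K ; 0# = [] ; 1# = 1P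
    ; isCommutativeRing = poly-isCommutativeRing }

  module 𝕊 = CommutativeRing polyRing

  𝐞 : Fin d → M
  𝐞 i = replicate d 0 [ i ]≔ 1

  lookup-⊕ : ∀ i m m′ → lookup (m ⊕ m′) i ≡ lookup m i ℕ.+ lookup m′ i
  lookup-⊕ i m m′ = Vecₚ.lookup-zipWith ℕ._+_ i m m′

  lookup-𝐞 : ∀ i → lookup (𝐞 i) i ≡ 1
  lookup-𝐞 i = Vecₚ.lookup∘update i 𝟎 1

  lookup-𝐞-≢ : ∀ {i j} → j ≢ i → lookup (𝐞 i) j ≡ 0
  lookup-𝐞-≢ {i} {j} ne = ≡.trans (Vecₚ.lookup∘update′ ne 𝟎 1) (Vecₚ.lookup-replicate j 0)

  sum-⊕ : ∀ m m′ → Vec.sum (m ⊕ m′) ≡ Vec.sum m ℕ.+ Vec.sum m′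
  sum-⊕ = go
    where
    go : ∀ {n} (m m′ : Vec ℕ n) → Vec.sum (zipWith ℕ._+_ m m′) ≡ Vec.sum m ℕ.+ Vec.sum m′
    go Vec.[]      Vec.[]        = ≡.refl
    go (x Vec.∷ m) (y Vec.∷ m′) =
      ≡.trans (≡.cong (x ℕ.+ y ℕ.+_) (go m m′)) (ℕ-interchange x y (Vec.sum m) (Vec.sum m′))
      where open import Algebra.Properties.CommutativeSemigroup ℕₚ.+-commutativeSemigroup
              using () renaming (interchange to ℕ-interchange)

  sum-𝟎 : Vec.sum 𝟎 ≡ 0
  sum-𝟎 = go d
    where
    go : ∀ n → Vec.sum (replicate n 0) ≡ 0
    go zero    = ≡.refl
    go (suc n) = go n

  divides? : ∀ m₁ m → Dec (∃ λ m₂ → m₁ ⊕ m₂ ≡ m)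
  divides? = go
    where
    go : ∀ {n} (m₁ m : Vec ℕ n) → Dec (∃ λ m₂ → zipWith ℕ._+_ m₁ m₂ ≡ m)
    go Vec.[]       Vec.[]      = yes (Vec.[] , ≡.refl)
    go (x Vec.∷ m₁) (y Vec.∷ m) with x ℕ.≤? y | go m₁ m
    ... | yes x≤y | yes (m₂ , eq) = yes (y ∸ x Vec.∷ m₂ , ≡.cong₂ Vec._∷_ (ℕₚ.m+[n∸m]≡n x≤y) eq)
    ... | no x≰y  | _             = no λ { (z Vec.∷ m₂ , eq) →
                                      x≰y (≡.subst (x ≤_) (Vecₚ.∷-injectiveˡ eq) (ℕₚ.m≤m+n x z)) }
    ... | yes _   | no ¬r         = no λ { (z Vec.∷ m₂ , eq) → ¬r (m₂ , Vecₚ.∷-injectiveʳ eq) }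

  split-𝐞 : ∀ i {s} m → lookup m i ≡ suc s → ∃ λ m′ → 𝐞 i ⊕ m′ ≡ m × lookup m′ i ≡ s
  split-𝐞 i {s} m eq = m′ , eq′ , ℕₚ.suc-injective (≡.trans (≡.sym lk) eq)
    where
    go : ∀ {n} (i : Fin n) m → lookup m i ≡ suc s → ∃ λ m′ → zipWith ℕ._+_ (replicate n 0 [ i ]≔ 1) m′ ≡ m
    go zero    (.(suc s) Vec.∷ m) ≡.refl = s Vec.∷ m , ≡.cong (suc s Vec.∷_) (Vecₚ.zipWith-identityˡ ℕₚ.+-identityˡ m)
    go (suc i) (x Vec.∷ m)        eq     = let m′ , eq′ = go i m eq in x Vec.∷ m′ , ≡.cong (x Vec.∷_) eq′
    m′ : M
    m′ = proj₁ (go i m eq)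
    eq′ : 𝐞 i ⊕ m′ ≡ m
    eq′ = proj₂ (go i m eq)
    lk : lookup m i ≡ suc (lookup m′ i)
    lk = ≡.trans (≡.cong (λ z → lookup z i) (≡.sym eq′))
           (≡.trans (lookup-⊕ i (𝐞 i) m′) (≡.cong (ℕ._+ lookup m′ i) (lookup-𝐞 i)))

  coeff-var-* : ∀ i p m → coeff K (_*P_ K (var K i) p) m ≈ ext (λ m₂ → ind m (𝐞 i ⊕ m₂)) p
  coeff-var-* i p m = trans (coeff-*P (var K i) p m) (trans (+-identityʳ _) (*-identityˡ _))

  ext-ind-⊕ : ∀ m₁ p m → ext (λ m₂ → ind (m₁ ⊕ m) (m₁ ⊕ m₂)) p ≈ coeff K p m
  ext-ind-⊕ m₁ p m = trans (ext-cong same p) (sym (coeff-ext p m))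
    where
    same : ∀ m₂ → ind (m₁ ⊕ m) (m₁ ⊕ m₂) ≈ ind m m₂
    same m₂ with m₂ ≟M m
    ... | yes eq = ind-yes (≡.cong (m₁ ⊕_) eq)
    ... | no ne  = ind-no (ne ∘ ⊕-cancelˡ m₁)

  ext-ind-none : ∀ m₁ p m → ¬ (∃ λ m₂ → m₁ ⊕ m₂ ≡ m) → ext (λ m₂ → ind m (m₁ ⊕ m₂)) p ≈ 0#
  ext-ind-none m₁ p m ¬div = trans (ext-cong (λ m₂ → ind-no λ eq → ¬div (m₂ , eq)) p) (ext-0 p)

  coeff-var-⊕ : ∀ i p m → coeff K (_*P_ K (var K i) p) (𝐞 i ⊕ m) ≈ coeff K p m
  coeff-var-⊕ i p m = trans (coeff-var-* i p (𝐞 i ⊕ m)) (ext-ind-⊕ (𝐞 i) p m)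

  coeff-var-0 : ∀ i p m → lookup m i ≡ 0 → coeff K (_*P_ K (var K i) p) m ≈ 0#
  coeff-var-0 i p m eq = trans (coeff-var-* i p m) (ext-ind-none (𝐞 i) p m λ { (m₂ , eq₂) →
    ℕₚ.1+n≢0 (≡.trans (≡.sym (≡.trans (lookup-⊕ i (𝐞 i) m₂) (≡.cong (ℕ._+ lookup m₂ i) (lookup-𝐞 i))))
                      (≡.trans (≡.cong (λ z → lookup z i) eq₂) eq)) })

  x[_] : Fin d → S
  x[ i ] = var K i

  coeff-lin-* : ∀ a b p m → coeff K ((x[ a ] 𝕊.- x[ b ]) 𝕊.* p) m
                            ≈ coeff K (x[ a ] 𝕊.* p) m + - coeff K (x[ b ] 𝕊.* p) m
  coeff-lin-* a b p m = begin
    coeff K ((x[ a ] 𝕊.- x[ b ]) 𝕊.* p) m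
      ≈⟨ at (𝕊.distribʳ p x[ a ] (𝕊.- x[ b ])) m ⟩
    coeff K (x[ a ] 𝕊.* p 𝕊.+ (𝕊.- x[ b ]) 𝕊.* p) m
      ≈⟨ coeff-++ (x[ a ] 𝕊.* p) _ m ⟩
    coeff K (x[ a ] 𝕊.* p) m + coeff K ((𝕊.- x[ b ]) 𝕊.* p) m
      ≈⟨ +-congˡ (at (𝕊-neg x[ b ] p) m) ⟨
    coeff K (x[ a ] 𝕊.* p) m + coeff K (𝕊.- (x[ b ] 𝕊.* p)) m
      ≈⟨ +-congˡ (coeff-neg (x[ b ] 𝕊.* p) m) ⟩
    coeff K (x[ a ] 𝕊.* p) m + - coeff K (x[ b ] 𝕊.* p) m ∎
    where open import Algebra.Properties.Ring 𝕊.ring using () renaming (-‿distribˡ-* to 𝕊-neg)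

  -- Absence of the variable y_a, not freeness of a module. It is a condition on coefficients, since
  -- the list may contain terms that cancel.
  Free : Fin d → S → Set ℓ
  Free a p = ∀ m → lookup m a ≢ 0 → coeff K p m ≈ 0#

  -- If y_a does not occur in (y_a − y_b)t, the coefficient of t at m equals the one at
  -- m·y_a/y_b, and it vanishes once the exponent of y_b is used up.
  free-multiple : ∀ {a b} t → a ≢ b → Free a ((x[ a ] 𝕊.- x[ b ]) 𝕊.* t) → t ≋ []
  free-multiple {a} {b} t a≢b free = mk≋ λ m → go (lookup m b) m ≡.refl
    where
    step : ∀ m → coeff K t m ≈ coeff K (x[ b ] 𝕊.* t) (𝐞 a ⊕ m)
    step m = trans (sym (coeff-var-⊕ a t m)) (+-cancelʳ _ _ _ (trans
      (trans (sym (coeff-lin-* a b t (𝐞 a ⊕ m))) (free (𝐞 a ⊕ m) nonzero)) (sym (-‿inverseʳ _))))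
      where
      nonzero : lookup (𝐞 a ⊕ m) a ≢ 0
      nonzero eq = ℕₚ.1+n≢0 (≡.trans (≡.sym (≡.trans (lookup-⊕ a (𝐞 a) m) (≡.cong (ℕ._+ lookup m a) (lookup-𝐞 a)))) eq)
    at-b : ∀ m → lookup (𝐞 a ⊕ m) b ≡ lookup m b
    at-b m = ≡.trans (lookup-⊕ b (𝐞 a) m) (≡.cong (ℕ._+ lookup m b) (lookup-𝐞-≢ (a≢b ∘ ≡.sym)))
    go : ∀ s m → lookup m b ≡ s → coeff K t m ≈ 0#
    go zero    m eq = trans (step m) (coeff-var-0 b t (𝐞 a ⊕ m) (≡.trans (at-b m) eq))
    go (suc s) m eq = let m′ , eq′ , lk = split-𝐞 b (𝐞 a ⊕ m) (≡.trans (at-b m) eq) in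
      trans (step m) (trans (reflexive (≡.cong (coeff K (x[ b ] 𝕊.* t)) (≡.sym eq′)))
        (trans (coeff-var-⊕ b t m′) (go s m′ lk)))

  lin-cancel : ∀ {a b} t → a ≢ b → (x[ a ] 𝕊.- x[ b ]) 𝕊.* t ≋ [] → t ≋ []
  lin-cancel t a≢b eq = free-multiple t a≢b (λ m _ → at eq m)

  free-+ : ∀ a {p q} → Free a p → Free a q → Free a (p 𝕊.+ q)
  free-+ a {p} {q} fp fq m ne = trans (coeff-++ p q m) (trans (+-cong (fp m ne) (fq m ne)) (+-identityˡ 0#))

  free-var : ∀ {a b} p → a ≢ b → Free a p → Free a (x[ b ] 𝕊.* p)
  free-var {a} {b} p a≢b fp m ne with lookup m b in eq
  ... | zero  = coeff-var-0 b p m eq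
  ... | suc s = let m′ , eq′ , _ = split-𝐞 b m eq in
    trans (reflexive (≡.cong (coeff K (x[ b ] 𝕊.* p)) (≡.sym eq′))) (trans (coeff-var-⊕ b p m′)
      (fp m′ λ z → ne (≡.trans (≡.cong (λ v → lookup v a) (≡.sym eq′))
        (≡.trans (lookup-⊕ a (𝐞 b) m′) (≡.cong₂ ℕ._+_ (lookup-𝐞-≢ a≢b) z)))))

  free-lin : ∀ {a b b′} p → a ≢ b → a ≢ b′ → Free a p → Free a ((x[ b ] 𝕊.- x[ b′ ]) 𝕊.* p)
  free-lin {a} {b} {b′} p ne ne′ fp m nz = trans (coeff-lin-* b b′ p m)
    (trans (+-cong (free-var p ne fp m nz) (trans (-‿cong (free-var p ne′ fp m nz)) -0#≈0#)) (+-identityˡ 0#))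

  record Division (a w : Fin d) (p : S) : Set (c ⊔ ℓ) where
    constructor division
    field
      quot rem : S
      eqn      : p ≋ (x[ a ] 𝕊.- x[ w ]) 𝕊.* quot 𝕊.+ rem
      rem-free : Free a rem

  -- The remainder arises by substituting x_w for x_a. This is done term by term, by recursion on
  -- the exponent of x_a.
  divide : ∀ {a w} → a ≢ w → ∀ p → Division a w p
  divide {a} {w} a≢w = go
    where
    open DivisionIdentities polyRing using (division-*var; division-+)
    D : S
    D = x[ a ] 𝕊.- x[ w ]

    term : ∀ s b m → lookup m a ≡ s → Division a w ((b , m) ∷ [])
    term zero    b m eq = division [] ((b , m) ∷ []) (mk≋ λ m′ → sym (at (𝕊.+-congʳ {(b , m) ∷ []} {D 𝕊.* []} {[]} (𝕊.zeroʳ D)) m′)) free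
      where
      free : Free a ((b , m) ∷ [])
      free m′ ne = trans (coeff-ext ((b , m) ∷ []) m′) (trans (+-identityʳ _)
        (trans (*-congˡ (ind-no {m′} {m} λ { ≡.refl → ne eq })) (zeroʳ b)))
    term (suc s) b m eq with split-𝐞 a m eq
    ... | m′ , ≡.refl , lk with term s b m′ lk
    ... | division h r e free = division (x[ a ] 𝕊.* h 𝕊.+ r) (x[ w ] 𝕊.* r)
      (𝕊.trans (from-ext unfold) (division-*var x[ a ] x[ w ] {(b , m′) ∷ []} h r e)) (free-var r a≢w free)
      where
      unfold : ∀ f → ext f ((b , 𝐞 a ⊕ m′) ∷ []) ≈ ext f (x[ a ] 𝕊.* ((b , m′) ∷ []))
      unfold f = +-congʳ (*-congʳ (sym (*-identityˡ b)))

    go : ∀ p → Division a w p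
    go []            = division [] [] (mk≋ λ m → sym (at (𝕊.zeroʳ D) m)) (λ _ _ → refl)
    go ((b , m) ∷ p) with term _ b m ≡.refl | go p
    ... | division h r e free | division h′ r′ e′ free′ = division (h 𝕊.+ h′) (r 𝕊.+ r′)
      (division-+ {D} {(b , m) ∷ []} {p} {h} {h′} {r} {r′} e e′) (free-+ a {r} {r′} free free′)

  -- This stands in for unique factorisation. The remainder r of h modulo x_a - x_w satisfies (x_w -
  -- x_u) r = (x_a - x_w) t. The left side is free of x_a, hence t = 0, and then r = 0 because u and
  -- w differ.
  lin-coprime : ∀ {a u w} → a ≢ u → a ≢ w → u ≢ w → ∀ h q →
                (x[ a ] 𝕊.- x[ u ]) 𝕊.* h ≋ (x[ a ] 𝕊.- x[ w ]) 𝕊.* q →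
                ∃ λ k → h ≋ (x[ a ] 𝕊.- x[ w ]) 𝕊.* k
  lin-coprime {a} {u} {w} a≢u a≢w u≢w h q eq with divide a≢w h
  ... | division k r e free = k , 𝕊.trans e (mk≋ λ m →
          trans (coeff-++ (D 𝕊.* k) r m) (trans (+-congˡ (at r≋0 m)) (+-identityʳ _)))
    where
    D t : S
    D = x[ a ] 𝕊.- x[ w ]
    t = q 𝕊.- ((x[ a ] 𝕊.- x[ u ]) 𝕊.* k 𝕊.+ r)
    multiple : (x[ w ] 𝕊.- x[ u ]) 𝕊.* r ≋ D 𝕊.* t
    multiple = DivisionIdentities.remainder-multiple polyRing x[ a ] x[ u ] x[ w ] {h} {q} {k} {r} e eq
    t≋0 : t ≋ []
    t≋0 = free-multiple t a≢w λ m ne → trans (sym (at multiple m)) (free-lin r a≢w a≢u free m ne)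
    r≋0 : r ≋ []
    r≋0 = lin-cancel r (u≢w ∘ ≡.sym) (𝕊.trans multiple (𝕊.trans (𝕊.*-congˡ {D} t≋0) (𝕊.zeroʳ D)))

  homogeneous-0 : ∀ e → Homogeneous K {d} e []
  homogeneous-0 e m ne = refl

  homogeneous-1 : Homogeneous K 0 1P
  homogeneous-1 m ne = trans (coeff-ext 1P m) (trans (ext-1P (ind m)) (ind-no {m} {𝟎} λ { ≡.refl → ne sum-𝟎 }))

  homogeneous-var : ∀ {e} i q → Homogeneous K e q → Homogeneous K (suc e) (x[ i ] 𝕊.* q)
  homogeneous-var i q hq m ne with lookup m i in eq
  ... | zero  = coeff-var-0 i q m eq
  ... | suc s with split-𝐞 i m eq
  ...   | m′ , ≡.refl , _ = trans (coeff-var-⊕ i q m′)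
          (hq m′ λ z → ne (≡.trans (sum-⊕ (𝐞 i) m′) (≡.cong₂ ℕ._+_ (sum-𝐞 i) z)))
    where
    sum-𝐞 : ∀ i → Vec.sum (𝐞 i) ≡ 1
    sum-𝐞 = go
      where
      sum-0 : ∀ n → Vec.sum (replicate n 0) ≡ 0
      sum-0 zero    = ≡.refl
      sum-0 (suc n) = sum-0 n
      go : ∀ {n} (i : Fin n) → Vec.sum (replicate n 0 [ i ]≔ 1) ≡ 1
      go {suc n} zero    = ≡.cong suc (sum-0 n)
      go         (suc i) = go i

  homogeneous-lin : ∀ {e} a b q → Homogeneous K e q → Homogeneous K (suc e) ((x[ a ] 𝕊.- x[ b ]) 𝕊.* q)
  homogeneous-lin a b q hq m ne = trans (coeff-lin-* a b q m)
    (trans (+-cong (homogeneous-var a q hq m ne) (-‿cong (homogeneous-var b q hq m ne)))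
           (-‿inverseʳ 0#))

  -- The homogeneous part of degree t - f, the only one that reaches degree t in a product with a
  -- form of degree f. The condition is written as a sum, so for f > t the result is zero and not
  -- the constant term that truncated subtraction would select.
  component : ℕ → ℕ → S → S
  component t f []            = []
  component t f ((a , m) ∷ p) with Vec.sum m ℕ.+ f ℕ.≟ t
  ... | yes _ = (a , m) ∷ component t f p
  ... | no  _ = component t f p

  ext-component : ∀ t f {g h} → (∀ m → Vec.sum m ℕ.+ f ≡ t → g m ≈ h m) →
                  (∀ m → Vec.sum m ℕ.+ f ≢ t → h m ≈ 0#) →
                  ∀ p → ext g (component t f p) ≈ ext h p
  ext-component t f g≈h h≈0 []            = refl
  ext-component t f g≈h h≈0 ((a , m) ∷ p) with Vec.sum m ℕ.+ f ℕ.≟ t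
  ... | yes eq = +-cong (*-congˡ (g≈h m eq)) (ext-component t f g≈h h≈0 p)
  ... | no ne  = trans (ext-component t f g≈h h≈0 p)
                   (sym (trans (+-congʳ (trans (*-congˡ (h≈0 m ne)) (zeroʳ a))) (+-identityˡ _)))

  ext-ind-homogeneous : ∀ {f q} → Homogeneous K f q → ∀ m₁ m → Vec.sum m₁ ℕ.+ f ≢ Vec.sum m →
                        ext (λ m₂ → ind m (m₁ ⊕ m₂)) q ≈ 0#
  ext-ind-homogeneous {f} {q} hq m₁ m ne with divides? m₁ m
  ... | no ¬div             = ext-ind-none m₁ q m ¬div
  ... | yes (m₂ , ≡.refl)   = trans (ext-ind-⊕ m₁ q m₂)
          (hq m₂ λ z → ne (≡.sym (≡.trans (sum-⊕ m₁ m₂) (≡.cong (Vec.sum m₁ ℕ.+_) z))))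

  coeff-component-* : ∀ {t f} p {q} → Homogeneous K f q → ∀ m → Vec.sum m ≡ t →
                      coeff K (component t f p 𝕊.* q) m ≈ coeff K (p 𝕊.* q) m
  coeff-component-* {t} {f} p {q} hq m ≡.refl = begin
    coeff K (component t f p 𝕊.* q) m                                ≈⟨ coeff-*P (component t f p) q m ⟩
    ext (λ m₁ → ext (λ m₂ → ind m (m₁ ⊕ m₂)) q) (component t f p)    ≈⟨ ext-component t f (λ _ _ → refl) (λ m₁ ne → ext-ind-homogeneous {q = q} hq m₁ m ne) p ⟩
    ext (λ m₁ → ext (λ m₂ → ind m (m₁ ⊕ m₂)) q) p                    ≈⟨ coeff-*P p q m ⟨
    coeff K (p 𝕊.* q) m                                              ∎

  homogeneous-component-* : ∀ {t f} p {q} → Homogeneous K f q → Homogeneous K t (component t f p 𝕊.* q)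
  homogeneous-component-* {t} {f} p {q} hq m ne = begin
    coeff K (component t f p 𝕊.* q) m                                ≈⟨ coeff-*P (component t f p) q m ⟩
    ext (λ m₁ → ext (λ m₂ → ind m (m₁ ⊕ m₂)) q) (component t f p)    ≈⟨ ext-component t f (λ m₁ eq → ext-ind-homogeneous {q = q} hq m₁ m λ z → ne (≡.trans (≡.sym z) eq)) (λ _ _ → refl) p ⟩
    ext (λ _ → 0#) p                                                 ≈⟨ ext-0 p ⟩
    0#                                                               ∎

  const : S → 𝕂
  const p = coeff K p 𝟎

  const-component : ∀ t p → const (component t t p) ≈ const p
  const-component t p = trans (coeff-ext (component t t p) 𝟎) (trans
    (ext-component t t (λ _ _ → refl) (λ m ne → ind-no {𝟎} {m} λ { ≡.refl → ne (≡.cong (ℕ._+ t) sum-𝟎) }) p)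
    (sym (coeff-ext p 𝟎)))

  const-cong : ∀ {p q} → p ≋ q → const p ≈ const q
  const-cong eq = at eq 𝟎

  const-1 : const 1P ≈ 1#
  const-1 = trans (coeff-ext 1P 𝟎) (trans (ext-1P (ind 𝟎)) (ind-yes {𝟎} {𝟎} ≡.refl))

  const-* : ∀ p q → const (p 𝕊.* q) ≈ const p * const q
  const-* p q = begin
    const (p 𝕊.* q)                                  ≈⟨ coeff-*P p q 𝟎 ⟩
    ext (λ m₁ → ext (λ m₂ → ind 𝟎 (m₁ ⊕ m₂)) q) p    ≈⟨ ext-cong inner p ⟩
    ext (λ m₁ → const q * ind 𝟎 m₁) p                ≈⟨ ext-*ˡ (const q) (ind 𝟎) p ⟩
    const q * ext (ind 𝟎) p                          ≈⟨ *-congˡ (coeff-ext p 𝟎) ⟨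
    const q * const p                                ≈⟨ *-comm _ _ ⟩
    const p * const q                                ∎
    where
    ⊕-zero : ∀ {n} (m₁ m₂ : Vec ℕ n) → zipWith ℕ._+_ m₁ m₂ ≡ replicate n 0 → m₁ ≡ replicate n 0
    ⊕-zero Vec.[]             Vec.[]        _  = ≡.refl
    ⊕-zero (zero Vec.∷ m₁)    (y Vec.∷ m₂)  eq = ≡.cong (0 Vec.∷_) (⊕-zero m₁ m₂ (Vecₚ.∷-injectiveʳ eq))
    ⊕-zero (suc x Vec.∷ m₁)   (y Vec.∷ m₂)  eq = ⊥-elim (ℕₚ.1+n≢0 (Vecₚ.∷-injectiveˡ eq))
    inner : ∀ m₁ → ext (λ m₂ → ind 𝟎 (m₁ ⊕ m₂)) q ≈ const q * ind 𝟎 m₁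
    inner m₁ with m₁ ≟M 𝟎
    ... | yes ≡.refl = trans (ext-cong (λ m₂ → reflexive (≡.cong (ind 𝟎) (⊕-identityˡ m₂))) q)
                         (trans (sym (coeff-ext q 𝟎)) (sym (*-identityʳ _)))
    ... | no ne      = trans (ext-ind-none m₁ q 𝟎 λ { (m₂ , eq) → ne (⊕-zero m₁ m₂ eq) }) (sym (zeroʳ _))

-- Finite sums and matrix products

module SumLemmas {c ℓ : Level} (R : CommutativeRing c ℓ) where
  open CommutativeRing R hiding (zero)
  open import Algebra.Properties.Semiring.Sum semiring public
  open import Algebra.Properties.AbelianGroup +-abelianGroup
    using () renaming (⁻¹-∙-comm to -‿+-comm; ε⁻¹≈ε to -0#≈0#)

  sum-cong : ∀ {n} {f g : Fin n → Carrier} → (∀ i → f i ≈ g i) → sum f ≈ sum g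
  sum-cong eq = sum-cong-≋ eq

  sum-zero : ∀ {n} (f : Fin n → Carrier) → (∀ i → f i ≈ 0#) → sum f ≈ 0#
  sum-zero {n} f f≈0 = trans (sum-cong f≈0) (sum-replicate-zero n)

  sum-single : ∀ {n} (f : Fin n → Carrier) i → (∀ j → j ≢ i → f j ≈ 0#) → sum f ≈ f i
  sum-single f zero    f≈0 = trans (+-congˡ (sum-zero _ λ j → f≈0 (suc j) λ ())) (+-identityʳ _)
  sum-single f (suc i) f≈0 = trans (+-cong (f≈0 zero λ ())
    (sum-single _ i λ j ne → f≈0 (suc j) (ne ∘ Finₚ.suc-injective))) (+-identityˡ _)

  sum-neg : ∀ {n} (f : Fin n → Carrier) → - sum f ≈ sum (λ a → - f a)
  sum-neg {ℕ.zero}  f = -0#≈0#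
  sum-neg {ℕ.suc n} f = trans (sym (-‿+-comm _ _)) (+-congˡ (sum-neg (f ∘ suc)))

module MatrixLemmas {c ℓ : Level} (R : CommutativeRing c ℓ) where
  open CommutativeRing R hiding (zero)
  open SumLemmas R
  open import Relation.Binary.Reasoning.Setoid setoid

  sum-assoc : ∀ {l n} (u : Fin l → Carrier) (A : Fin l → Fin n → Carrier) (v : Fin n → Carrier) →
              sum (λ j → u j * sum (λ a → A j a * v a)) ≈ sum (λ a → sum (λ j → u j * A j a) * v a)
  sum-assoc u A v = begin
    sum (λ j → u j * sum (λ a → A j a * v a))     ≈⟨ sum-cong (λ j → *-distribˡ-sum (u j) (λ a → A j a * v a)) ⟩
    sum (λ j → sum (λ a → u j * (A j a * v a)))   ≈⟨ ∑-comm (λ j a → u j * (A j a * v a)) ⟩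
    sum (λ a → sum (λ j → u j * (A j a * v a)))   ≈⟨ sum-cong (λ a → sum-cong (λ j → *-assoc (u j) (A j a) (v a))) ⟨
    sum (λ a → sum (λ j → (u j * A j a) * v a))   ≈⟨ sum-cong (λ a → *-distribʳ-sum (v a) (λ j → u j * A j a)) ⟨
    sum (λ a → sum (λ j → u j * A j a) * v a)     ∎

  δ : ∀ {n} → Fin n → Fin n → Carrier
  δ i j with j Fin.≟ i
  ... | yes _ = 1#
  ... | no _  = 0#

  δ-≢ : ∀ {n} {i j : Fin n} → j ≢ i → δ i j ≈ 0#
  δ-≢ {i = i} {j} ne with j Fin.≟ i
  ... | yes eq = ⊥-elim (ne eq)
  ... | no _   = refl

  δ-diag : ∀ {n} (i : Fin n) → δ i i ≈ 1#
  δ-diag i with i Fin.≟ i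
  ... | yes _ = refl
  ... | no ne = ⊥-elim (ne ≡.refl)

  sum-δ : ∀ {n} (i : Fin n) (v : Fin n → Carrier) → sum (λ j → δ i j * v j) ≈ v i
  sum-δ i v = begin
    sum (λ j → δ i j * v j)    ≈⟨ sum-single (λ j → δ i j * v j) i (λ j ne → trans (*-congʳ (δ-≢ ne)) (zeroˡ (v j))) ⟩
    δ i i * v i                ≈⟨ *-congʳ (δ-diag i) ⟩
    1# * v i                   ≈⟨ *-identityˡ (v i) ⟩
    v i                        ∎

-- Free bases from Newton interpolation

-- A clique of hubs together with leaves attached to hubs; nbrs is ignored at the hubs.
record System (d : ℕ) : Set where
  field
    r           : ℕ
    hub         : Fin r → Fin d
    hub-inj     : ∀ {i j} → hub i ≡ hub j → i ≡ j
    nbrs        : Fin d → List (Fin r)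
    nbrs-unique : ∀ v → Unique (nbrs v)

  IsHub : Fin d → Set
  IsHub v = ∃ λ i → hub i ≡ v

  hub? : ∀ v → Dec (IsHub v)
  hub? v = Finₚ.any? (λ i → hub i Fin.≟ v)

  below : Fin r → List (Fin r)
  below i = List.map Fin.inject (List.allFin (toℕ i))

  private
    choose : ∀ {a} {A : Set a} {v} → (Fin r → A) → A → Dec (IsHub v) → A
    choose f z (yes (i , _)) = f i
    choose f z (no _)        = z

  earlier : Fin d → List (Fin r)
  earlier v = choose below (nbrs v) (hub? v)

  N : Fin d → List (Fin d)
  N v = List.map hub (earlier v)

  deg : Fin d → ℕ
  deg v = length (earlier v)

  -- All leaves share the top rank `r`: since `N v` consists of hubs, leaves need no order among
  -- themselves.
  rank : Fin d → ℕ
  rank v = choose toℕ r (hub? v)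

  earlier-hub : ∀ i → earlier (hub i) ≡ below i
  earlier-hub i with hub? (hub i)
  ... | yes (j , eq) = ≡.cong below (hub-inj eq)
  ... | no ¬h        = ⊥-elim (¬h (i , ≡.refl))

  earlier-leaf : ∀ {v} → ¬ IsHub v → earlier v ≡ nbrs v
  earlier-leaf {v} ¬h with hub? v
  ... | yes h = ⊥-elim (¬h h)
  ... | no _  = ≡.refl

  deg-hub : ∀ i → deg (hub i) ≡ toℕ i
  deg-hub i = ≡.trans (≡.cong length (earlier-hub i))
    (≡.trans (Listₚ.length-map Fin.inject (List.allFin (toℕ i))) (Listₚ.length-tabulate id))

  deg-leaf : ∀ {v} → ¬ IsHub v → deg v ≡ length (nbrs v)
  deg-leaf ¬h = ≡.cong length (earlier-leaf ¬h)

  rank-hub : ∀ i → rank (hub i) ≡ toℕ i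
  rank-hub i with hub? (hub i)
  ... | yes (j , eq) = ≡.cong toℕ (hub-inj eq)
  ... | no ¬h        = ⊥-elim (¬h (i , ≡.refl))

  rank≤r : ∀ v → rank v ≤ r
  rank≤r v with hub? v
  ... | yes (i , _) = ℕₚ.<⇒≤ (Finₚ.toℕ<n i)
  ... | no _        = ℕₚ.≤-refl

  ∈-below⁺ : ∀ {i j} → toℕ j < toℕ i → j ∈ below i
  ∈-below⁺ {i} {j} j<i = ≡.subst (_∈ below i)
    (Finₚ.toℕ-injective (≡.trans (Finₚ.toℕ-inject (Fin.fromℕ< j<i)) (Finₚ.toℕ-fromℕ< j<i)))
    (∈-map⁺ Fin.inject (∈-allFin (Fin.fromℕ< j<i)))

  ∈-below⁻ : ∀ {i j} → j ∈ below i → toℕ j < toℕ i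
  ∈-below⁻ {i} j∈ with ∈-map⁻ Fin.inject j∈
  ... | k , _ , ≡.refl = ≡.subst (_< toℕ i) (≡.sym (Finₚ.toℕ-inject k)) (Finₚ.toℕ<n k)

  N-unique : ∀ v → Unique (N v)
  N-unique v with hub? v
  ... | yes (i , _) = Uniqueₚ.map⁺ hub-inj (Uniqueₚ.map⁺ inject-injective (Uniqueₚ.allFin⁺ (toℕ i)))
    where
    inject-injective : ∀ {j k : Fin (toℕ i)} → Fin.inject j ≡ Fin.inject k → j ≡ k
    inject-injective {j} {k} eq = Finₚ.toℕ-injective
      (≡.trans (≡.sym (Finₚ.toℕ-inject j)) (≡.trans (≡.cong toℕ eq) (Finₚ.toℕ-inject k)))
  ... | no _        = Uniqueₚ.map⁺ hub-inj (nbrs-unique v)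

  N-hub : ∀ {v u} → u ∈ N v → IsHub u
  N-hub u∈ with ∈-map⁻ hub u∈
  ... | j , _ , eq = j , ≡.sym eq

  N-rank : ∀ {v u} → u ∈ N v → rank u < rank v
  N-rank {v} u∈ with ∈-map⁻ hub u∈
  ... | j , j∈ , ≡.refl with hub? v
  ...   | yes (i , _) = ≡.subst (_< toℕ i) (≡.sym (rank-hub j)) (∈-below⁻ j∈)
  ...   | no _        = ≡.subst (_< r) (≡.sym (rank-hub j)) (Finₚ.toℕ<n j)

  v∉N : ∀ v → v ∉ N v
  v∉N v v∈ = ℕₚ.<-irrefl ≡.refl (N-rank v∈)

  hub-∈N : ∀ {i j} → toℕ j < toℕ i → hub j ∈ N (hub i)
  hub-∈N {i} {j} j<i = ∈-map⁺ hub (≡.subst (j ∈_) (≡.sym (earlier-hub i)) (∈-below⁺ j<i))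

  N-intro : ∀ {v j} → ¬ IsHub v → j ∈ nbrs v → hub j ∈ N v
  N-intro {v} {j} ¬h j∈ = ∈-map⁺ hub (≡.subst (j ∈_) (≡.sym (earlier-leaf ¬h)) j∈)

  N-elim : ∀ {q} (Q : Fin d → Fin d → Set q) → (∀ {i j} → toℕ j < toℕ i → Q (hub i) (hub j)) →
           (∀ {v j} → ¬ IsHub v → j ∈ nbrs v → Q v (hub j)) → ∀ {v u} → u ∈ N v → Q v u
  N-elim Q hubs leaves {v} u∈ with ∈-map⁻ hub u∈
  ... | j , j∈ , ≡.refl with hub? v
  ...   | yes (i , ≡.refl) = hubs (∈-below⁻ j∈)
  ...   | no ¬h            = leaves ¬h j∈

  -- A leaf has rank `r`, beyond every hub index, so `a` is a hub, and an earlier one.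
  smaller-rank : ∀ {i a} → a ≢ hub i → rank a ≤ toℕ i → a ∈ N (hub i)
  smaller-rank {i} {a} a≢ ra≤ with hub? a in eq
  ... | no _             = ⊥-elim (ℕₚ.<⇒≱ (Finₚ.toℕ<n i) ra≤)
  ... | yes (j , ≡.refl) = hub-∈N (ℕₚ.≤∧≢⇒< ra≤ λ z → a≢ (≡.cong hub (Finₚ.toℕ-injective z)))

-- Newton interpolation: dividing by P_a at the a-th step, the elements Θ a form a basis of
-- the module of tuples φ such that x_a − x_u divides φ_a − φ_u for u ∈ N a.
module NewtonBasis {c ℓ : Level} (R : CommutativeRing c ℓ) where
  open CommutativeRing R hiding (zero)
  open SumLemmas R
  open MatrixLemmas R
  open DivisionIdentities R using (x-z≈[x-y]+[y-z]; x≈x-y+y)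
  open import Algebra.Properties.Ring ring using (-‿distribʳ-*; -‿distribˡ-*; x∙y⁻¹≈ε⇒x≈y)
  open import Algebra.Properties.AbelianGroup +-abelianGroup
    using () renaming (⁻¹-∙-comm to -‿+-comm; ε⁻¹≈ε to -0#≈0#; ⁻¹-involutive to -‿involutive)
  open import Algebra.Properties.CommutativeSemigroup +-commutativeSemigroup
    using () renaming (interchange to +-interchange)
  open import Algebra.Properties.CommutativeSemigroup *-commutativeSemigroup
    using () renaming (x∙yz≈y∙xz to x*yz≈y*xz)
  open import Relation.Binary.Reasoning.Setoid setoid

  -- The ring enters through two properties of the differences x_a - x_b: they are not zero
  -- divisors, and two of them with the same `a` are coprime.
  module Basis {d : ℕ} (x : Fin d → Carrier)
    (cancel : ∀ {a b} p → a ≢ b → (x a - x b) * p ≈ 0# → p ≈ 0#)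
    (coprime : ∀ {a u w} → a ≢ u → a ≢ w → u ≢ w → ∀ h q →
               (x a - x u) * h ≈ (x a - x w) * q → ∃ λ k → h ≈ (x a - x w) * k)
    (E : System d) where
    open System E

    P : List (Fin d) → Carrier → Carrier
    P []       t = 1#
    P (u ∷ us) t = (t - x u) * P us t

    infix 4 _∣_
    _∣_ : Carrier → Carrier → Set (c ⊔ ℓ)
    D ∣ p = ∃ λ h → p ≈ D * h

    ∣-0 : ∀ {D p} → p ≈ 0# → D ∣ p
    ∣-0 {D} p≈0 = 0# , trans p≈0 (sym (zeroʳ D))

    ∣-+ : ∀ {D p q} → D ∣ p → D ∣ q → D ∣ p + q
    ∣-+ (h , e) (k , e′) = h + k , trans (+-cong e e′) (sym (distribˡ _ _ _))

    ∣-neg : ∀ {D p} → D ∣ p → D ∣ - p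
    ∣-neg (h , e) = - h , trans (-‿cong e) (-‿distribʳ-* _ _)

    ∣-* : ∀ {D p} q → D ∣ p → D ∣ q * p
    ∣-* q (h , e) = q * h , trans (*-congˡ e) (x*yz≈y*xz _ _ _)

    ∣-resp : ∀ {D p q} → p ≈ q → D ∣ p → D ∣ q
    ∣-resp eq (h , e) = h , trans (sym eq) e

    x-y≈-[y-x] : ∀ p q → p - q ≈ - (q - p)
    x-y≈-[y-x] p q = trans (+-congʳ (sym (-‿involutive p)))
      (trans (+-comm _ _) (-‿+-comm q (- p)))

    -- The discrete product rule: the first factors differ by `y`, which multiplies `Qᵢ`, and the
    -- factor `z` multiplies the difference of the remaining products.
    P-diff : ∀ us i j → x i - x j ∣ P us (x i) - P us (x j)
    P-diff []       i j = ∣-0 (-‿inverseʳ 1#)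
    P-diff (u ∷ us) i j = ∣-resp identity (∣-+ (Qᵢ , refl) (∣-* z (P-diff us i j)))
      where
      Qᵢ Qⱼ y z : Carrier
      Qᵢ = P us (x i)
      Qⱼ = P us (x j)
      y = x i - x j
      z = x j - x u
      identity : y * Qᵢ + z * (Qᵢ - Qⱼ) ≈ (x i - x u) * Qᵢ - z * Qⱼ
      identity = begin
        y * Qᵢ + z * (Qᵢ - Qⱼ)            ≈⟨ +-congˡ (distribˡ _ _ _) ⟩
        y * Qᵢ + (z * Qᵢ + z * - Qⱼ)      ≈⟨ +-assoc _ _ _ ⟨
        (y * Qᵢ + z * Qᵢ) + z * - Qⱼ      ≈⟨ +-cong (distribʳ _ _ _) (-‿distribʳ-* _ _) ⟨
        (y + z) * Qᵢ - z * Qⱼ             ≈⟨ +-congʳ (*-congʳ (x-z≈[x-y]+[y-z] _ _ _)) ⟨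
        (x i - x u) * Qᵢ - z * Qⱼ         ∎

    P-∣ : ∀ {us u} t → u ∈ us → t - x u ∣ P us t
    P-∣ t (here ≡.refl) = _ , refl
    P-∣ t (there u∈)    = ∣-* _ (P-∣ t u∈)

    P-zero : ∀ {us u} → u ∈ us → P us (x u) ≈ 0#
    P-zero {us} {u} u∈ = let h , e = P-∣ {us} (x u) u∈ in
      trans e (trans (*-congʳ (-‿inverseʳ (x u))) (zeroˡ h))

    P-cancel : ∀ us {a} p → a ∉ us → P us (x a) * p ≈ 0# → p ≈ 0#
    P-cancel []       p a∉ eq = trans (sym (*-identityˡ p)) eq
    P-cancel (u ∷ us) p a∉ eq = P-cancel us p (a∉ ∘ there)
      (cancel _ (a∉ ∘ here) (trans (sym (*-assoc _ _ _)) eq))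

    -- The factors are split off one at a time; `coprime` passes divisibility by each remaining
    -- factor on to the quotient, and applies because the entries of the list are distinct.
    P-divides : ∀ {us a p} → Unique us → a ∉ us → (∀ {u} → u ∈ us → x a - x u ∣ p) → P us (x a) ∣ p
    P-divides {[]}     {a} {p} _ _  _ = p , sym (*-identityˡ p)
    P-divides {u ∷ us} {a} {p} (u∉ ∷ uniq) a∉ div with div (here ≡.refl)
    ... | h , p≈ = let k , h≈ = P-divides uniq (a∉ ∘ there) div′ in
          k , trans p≈ (trans (*-congˡ h≈) (sym (*-assoc _ _ _)))
      where
      div′ : ∀ {w} → w ∈ us → x a - x w ∣ h
      div′ w∈ = let q , p≈′ = div (there w∈) in
        coprime (a∉ ∘ here) (λ { ≡.refl → a∉ (there w∈) }) (λ { ≡.refl → All.lookup u∉ w∈ ≡.refl })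
                h q (trans (sym p≈) p≈′)

    Θ′ : ∀ a → Dec (IsHub a) → Fin d → Carrier
    Θ′ a (yes _) i = P (N a) (x i)
    Θ′ a (no _)  i with i Fin.≟ a
    ... | yes _ = P (N a) (x a)
    ... | no _  = 0#

    Θ : Fin d → Fin d → Carrier
    Θ a = Θ′ a (hub? a)

    Θ-diag : ∀ a → Θ a a ≈ P (N a) (x a)
    Θ-diag a = go (hub? a)
      where
      go : ∀ h → Θ′ a h a ≈ P (N a) (x a)
      go (yes _) = refl
      go (no _) with a Fin.≟ a
      ... | yes _ = refl
      ... | no ne = ⊥-elim (ne ≡.refl)

    -- If `b` is a hub, then `a` belongs to `N b` and a factor of P vanishes at x_a. If `b` is a
    -- leaf, its element is supported at `b` alone.
    Θ-triangular : ∀ {a b} → a ≢ b → rank a ≤ rank b → Θ b a ≈ 0#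
    Θ-triangular {a} {b} a≢b le = go (hub? b)
      where
      go : ∀ h → Θ′ b h a ≈ 0#
      go (yes (i , ≡.refl)) = P-zero (smaller-rank a≢b (≡.subst (rank a ≤_) (rank-hub i) le))
      go (no _) with a Fin.≟ b
      ... | yes eq = ⊥-elim (a≢b eq)
      ... | no _   = refl

    Θ-preserves : ∀ {q} (Q : Carrier → Set q) a → Q 0# → (∀ i → Q (P (N a) (x i))) → ∀ i → Q (Θ a i)
    Θ-preserves Q a Q0 QP i = go (hub? a)
      where
      go : ∀ h → Q (Θ′ a h i)
      go (yes _) = QP i
      go (no _) with i Fin.≟ a
      ... | yes _ = QP a
      ... | no _  = Q0

    Divisible : (Fin d → Fin d → Set) → (Fin d → Carrier) → Set (c ⊔ ℓ)
    Divisible ρ φ = ∀ i j → ρ i j → x i - x j ∣ φ i - φ j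

    -- The element of a hub applies one polynomial to all coordinates, so it respects every
    -- hyperplane x_i = x_j. That of a leaf `a` is supported at `a`, and respects the hyperplanes of
    -- ρ through `a` once every ρ-neighbour of `a` contributes a factor of P.
    LeafClosed : (Fin d → Fin d → Set) → Fin d → Set
    LeafClosed ρ a = ¬ IsHub a → ∀ i → ρ i a ⊎ ρ a i → i ∈ N a

    Θ-divisible : ∀ {ρ} a → LeafClosed ρ a → Divisible ρ (Θ a)
    Θ-divisible a closed i j ρij = go (hub? a)
      where
      go : ∀ h → x i - x j ∣ Θ′ a h i - Θ′ a h j
      go (yes _) = P-diff (N a) i j
      go (no ¬h) with i Fin.≟ a | j Fin.≟ a
      ... | yes _      | yes _      = ∣-0 (-‿inverseʳ _)
      ... | yes ≡.refl | no _       = ∣-resp (sym (trans (+-congˡ -0#≈0#) (+-identityʳ _)))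
                                        (P-∣ (x i) (closed ¬h j (inj₂ ρij)))
      ... | no _       | yes ≡.refl = let h , e = P-∣ (x j) (closed ¬h i (inj₁ ρij)) in
                                      h , trans (+-identityˡ _) (trans (-‿cong e)
                                        (trans (-‿distribˡ-* _ _) (*-congʳ (sym (x-y≈-[y-x] _ _)))))
      ... | no _       | no _       = ∣-0 (-‿inverseʳ 0#)

    comb : (Fin d → Carrier) → Fin d → Carrier
    comb g i = sum (λ a → g a * Θ a i)

    -- Evaluation at `a` leaves only the diagonal term: elements of lower rank have coefficient zero
    -- by induction, and the others vanish at `a`.
    Θ-independent : ∀ g → (∀ i → comb g i ≈ 0#) → ∀ a → g a ≈ 0#
    Θ-independent g eq a = go (suc (rank a)) a ℕₚ.≤-refl
      where
      go : ∀ n a → rank a < n → g a ≈ 0#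
      go (suc n) a (s≤s ra≤n) = P-cancel (N a) (g a) (v∉N a) (begin
        P (N a) (x a) * g a    ≈⟨ *-comm _ _ ⟩
        g a * P (N a) (x a)    ≈⟨ *-congˡ (Θ-diag a) ⟨
        g a * Θ a a            ≈⟨ sum-single (λ b → g b * Θ b a) a others ⟨
        comb g a               ≈⟨ eq a ⟩
        0#                     ∎)
        where
        others : ∀ b → b ≢ a → g b * Θ b a ≈ 0#
        others b b≢a with rank b ℕ.<? rank a
        ... | yes lt = trans (*-congʳ (go n b (ℕₚ.<-≤-trans lt ra≤n))) (zeroˡ _)
        ... | no ≮   = trans (*-congˡ (Θ-triangular (b≢a ∘ ≡.sym) (ℕₚ.≮⇒≥ ≮))) (zeroʳ _)

    Earlier : Fin d → Fin d → Set
    Earlier a u = u ∈ N a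

    comb-divisible : ∀ g → Divisible Earlier (comb g)
    comb-divisible g i j j∈ = ∣-resp (sym sum-diff) (∣-sum λ a →
      ∣-resp (trans (distribˡ _ _ _) (+-congˡ (sym (-‿distribʳ-* _ _)))) (∣-* (g a) (Θ-divisible a closed i j j∈)))
      where
      closed : ∀ {a} → LeafClosed Earlier a
      closed ¬h i (inj₁ a∈) = ⊥-elim (¬h (N-hub a∈))
      closed ¬h i (inj₂ i∈) = i∈
      ∣-sum : ∀ {n D} {f : Fin n → Carrier} → (∀ a → D ∣ f a) → D ∣ sum f
      ∣-sum {zero}  div = ∣-0 refl
      ∣-sum {suc n} div = ∣-+ (div zero) (∣-sum (div ∘ suc))
      sum-diff : comb g i - comb g j ≈ sum (λ a → g a * Θ a i - g a * Θ a j)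
      sum-diff = trans (+-congˡ (sum-neg (λ a → g a * Θ a j))) (sym (∑-distrib-+ (λ a → g a * Θ a i) (λ a → - (g a * Θ a j))))

    -- At stage t the combination agrees with φ on all vertices of rank below t. The correction
    -- takes elements of rank t, which vanish at lower ranks and at the other vertices of rank t.
    -- Leaves have rank `r`, hence stage `suc r`.
    Θ-spans : ∀ φ → Divisible Earlier φ → ∃ λ g → ∀ i → φ i ≈ comb g i
    Θ-spans φ φ-div = let g , eq = go (suc r) in g , λ i → eq i (s≤s (rank≤r i))
      where
      go : ∀ t → ∃ λ g → ∀ i → rank i < t → φ i ≈ comb g i
      go zero    = (λ _ → 0#) , λ _ ()
      go (suc t) with go t
      ... | g , eq = (λ a → g a + g′ a) , λ { i (s≤s ri≤t) → begin
          φ i                                                    ≈⟨ x≈x-y+y (φ i) (comb g i) ⟩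
          ψ i + comb g i                                         ≈⟨ +-congʳ (ψ≈ i ri≤t) ⟩
          comb g′ i + comb g i                                   ≈⟨ +-comm _ _ ⟩
          comb g i + comb g′ i                                   ≈⟨ ∑-distrib-+ (λ a → g a * Θ a i) (λ a → g′ a * Θ a i) ⟨
          sum (λ a → g a * Θ a i + g′ a * Θ a i)                 ≈⟨ sum-cong (λ a → distribʳ (Θ a i) (g a) (g′ a)) ⟨
          comb (λ a → g a + g′ a) i                              ∎ }
        where
        ψ : Fin d → Carrier
        ψ i = φ i - comb g i

        ψ≈0 : ∀ {i} → rank i < t → ψ i ≈ 0#
        ψ≈0 {i} lt = trans (+-congʳ (eq i lt)) (-‿inverseʳ _)

        ψ-div : ∀ {i j} → j ∈ N i → x i - x j ∣ ψ i - ψ j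
        ψ-div {i} {j} j∈ = ∣-resp (trans (+-congˡ (sym (-‿+-comm _ _))) (trans (+-interchange _ _ _ _)
          (+-congˡ (-‿+-comm _ _)))) (∣-+ (φ-div i j j∈) (∣-neg (comb-divisible g i j j∈)))

        -- ψ vanishes on `N a`, so every x_a - x_u with u in `N a` divides ψ_a itself.
        quotient : ∀ {a} → rank a ≡ t → P (N a) (x a) ∣ ψ a
        quotient {a} ≡.refl = P-divides (N-unique a) (v∉N a) λ u∈ →
          ∣-resp (trans (+-congˡ (trans (-‿cong (ψ≈0 (N-rank u∈))) -0#≈0#)) (+-identityʳ _)) (ψ-div u∈)

        g″ : ∀ a → Dec (rank a ≡ t) → Carrier
        g″ a (yes ra≡t) = proj₁ (quotient ra≡t)
        g″ a (no _)     = 0#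

        g′ : Fin d → Carrier
        g′ a = g″ a (rank a ℕ.≟ t)

        g′-diag : ∀ i → rank i ≤ t → ψ i ≈ g′ i * Θ i i
        g′-diag i ri≤t with rank i ℕ.≟ t
        ... | yes ra≡t = trans (proj₂ (quotient ra≡t)) (trans (*-comm _ _) (*-congˡ (sym (Θ-diag i))))
        ... | no ne    = trans (ψ≈0 (ℕₚ.≤∧≢⇒< ri≤t ne)) (sym (zeroˡ _))

        ψ≈ : ∀ i → rank i ≤ t → ψ i ≈ comb g′ i
        ψ≈ i ri≤t = trans (g′-diag i ri≤t) (sym (sum-single (λ a → g′ a * Θ a i) i others))
          where
          others : ∀ a → a ≢ i → g′ a * Θ a i ≈ 0#
          others a a≢i with rank a ℕ.≟ t
          ... | yes ≡.refl = trans (*-congˡ (Θ-triangular (a≢i ∘ ≡.sym) ri≤t)) (zeroʳ _)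
          ... | no _       = zeroˡ _

    Θ-unique : ∀ g h → (∀ i → comb g i ≈ comb h i) → ∀ a → g a ≈ h a
    Θ-unique g h eq a = x∙y⁻¹≈ε⇒x≈y (g a) (h a) (Θ-independent (λ a → g a - h a) diff a)
      where
      diff : ∀ i → comb (λ a → g a - h a) i ≈ 0#
      diff i = begin
        comb (λ a → g a - h a) i                              ≈⟨ sum-cong (λ a → distribʳ (Θ a i) (g a) (- h a)) ⟩
        sum (λ a → g a * Θ a i + - h a * Θ a i)               ≈⟨ sum-cong (λ a → +-congˡ (-‿distribˡ-* (h a) (Θ a i))) ⟨
        sum (λ a → g a * Θ a i + - (h a * Θ a i))             ≈⟨ ∑-distrib-+ (λ a → g a * Θ a i) (λ a → - (h a * Θ a i)) ⟩
        comb g i + sum (λ a → - (h a * Θ a i))                ≈⟨ +-congˡ (sum-neg (λ a → h a * Θ a i)) ⟨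
        comb g i - comb h i                                   ≈⟨ +-congʳ (eq i) ⟩
        comb h i - comb h i                                   ≈⟨ -‿inverseʳ _ ⟩
        0#                                                    ∎

    -- Expanding Θ b in θ, and each θ a in Θ again, must return the coordinates of Θ b, since
    -- expansions in Θ are unique.
    Θ-factor : ∀ {θ : Fin d → Fin d → Carrier} g h b →
               (∀ i → Θ b i ≈ sum (λ a → g a * θ a i)) → (∀ a i → θ a i ≈ comb (h a) i) →
               ∀ b′ → sum (λ a → g a * h a b′) ≈ δ b b′
    Θ-factor {θ} g h b Θ≈ θ≈ = Θ-unique (λ b′ → sum (λ a → g a * h a b′)) (δ b) λ i → begin
      comb (λ b′ → sum (λ a → g a * h a b′)) i     ≈⟨ sum-assoc g h (λ b′ → Θ b′ i) ⟨
      sum (λ a → g a * comb (h a) i)               ≈⟨ sum-cong (λ a → *-congˡ (θ≈ a i)) ⟨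
      sum (λ a → g a * θ a i)                      ≈⟨ Θ≈ i ⟨
      Θ b i                                        ≈⟨ sum-δ b (λ b′ → Θ b′ i) ⟨
      comb (δ b) i                                 ∎

    module _ (σ : Permutation d d) where

      Θ-spans-permuted : ∀ φ → Divisible Earlier φ →
                         ∃ λ g → ∀ i → φ i ≈ sum (λ b → g b * Θ (σ ⟨$⟩ʳ b) i)
      Θ-spans-permuted φ div = let g , eq = Θ-spans φ div in
        (λ b → g (σ ⟨$⟩ʳ b)) , λ i → trans (eq i) (sum-permute (λ a → g a * Θ a i) σ)

      Θ-independent-permuted : ∀ g → (∀ i → sum (λ b → g b * Θ (σ ⟨$⟩ʳ b) i) ≈ 0#) → ∀ b → g b ≈ 0#
      Θ-independent-permuted g eq b = ≡.subst (λ c → g c ≈ 0#) (Perm.inverseˡ σ)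
        (Θ-independent (λ a → g (σ ⟨$⟩ˡ a)) comb≈0 (σ ⟨$⟩ʳ b))
        where
        comb≈0 : ∀ i → comb (λ a → g (σ ⟨$⟩ˡ a)) i ≈ 0#
        comb≈0 i = begin
          comb (λ a → g (σ ⟨$⟩ˡ a)) i                                     ≈⟨ sum-permute (λ a → g (σ ⟨$⟩ˡ a) * Θ a i) σ ⟩
          sum (λ b → g (σ ⟨$⟩ˡ (σ ⟨$⟩ʳ b)) * Θ (σ ⟨$⟩ʳ b) i)             ≈⟨ sum-cong {d} (λ b → *-congʳ (reflexive (≡.cong g (Perm.inverseˡ σ)))) ⟩
          sum (λ b → g b * Θ (σ ⟨$⟩ʳ b) i)                                ≈⟨ eq i ⟩
          0#                                                              ∎

-- Linear dependence up to double negation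

¬¬-∀-Fin : ∀ {a n} {Q : Fin n → Set a} → (∀ i → ¬ ¬ Q i) → ¬ ¬ (∀ i → Q i)
¬¬-∀-Fin {n = zero}  ¬¬Q k = k λ ()
¬¬-∀-Fin {n = suc n} ¬¬Q k = ¬¬Q zero λ q → ¬¬-∀-Fin (¬¬Q ∘ suc) λ qs →
  k λ { zero → q ; (suc i) → qs i }

-- Equality in K need not be decidable, so linear dependence is only found up to ¬¬.
module LinearAlgebra {c ℓ : Level} (K : Field c ℓ) where
  open Field K hiding (zero)
  open SumLemmas commutativeRing
  open MatrixLemmas commutativeRing
  open import Algebra.Properties.Ring ring using (-‿distribˡ-*; -‿distribʳ-*)
  open import Relation.Binary.Reasoning.Setoid setoid

  Dependence : ∀ {l m} → (Fin l → Fin m → Carrier) → Set (c ⊔ ℓ)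
  Dependence {l} A = Σ (Fin l → Carrier) λ z →
    (∃ λ i → ¬ (z i ≈ 0#)) × (∀ a → sum (λ i → z i * A i a) ≈ 0#)

  dependent : ∀ {l m} → m < l → (A : Fin l → Fin m → Carrier) → ¬ ¬ Dependence A
  dependent {suc l} {m} m<l A k = ¬¬-∀-Fin row-zero λ A₀≈0 →
    k (δ zero , (zero , λ δ≈0 → 0≉1 (trans (sym δ≈0) (δ-diag {suc l} zero))) ,
       λ a → trans (sum-δ zero (λ i → A i a)) (A₀≈0 a))
    where
    -- Whether the first row is zero cannot be decided. Assuming that there is no dependence, a
    -- nonzero entry would produce one by elimination; so every entry is zero up to double negation,
    -- and a zero row is dependent by itself.
    row-zero : ∀ a → ¬ ¬ (A zero a ≈ 0#)
    row-zero a A₀a≉0 = eliminate m<l A a A₀a≉0 k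
      where
      eliminate : ∀ {m} → m < suc l → (A : Fin (suc l) → Fin m → Carrier) →
                  ∀ c → ¬ (A zero c ≈ 0#) → ¬ ¬ Dependence A
      eliminate {suc m} (s≤s m<l) A c A₀c≉0 k = dependent m<l A′ λ { (z′ , (i , z′ᵢ≉0) , z′A′≈0) →
        -- Elimination added A_jc · w to row j. The coefficient z₀ of the first row collects these
        -- contributions, weighted by z′.
        let z₀ : Carrier
            z₀ = sum (λ j → z′ j * A (suc j) c) * - y
            z : Fin (suc l) → Carrier
            z = λ { zero → z₀ ; (suc j) → z′ j }
            combine : ∀ a → sum (λ j → z j * A j a) ≈ sum (λ j → z′ j * (A (suc j) a + A (suc j) c * w a))
            combine a = begin
              z₀ * A zero a + sum (λ j → z′ j * A (suc j) a)
                ≈⟨ +-comm _ _ ⟩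
              sum (λ j → z′ j * A (suc j) a) + z₀ * A zero a
                ≈⟨ +-congˡ (*-assoc _ (- y) (A zero a)) ⟩
              sum (λ j → z′ j * A (suc j) a) + sum (λ j → z′ j * A (suc j) c) * w a
                ≈⟨ +-congˡ (*-distribʳ-sum (w a) (λ j → z′ j * A (suc j) c)) ⟩
              sum (λ j → z′ j * A (suc j) a) + sum (λ j → (z′ j * A (suc j) c) * w a)
                ≈⟨ ∑-distrib-+ (λ j → z′ j * A (suc j) a) (λ j → (z′ j * A (suc j) c) * w a) ⟨
              sum (λ j → z′ j * A (suc j) a + (z′ j * A (suc j) c) * w a)
                ≈⟨ sum-cong {n = l} (λ j → trans (distribˡ _ _ _) (+-congˡ (sym (*-assoc _ _ _)))) ⟨
              sum (λ j → z′ j * (A (suc j) a + A (suc j) c * w a)) ∎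
            column : ∀ a → sum (λ j → z j * A j a) ≈ 0#
            column a = trans (combine a) (vanish a z′ z′A′≈0 (c Fin.≟ a))
        in k (z , (suc i , z′ᵢ≉0) , column) }
        where
        y : Carrier
        y = proj₁ (inverse (A zero c) A₀c≉0)
        w : Fin (suc m) → Carrier
        w a = - y * A zero a
        A′ : Fin l → Fin m → Carrier
        A′ j b = A (suc j) (Fin.punchIn c b) + A (suc j) c * w (Fin.punchIn c b)
        w-pivot : w c ≈ - 1#
        w-pivot = trans (sym (-‿distribˡ-* y (A zero c)))
          (-‿cong (trans (*-comm y (A zero c)) (proj₂ (inverse (A zero c) A₀c≉0))))
        vanish : ∀ a (z′ : Fin l → Carrier) → (∀ b → sum (λ j → z′ j * A′ j b) ≈ 0#) → Dec (c ≡ a) →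
                 sum (λ j → z′ j * (A (suc j) a + A (suc j) c * w a)) ≈ 0#
        vanish a z′ eq (yes ≡.refl) = sum-zero {l} _ λ j → trans (*-congˡ (begin
          A (suc j) c + A (suc j) c * w c      ≈⟨ +-congˡ (*-congˡ w-pivot) ⟩
          A (suc j) c + A (suc j) c * - 1#     ≈⟨ +-congˡ (-‿distribʳ-* _ _) ⟨
          A (suc j) c - A (suc j) c * 1#       ≈⟨ +-congˡ (-‿cong (*-identityʳ _)) ⟩
          A (suc j) c - A (suc j) c            ≈⟨ -‿inverseʳ _ ⟩
          0#                                   ∎)) (zeroʳ (z′ j))
        vanish a z′ eq (no c≢a) = ≡.subst (λ a → sum (λ j → z′ j * (A (suc j) a + A (suc j) c * w a)) ≈ 0#)
          (Finₚ.punchIn-punchOut c≢a) (eq (Fin.punchOut c≢a))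

  -- The identity of size l would factor through the m coordinates selected by `c`. A dependence z
  -- of the rows of A on these coordinates gives z = zAB = 0.
  no-factorisation : ∀ {l m d} (c : Fin m → Fin d) → m < l →
    (A : Fin l → Fin d → Carrier) (B : Fin d → Fin l → Carrier) →
    (∀ a → (∃ λ i → c i ≡ a) ⊎ (∀ j → B a j ≈ 0#)) →
    (∀ j j′ → sum (λ a → A j a * B a j′) ≈ δ j′ j) → ⊥
  no-factorisation c m<l A B cover AB≈δ = dependent m<l (λ j i → A j (c i)) λ { (z , (j₀ , z≉0) , zA≈0) →
    z≉0 (begin
      z j₀                                              ≈⟨ sum-δ j₀ z ⟨
      sum (λ j → δ j₀ j * z j)                          ≈⟨ sum-cong (λ j → trans (*-comm _ _) (*-congˡ (sym (AB≈δ j j₀)))) ⟩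
      sum (λ j → z j * sum (λ a → A j a * B a j₀))      ≈⟨ sum-assoc z A (λ a → B a j₀) ⟩
      sum (λ a → sum (λ j → z j * A j a) * B a j₀)      ≈⟨ sum-zero _ (λ a → column z zA≈0 j₀ a (cover a)) ⟩
      0#                                                ∎) }
    where
    column : ∀ z → (∀ i → sum (λ j → z j * A j (c i)) ≈ 0#) → ∀ j₀ a →
             (∃ λ i → c i ≡ a) ⊎ (∀ j → B a j ≈ 0#) → sum (λ j → z j * A j a) * B a j₀ ≈ 0#
    column z zA≈0 j₀ a (inj₁ (i , ≡.refl)) = trans (*-congʳ (zA≈0 i)) (zeroˡ _)
    column z zA≈0 j₀ a (inj₂ B≈0)          = trans (*-congˡ (B≈0 j₀)) (zeroʳ _)

-- Comparison of bases by degree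

module SystemBases {c ℓ : Level} (K : Field c ℓ) {d : ℕ} (E : System d) where
  open Field K using (_≈_; _*_; 0#)
  module 𝕂 = Field K
  open Polynomials K {d}
  open System E
  open NewtonBasis.Basis polyRing x[_] (λ {a} {b} → lin-cancel {a} {b}) (λ {a} {u} {w} → lin-coprime {a} {u} {w}) E
  module ΣS = SumLemmas polyRing
  module ΣK = SumLemmas 𝕂.commutativeRing
  module MS = MatrixLemmas polyRing
  module MK = MatrixLemmas 𝕂.commutativeRing
  open import Relation.Binary.Reasoning.Setoid 𝕂.setoid

  Θ-homogeneous : ∀ a i → Homogeneous K (deg a) (Θ a i)
  Θ-homogeneous a = Θ-preserves (Homogeneous K (deg a)) a (homogeneous-0 (deg a)) λ i →
    ≡.subst (λ e → Homogeneous K e (P (N a) x[ i ])) (Listₚ.length-map hub (earlier a)) (P-homogeneous (N a) i)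
    where
    P-homogeneous : ∀ us i → Homogeneous K (length us) (P us x[ i ])
    P-homogeneous []       i = homogeneous-1
    P-homogeneous (u ∷ us) i = homogeneous-lin i u (P us x[ i ]) (P-homogeneous us i)

  lin≋sum : ∀ g (θ : Fin d → Der K d) i → lin K g θ i ≋ ΣS.sum (λ a → g a 𝕊.* θ a i)
  lin≋sum g θ i = ≡.subst (λ z → concat z ≋ ΣS.sum f) (≡.sym (Listₚ.map-tabulate id f)) (go f)
    where
    f : Fin d → S
    f a = g a 𝕊.* θ a i
    go : ∀ {n} (f : Fin n → S) → concat (tabulate f) ≋ ΣS.sum f
    go {zero}  f = 𝕊.refl
    go {suc n} f = 𝕊.+-congˡ {f zero} (go (f ∘ suc))

  divisible→InD : ∀ {ρ} φ → Divisible ρ φ → InD K ρ φ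
  divisible→InD φ div a b r = let h , e = div a b r in h , at e

  InD→divisible : ∀ {ρ} φ → InD K ρ φ → Divisible ρ φ
  InD→divisible φ ind a b r = let h , e = ind a b r in h , mk≋ e

  -- The inclusion of the edges in ρ places D inside the span of the Newton elements, and closedness
  -- at the leaves places these elements inside D. The permutation only sorts them by degree.
  free : ∀ {ρ e} (σ : Permutation d d) → (∀ b → deg (σ ⟨$⟩ʳ b) ≡ e b) →
         (∀ {a u} → u ∈ N a → ρ a u) → (∀ a → LeafClosed ρ a) → FreeWithExps K ρ e
  free {ρ} {e} σ deg≡e N⊆ρ closed = θ
    , (λ b → divisible→InD (θ b) (Θ-divisible (σ ⟨$⟩ʳ b) (closed (σ ⟨$⟩ʳ b))))
    , (λ b i → ≡.subst (λ e → Homogeneous K e (θ b i)) (deg≡e b) (Θ-homogeneous (σ ⟨$⟩ʳ b) i))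
    , spans
    , independent
    where
    θ : Fin d → Der K d
    θ b = Θ (σ ⟨$⟩ʳ b)
    spans : ∀ φ → InD K ρ φ → Σ (Fin d → S) λ g → ∀ i → _≈P_ K (φ i) (lin K g θ i)
    spans φ φ∈D = proj₁ expansion , λ i → at (𝕊.trans (proj₂ expansion i) (𝕊.sym (lin≋sum (proj₁ expansion) θ i)))
      where
      expansion : ∃ λ g → ∀ i → φ i ≋ ΣS.sum (λ b → g b 𝕊.* θ b i)
      expansion = Θ-spans-permuted σ φ (λ a u u∈ → InD→divisible φ φ∈D a u (N⊆ρ u∈))
    independent : ∀ g → (∀ i → _≈P_ K (lin K g θ i) []) → ∀ b → _≈P_ K (g b) []
    independent g eq b = at (Θ-independent-permuted σ g (λ i → 𝕊.trans (𝕊.sym (lin≋sum g θ i)) (mk≋ (eq i))) b)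

  coeff-sum : ∀ {n} (f : Fin n → S) m → coeff K (ΣS.sum f) m ≈ ΣK.sum (λ i → coeff K (f i) m)
  coeff-sum {zero}  f m = 𝕂.refl
  coeff-sum {suc n} f m = 𝕂.trans (coeff-++ (f zero) (ΣS.sum (f ∘ suc)) m) (𝕂.+-congˡ (coeff-sum (f ∘ suc) m))

  -- Only the component of degree deg b of the expansion of φ sees the constant term of h b.
  const-coefficient : ∀ {e} (φ : Der K d) (h : Fin d → S) → (∀ i → Homogeneous K e (φ i)) →
                      (∀ i → φ i ≋ comb h i) → ∀ b → e ≢ deg b → const (h b) ≈ 0#
  const-coefficient {e} φ h φ-hom φ≋ b e≢ =
    𝕂.trans (𝕂.sym (const-component (deg b) (h b))) (const-cong (Θ-independent g (λ i → mk≋ (vanish i)) b))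
    where
    g : Fin d → S
    g a = component (deg b) (deg a) (h a)
    vanish : ∀ i m → coeff K (comb g i) m ≈ 0#
    vanish i m = go (Vec.sum m ℕ.≟ deg b)
      where
      go : Dec (Vec.sum m ≡ deg b) → coeff K (comb g i) m ≈ 0#
      go (no ne)  = 𝕂.trans (coeff-sum (λ a → g a 𝕊.* Θ a i) m)
        (ΣK.sum-zero {d} _ λ a → homogeneous-component-* (h a) {Θ a i} (Θ-homogeneous a i) m ne)
      go (yes eq) = begin
        coeff K (comb g i) m                              ≈⟨ coeff-sum (λ a → g a 𝕊.* Θ a i) m ⟩
        ΣK.sum (λ a → coeff K (g a 𝕊.* Θ a i) m)          ≈⟨ ΣK.sum-cong {d} (λ a → coeff-component-* (h a) {Θ a i} (Θ-homogeneous a i) m eq) ⟩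
        ΣK.sum (λ a → coeff K (h a 𝕊.* Θ a i) m)          ≈⟨ coeff-sum (λ a → h a 𝕊.* Θ a i) m ⟨
        coeff K (comb h i) m                              ≈⟨ at (φ≋ i) m ⟨
        coeff K (φ i) m                                   ≈⟨ φ-hom i m (λ z → e≢ (≡.trans (≡.sym z) eq)) ⟩
        0#                                                ∎

  -- The expansions of Θ (b j) in the given basis and back compose to the identity.  Their constant
  -- terms factor the identity of K^l through the basis elements of degree deg (b j).
  exponents-bound : ∀ {ρ e l m} → FreeWithExps K ρ e → (∀ {a u} → u ∈ N a → ρ a u) →
    (b : Fin l → Fin d) → (∀ {j j′} → b j ≡ b j′ → j ≡ j′) → (∀ j → LeafClosed ρ (b j)) →
    (c : Fin m → Fin d) → m < l → (∀ a → (∃ λ i → c i ≡ a) ⊎ (∀ j → e a ≢ deg (b j))) → ⊥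
  exponents-bound {ρ} {e} {l} {m} (θ , θ∈D , θ-hom , θ-spans , _) N⊆ρ b b-inj closed c m<l cover =
    LinearAlgebra.no-factorisation K c m<l A B zero-columns factor
    where
    g : Fin l → Fin d → S
    g j = proj₁ (θ-spans (Θ (b j)) (divisible→InD (Θ (b j)) (Θ-divisible (b j) (closed j))))
    g-eq : ∀ j i → Θ (b j) i ≋ ΣS.sum (λ a → g j a 𝕊.* θ a i)
    g-eq j i = 𝕊.trans (mk≋ (proj₂ (θ-spans (Θ (b j)) (divisible→InD (Θ (b j)) (Θ-divisible (b j) (closed j)))) i))
                       (lin≋sum (g j) θ i)
    expansion : ∀ a → ∃ λ h → ∀ i → θ a i ≋ comb h i
    expansion a = Θ-spans (θ a) (λ v u u∈ → InD→divisible (θ a) (θ∈D a) v u (N⊆ρ u∈))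
    h : Fin d → Fin d → S
    h a = proj₁ (expansion a)
    A : Fin l → Fin d → 𝕂.Carrier
    A j a = const (g j a)
    B : Fin d → Fin l → 𝕂.Carrier
    B a j = const (h a (b j))
    zero-columns : ∀ a → (∃ λ i → c i ≡ a) ⊎ (∀ j → B a j ≈ 0#)
    zero-columns a = Sum.map₂ (λ ne j → const-coefficient (θ a) (h a) (θ-hom a) (proj₂ (expansion a)) (b j) (ne j)) (cover a)
    const-δ : ∀ j j′ → const (MS.δ (b j) (b j′)) ≈ MK.δ j′ j
    const-δ j j′ = go (j Fin.≟ j′)
      where
      go : Dec (j ≡ j′) → const (MS.δ (b j) (b j′)) ≈ MK.δ j′ j
      go (yes ≡.refl) = 𝕂.trans (const-cong (MS.δ-diag (b j))) (𝕂.trans const-1 (𝕂.sym (MK.δ-diag j)))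
      go (no ne)      = 𝕂.trans (const-cong (MS.δ-≢ {i = b j} {b j′} (ne ∘ ≡.sym ∘ b-inj))) (𝕂.sym (MK.δ-≢ {i = j′} {j} ne))
    factor : ∀ j j′ → ΣK.sum (λ a → A j a * B a j′) ≈ MK.δ j′ j
    factor j j′ = begin
      ΣK.sum (λ a → const (g j a) * const (h a (b j′)))       ≈⟨ ΣK.sum-cong {d} (λ a → const-* (g j a) (h a (b j′))) ⟨
      ΣK.sum (λ a → const (g j a 𝕊.* h a (b j′)))             ≈⟨ coeff-sum (λ a → g j a 𝕊.* h a (b j′)) 𝟎 ⟨
      const (ΣS.sum (λ a → g j a 𝕊.* h a (b j′)))             ≈⟨ const-cong (Θ-factor {θ} (g j) h (b j) (g-eq j) (λ a → proj₂ (expansion a)) (b j′)) ⟩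
      const (MS.δ (b j) (b j′))                               ≈⟨ const-δ j j′ ⟩
      MK.δ j′ j                                               ∎

-- The graph and its contractions

pairFst≢pairSnd : ∀ p → pairFst p ≢ pairSnd p
pairFst≢pairSnd = toWitness {a? = Finₚ.all? λ p → ¬? (pairFst p Fin.≟ pairSnd p)} tt

module Graph (k : ℕ) where
  n : ℕ
  n = 4 ℕ.+ (6 ℕ.* k ℕ.+ k)

  Adj : Fin n → Fin n → Set
  Adj = GAdj k

  encode : Label k → Fin n
  encode (core a)  = a Fin.↑ˡ (6 ℕ.* k ℕ.+ k)
  encode (mid p t) = 4 Fin.↑ʳ (Fin.combine p t Fin.↑ˡ k)
  encode (extra t) = 4 Fin.↑ʳ ((6 ℕ.* k) Fin.↑ʳ t)

  decode-encode : ∀ l → decode k (encode l) ≡ l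
  decode-encode (core a)
    rewrite Finₚ.splitAt-↑ˡ 4 a (6 ℕ.* k ℕ.+ k) = ≡.refl
  decode-encode (mid p t)
    rewrite Finₚ.splitAt-↑ʳ 4 (6 ℕ.* k ℕ.+ k) (Fin.combine p t Fin.↑ˡ k)
          | Finₚ.splitAt-↑ˡ (6 ℕ.* k) (Fin.combine p t) k = ≡.cong (λ { (p , t) → mid p t }) (Finₚ.remQuot-combine p t)
  decode-encode (extra t)
    rewrite Finₚ.splitAt-↑ʳ 4 (6 ℕ.* k ℕ.+ k) ((6 ℕ.* k) Fin.↑ʳ t)
          | Finₚ.splitAt-↑ʳ (6 ℕ.* k) k t = ≡.refl

  encode-decode : ∀ i → encode (decode k i) ≡ i
  encode-decode i with Fin.splitAt 4 i in eq
  ... | inj₁ a = Finₚ.splitAt⁻¹-↑ˡ eq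
  ... | inj₂ r with Fin.splitAt (6 ℕ.* k) r in eq′
  ...   | inj₁ q = ≡.trans (≡.cong (λ z → 4 Fin.↑ʳ (z Fin.↑ˡ k)) (Finₚ.combine-remQuot {6} k q))
                     (≡.trans (≡.cong (4 Fin.↑ʳ_) (Finₚ.splitAt⁻¹-↑ˡ eq′)) (Finₚ.splitAt⁻¹-↑ʳ eq))
  ...   | inj₂ t = ≡.trans (≡.cong (4 Fin.↑ʳ_) (Finₚ.splitAt⁻¹-↑ʳ eq′)) (Finₚ.splitAt⁻¹-↑ʳ eq)

  encode-of : ∀ i {l} → decode k i ≡ l → i ≡ encode l
  encode-of i ≡.refl = ≡.sym (encode-decode i)

  decode-of : ∀ {i l} → i ≡ encode l → decode k i ≡ l
  decode-of {l = l} ≡.refl = decode-encode l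

  vcore : Fin 4 → Fin n
  vcore = encode ∘ core

  core-injective : ∀ {a b} → core {k} a ≡ core b → a ≡ b
  core-injective ≡.refl = ≡.refl

  mid-injective : ∀ {p q} {t u : Fin k} → mid p t ≡ mid q u → t ≡ u
  mid-injective ≡.refl = ≡.refl

  encode-injective : ∀ {l l′} → encode l ≡ encode l′ → l ≡ l′
  encode-injective {l} {l′} eq = ≡.trans (≡.sym (decode-encode l)) (decode-of eq)

  adj-encode : ∀ {l l′} → LAdj l l′ → Adj (encode l) (encode l′)
  adj-encode {l} {l′} = ≡.subst₂ LAdj (≡.sym (decode-encode l)) (≡.sym (decode-encode l′))

  LAdj-sym : ∀ (l l′ : Label k) → LAdj l l′ → LAdj l′ l
  LAdj-sym (core _)  (core _)  ne = ne ∘ ≡.sym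
  LAdj-sym (core _)  (mid _ _) h  = h
  LAdj-sym (core _)  (extra _) h  = h
  LAdj-sym (mid _ _) (core _)  h  = h
  LAdj-sym (extra _) (core _)  h  = h

  Adj-sym : ∀ {i j} → Adj i j → Adj j i
  Adj-sym {i} {j} = LAdj-sym (decode k i) (decode k j)

  LAdj? : ∀ (l l′ : Label k) → Dec (LAdj l l′)
  LAdj? (core a)  (core b)  = ¬? (a Fin.≟ b)
  LAdj? (core a)  (mid p _) = (a Fin.≟ pairFst p) ⊎-dec (a Fin.≟ pairSnd p)
  LAdj? (core a)  (extra _) = toℕ a ℕ.<? 3
  LAdj? (mid p _) (core a)  = (a Fin.≟ pairFst p) ⊎-dec (a Fin.≟ pairSnd p)
  LAdj? (mid _ _) (mid _ _) = no λ ()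
  LAdj? (mid _ _) (extra _) = no λ ()
  LAdj? (extra _) (core a)  = toℕ a ℕ.<? 3
  LAdj? (extra _) (mid _ _) = no λ ()
  LAdj? (extra _) (extra _) = no λ ()

  Leaf : Label k → Set
  Leaf (core _)  = ⊥
  Leaf (mid _ _) = ⊤
  Leaf (extra _) = ⊤

  core? : ∀ l → (∃ λ a → l ≡ core a) ⊎ Leaf l
  core? (core a)  = inj₁ (a , ≡.refl)
  core? (mid _ _) = inj₂ tt
  core? (extra _) = inj₂ tt

  ends : Label k → List (Fin 4)
  ends (core _)  = []
  ends (mid p _) = pairFst p ∷ pairSnd p ∷ []
  ends (extra _) = # 0 ∷ # 1 ∷ # 2 ∷ []

  ends-unique : ∀ l → Unique (ends l)
  ends-unique (core _)  = []
  ends-unique (mid p _) = (pairFst≢pairSnd p ∷ []) ∷ [] ∷ []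
  ends-unique (extra _) = ((λ ()) ∷ (λ ()) ∷ []) ∷ ((λ ()) ∷ []) ∷ [] ∷ []

  leaf-adj : ∀ {l l′} → Leaf l → LAdj l l′ → ∃ λ a → l′ ≡ core a × a ∈ ends l
  leaf-adj {mid p _} {core a} _ (inj₁ eq) = a , ≡.refl , here eq
  leaf-adj {mid p _} {core a} _ (inj₂ eq) = a , ≡.refl , there (here eq)
  leaf-adj {extra _} {core zero} _ _                   = _ , ≡.refl , here ≡.refl
  leaf-adj {extra _} {core (suc zero)} _ _             = _ , ≡.refl , there (here ≡.refl)
  leaf-adj {extra _} {core (suc (suc zero))} _ _       = _ , ≡.refl , there (there (here ≡.refl))
  leaf-adj {extra _} {core (suc (suc (suc zero)))} _ (s≤s (s≤s (s≤s ())))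

  ends-adj : ∀ l {a} → a ∈ ends l → LAdj l (core a)
  ends-adj (mid p _) (here eq)                    = inj₁ eq
  ends-adj (mid p _) (there (here eq))            = inj₂ eq
  ends-adj (extra _) (here ≡.refl)                = s≤s z≤n
  ends-adj (extra _) (there (here ≡.refl))        = s≤s (s≤s z≤n)
  ends-adj (extra _) (there (there (here ≡.refl))) = s≤s (s≤s (s≤s z≤n))

  toℕ-encode-mid : ∀ p t → toℕ (encode (mid p t)) ≡ 4 ℕ.+ toℕ (Fin.combine p t)
  toℕ-encode-mid p t = ≡.trans (Finₚ.toℕ-↑ʳ 4 _) (≡.cong (4 ℕ.+_) (Finₚ.toℕ-↑ˡ (Fin.combine p t) k))

  toℕ-encode-extra : ∀ t → toℕ (encode (extra t)) ≡ 4 ℕ.+ (6 ℕ.* k ℕ.+ toℕ t)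
  toℕ-encode-extra t = ≡.trans (Finₚ.toℕ-↑ʳ 4 ((6 ℕ.* k) Fin.↑ʳ t)) (≡.cong (4 ℕ.+_) (Finₚ.toℕ-↑ʳ (6 ℕ.* k) t))

  toℕ-vcore : ∀ a → toℕ (vcore a) ≡ toℕ a
  toℕ-vcore a = Finₚ.toℕ-↑ˡ a _

  Anchored : ∀ {d} → (Fin n → Fin d) → Fin n → Set
  Anchored π i = (∃ λ c → π (vcore c) ≡ π i × (i ≡ vcore c ⊎ Adj i (vcore c))) ⊎ (∀ j → π i ≡ π j → i ≡ j)

  -- The induced subgraph on the first d vertices, which still contains all of Q₄(M).
  module Prefix (d : ℕ) (Q≤d : 4 ℕ.+ 6 ℕ.* k ≤ d) (d≤n : d ≤ n) where
    ι : Fin d → Fin n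
    ι v = Fin.inject≤ v d≤n

    ι-injective : ∀ {v w} → ι v ≡ ι w → v ≡ w
    ι-injective = Finₚ.inject≤-injective d≤n d≤n _ _

    4≤d : 4 ≤ d
    4≤d = ℕₚ.≤-trans (ℕₚ.m≤m+n 4 _) Q≤d

    hub : Fin 4 → Fin d
    hub a = Fin.inject≤ a 4≤d

    ι-hub : ∀ a → ι (hub a) ≡ vcore a
    ι-hub a = Finₚ.toℕ-injective (≡.trans (Finₚ.toℕ-inject≤ (hub a) d≤n)
      (≡.trans (Finₚ.toℕ-inject≤ a 4≤d) (≡.sym (toℕ-vcore a))))

    label : Fin d → Label k
    label v = decode k (ι v)

    system : System d
    system = record
      { r = 4 ; hub = hub ; hub-inj = Finₚ.inject≤-injective 4≤d 4≤d _ _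
      ; nbrs = λ v → ends (label v) ; nbrs-unique = λ v → ends-unique (label v) }

    open System system public using (IsHub; N; deg; deg-hub; deg-leaf; N-intro; N-elim)

    core-hub : ∀ {v a} → label v ≡ core a → hub a ≡ v
    core-hub {v} {a} eq = ι-injective (≡.trans (ι-hub a) (≡.sym (encode-of (ι v) eq)))

    hub-label : ∀ a → label (hub a) ≡ core a
    hub-label a = decode-of (ι-hub a)

    leaf-label : ∀ {v} → ¬ IsHub v → Leaf (label v)
    leaf-label {v} ¬h with core? (label v)
    ... | inj₁ (a , eq) = ⊥-elim (¬h (a , core-hub eq))
    ... | inj₂ leaf     = leaf

    label-leaf : ∀ {v} → Leaf (label v) → ¬ IsHub v
    label-leaf {v} leaf (a , ≡.refl) = ≡.subst Leaf (hub-label a) leaf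

    _∼_ : Fin d → Fin d → Set
    v ∼ w = LAdj (label v) (label w)

    N⊆∼ : ∀ {a u} → u ∈ N a → a ∼ u
    N⊆∼ = N-elim _∼_
      (λ {i} {j} j<i → ≡.subst₂ LAdj (≡.sym (hub-label i)) (≡.sym (hub-label j)) λ { ≡.refl → ℕₚ.<-irrefl ≡.refl j<i })
      (λ {v} {j} _ j∈ → ≡.subst (LAdj (label v)) (≡.sym (hub-label j)) (ends-adj (label v) j∈))

    ∼-closed : ∀ a → ¬ IsHub a → ∀ i → i ∼ a ⊎ a ∼ i → i ∈ N a
    ∼-closed a ¬h i adj with leaf-adj (leaf-label ¬h) (Sum.[ LAdj-sym (label i) (label a) , id ] adj)
    ... | c , eq , c∈ = ≡.subst (_∈ N a) (core-hub eq) (N-intro ¬h c∈)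

    deg-core : ∀ v → toℕ v < 4 → deg v ≡ toℕ v
    deg-core v v<4 = ≡.trans (≡.cong deg v≡) (≡.trans (deg-hub c) (Finₚ.toℕ-fromℕ< v<4))
      where
      c : Fin 4
      c = Fin.fromℕ< v<4
      v≡ : v ≡ hub c
      v≡ = Finₚ.toℕ-injective (≡.sym (≡.trans (Finₚ.toℕ-inject≤ c 4≤d) (Finₚ.toℕ-fromℕ< v<4)))

    private
      toℕ-label : ∀ {v l} → label v ≡ l → toℕ v ≡ toℕ (encode l)
      toℕ-label {v} eq = ≡.trans (≡.sym (Finₚ.toℕ-inject≤ v d≤n)) (≡.cong toℕ (encode-of (ι v) eq))

    deg-mid : ∀ v → 4 ≤ toℕ v → toℕ v < 4 ℕ.+ 6 ℕ.* k → deg v ≡ 2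
    deg-mid v 4≤v v< = go (label v) ≡.refl
      where
      go : ∀ l → label v ≡ l → deg v ≡ 2
      go (core a) eq = ⊥-elim (ℕₚ.<⇒≱ (Finₚ.toℕ<n a) (≡.subst (4 ≤_) (≡.trans (toℕ-label eq) (toℕ-vcore a)) 4≤v))
      go (mid p t) eq = ≡.trans (deg-leaf (label-leaf (≡.subst Leaf (≡.sym eq) _))) (≡.cong (length ∘ ends) eq)
      go (extra t) eq = ⊥-elim (ℕₚ.<⇒≱ v< (≡.subst (4 ℕ.+ 6 ℕ.* k ≤_)
                      (≡.sym (≡.trans (toℕ-label eq) (toℕ-encode-extra t))) (ℕₚ.m≤m+n (4 ℕ.+ 6 ℕ.* k) (toℕ t))))

    deg-extra : ∀ v → 4 ℕ.+ 6 ℕ.* k ≤ toℕ v → deg v ≡ 3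
    deg-extra v v≥ = go (label v) ≡.refl
      where
      go : ∀ l → label v ≡ l → deg v ≡ 3
      go (core a) eq = ⊥-elim (ℕₚ.<⇒≱ (Finₚ.toℕ<n a) (≡.subst (4 ≤_) (≡.trans (toℕ-label eq) (toℕ-vcore a))
                      (ℕₚ.≤-trans (ℕₚ.m≤m+n 4 _) v≥)))
      go (mid p t) eq = ⊥-elim (ℕₚ.<⇒≱ (Finₚ.toℕ<n (Fin.combine p t)) (ℕₚ.+-cancelˡ-≤ 4 _ _
                      (≡.subst (4 ℕ.+ 6 ℕ.* k ≤_) (≡.trans (toℕ-label eq) (toℕ-encode-mid p t)) v≥)))
      go (extra t) eq = ≡.trans (deg-leaf (label-leaf (≡.subst Leaf (≡.sym eq) _))) (≡.cong (length ∘ ends) eq)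

-- Anchoring makes the classes of π connected, so that they define a flat.
record Contraction (k d : ℕ) : Set where
  open Graph k
  field
    π         : Fin n → Fin d
    section   : Fin d → Fin n
    π-section : ∀ b → π (section b) ≡ b
    anchor    : ∀ i → Anchored π i

  Contracted : Fin d → Fin d → Set
  Contracted a b = ∃ λ i → ∃ λ j → Adj i j × π i ≡ a × π j ≡ b × a ≢ b

module Flats {c ℓ : Level} (K : Field c ℓ) (k : ℕ) where
  open Graph k
  open Field K using (_≈_; refl; sym; trans; reflexive)

  -- The flat is cut out by the edges inside the classes of `π`. Two members of a class are linked
  -- by passing from each to a core of the class, and two cores are equal or adjacent.
  flat : ∀ {d} → Contraction k d → Flat K Adj d
  flat {d} C = record
    { π    = π
    ; surj = λ b → section b , π-section b
    ; S    = λ i j → ⌊ edge? i j ⌋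
    ; S⊆A  = λ i j t → proj₁ (toWitness {a? = edge? i j} t)
    ; ∩S⊆X = λ x h i j eq → glue x h i j eq (anchor i) (anchor j)
    ; X⊆∩S = λ x h i j t → h i j (proj₂ (toWitness {a? = edge? i j} t)) }
    where
    open Contraction C
    edge? : ∀ i j → Dec (Adj i j × π i ≡ π j)
    edge? i j = LAdj? (decode k i) (decode k j) ×-dec (π i Fin.≟ π j)

    module _ (x : Fin n → Field.Carrier K) (h : ∀ i j → T ⌊ edge? i j ⌋ → x i ≈ x j) where
      step : ∀ {i j} → Adj i j → π i ≡ π j → x i ≈ x j
      step {i} {j} adj eq = h i j (fromWitness {a? = edge? i j} (adj , eq))
      cores : ∀ c c′ → π (vcore c) ≡ π (vcore c′) → x (vcore c) ≈ x (vcore c′)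
      cores c c′ eq with c Fin.≟ c′
      ... | yes ≡.refl = refl
      ... | no ne      = step (adj-encode ne) eq
      to-core : ∀ {i c} → π (vcore c) ≡ π i → i ≡ vcore c ⊎ Adj i (vcore c) → x i ≈ x (vcore c)
      to-core eq (inj₁ ≡.refl) = refl
      to-core eq (inj₂ adj)    = step adj (≡.sym eq)
      glue : ∀ i j → π i ≡ π j → Anchored π i → Anchored π j → x i ≈ x j
      glue i j eq (inj₂ alone) _ = reflexive (≡.cong x (alone j eq))
      glue i j eq _ (inj₂ alone) = reflexive (≡.cong x (≡.sym (alone i (≡.sym eq))))
      glue i j eq (inj₁ (c , πc , ci)) (inj₁ (c′ , πc′ , c′j)) = trans (to-core πc ci)
        (trans (cores c c′ (≡.trans πc (≡.trans eq (≡.sym πc′)))) (sym (to-core πc′ c′j)))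

  chain : ∀ {d d′} (C : Contraction k d) (C′ : Contraction k d′) →
          (∀ i j → Contraction.π C′ i ≡ Contraction.π C′ j → Contraction.π C i ≡ Contraction.π C j) →
          _⊆F_ K Adj (flat C) (flat C′)
  chain C C′ factor x x∈C i j eq = x∈C i j (factor i j eq)

-- The flats of the witness

-- With indices from 0, the first summand produces 0, 1, 2, 2, and so on; the second raises the
-- value to 3 from index 6k + 3 on.
exponent : ℕ → ℕ → ℕ
exponent k i = (i ℕ.⊓ 2) ℕ.+ ((i ∸ (2 ℕ.+ 6 ℕ.* k)) ℕ.⊓ 1)

exponent-mono : ∀ k {i j} → i ≤ j → exponent k i ≤ exponent k j
exponent-mono k i≤j = ℕₚ.+-mono-≤ (ℕₚ.⊓-monoˡ-≤ 2 i≤j) (ℕₚ.⊓-monoˡ-≤ 1 (ℕₚ.∸-monoˡ-≤ (2 ℕ.+ 6 ℕ.* k) i≤j))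

exponent-low : ∀ k {i} → i ≤ 2 ℕ.+ 6 ℕ.* k → exponent k i ≡ i ℕ.⊓ 2
exponent-low k {i} le rewrite ℕₚ.m≤n⇒m∸n≡0 le = ℕₚ.+-identityʳ _

exponent-high : ∀ k {i} → 3 ℕ.+ 6 ℕ.* k ≤ i → exponent k i ≡ 3
exponent-high k {i} le = ≡.cong₂ ℕ._+_ (ℕₚ.m≥n⇒m⊓n≡n (ℕₚ.≤-trans (ℕₚ.m≤m+n 2 _) (ℕₚ.≤-trans (ℕₚ.n≤1+n _) le)))
  (ℕₚ.m≥n⇒m⊓n≡n (ℕₚ.m<n⇒0<n∸m le))

-- The restriction to a flat of dimension at most 6k + 3: vertices 1 and 2 are identified, the
-- vertices attached to both are absorbed, and in the resulting K₃ with 6k vertices of degree 2 all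
-- vertices placed at d or later are contracted into a neighbour.
module Placement (k : ℕ) where
  open Graph k

  D : ℕ
  D = 3 ℕ.+ (5 ℕ.* k ℕ.+ k)

  η : Fin 4 → Fin 3
  η zero          = zero
  η (suc zero)    = zero
  η (suc (suc a)) = suc a

  representative : Fin 3 → Fin 4
  representative zero    = zero
  representative (suc a) = suc (suc a)

  η-representative : ∀ a → η (representative a) ≡ a
  η-representative zero    = ≡.refl
  η-representative (suc a) = ≡.refl

  hubD : Fin 3 → Fin D
  hubD a = a Fin.↑ˡ (5 ℕ.* k ℕ.+ k)

  -- Pair `zero` is {1,2}, so its vertices join the merged vertex at position 0. Three hubs come
  -- first, then the 5k vertices of the other pairs, then the k extra vertices.
  place : Label k → Fin D
  place (core a)        = hubD (η a)
  place (mid zero t)    = zero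
  place (mid (suc p) t) = 3 Fin.↑ʳ (Fin.combine p t Fin.↑ˡ k)
  place (extra t)       = 3 Fin.↑ʳ ((5 ℕ.* k) Fin.↑ʳ t)

  pick-leaf : Fin (5 ℕ.* k) ⊎ Fin k → Label k
  pick-leaf (inj₁ q) = mid (suc (proj₁ (Fin.remQuot {5} k q))) (proj₂ (Fin.remQuot {5} k q))
  pick-leaf (inj₂ t) = extra t

  pick′ : Fin 3 ⊎ Fin (5 ℕ.* k ℕ.+ k) → Label k
  pick′ (inj₁ a) = core (representative a)
  pick′ (inj₂ r) = pick-leaf (Fin.splitAt (5 ℕ.* k) r)

  pick : Fin D → Label k
  pick b = pick′ (Fin.splitAt 3 b)

  place-pick : ∀ b → place (pick b) ≡ b
  place-pick b with Fin.splitAt 3 b in eq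
  ... | inj₁ a = ≡.trans (≡.cong hubD (η-representative a)) (Finₚ.splitAt⁻¹-↑ˡ eq)
  ... | inj₂ r with Fin.splitAt (5 ℕ.* k) r in eq′
  ...   | inj₁ q = ≡.trans (≡.cong (λ z → 3 Fin.↑ʳ (z Fin.↑ˡ k)) (Finₚ.combine-remQuot {5} k q))
                     (≡.trans (≡.cong (3 Fin.↑ʳ_) (Finₚ.splitAt⁻¹-↑ˡ eq′)) (Finₚ.splitAt⁻¹-↑ʳ eq))
  ...   | inj₂ t = ≡.trans (≡.cong (3 Fin.↑ʳ_) (Finₚ.splitAt⁻¹-↑ʳ eq′)) (Finₚ.splitAt⁻¹-↑ʳ eq)

  pick-hubD : ∀ a → pick (hubD a) ≡ core (representative a)
  pick-hubD a = ≡.cong pick′ (Finₚ.splitAt-↑ˡ 3 a (5 ℕ.* k ℕ.+ k))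

  data Outer : Label k → Set where
    mid   : ∀ p t → Outer (mid (suc p) t)
    extra : ∀ t → Outer (extra t)

  pick-place : ∀ {l} → Outer l → pick (place l) ≡ l
  pick-place (mid p t) = ≡.trans (≡.cong pick′ (Finₚ.splitAt-↑ʳ 3 _ (Fin.combine p t Fin.↑ˡ k)))
    (≡.trans (≡.cong pick-leaf (Finₚ.splitAt-↑ˡ (5 ℕ.* k) (Fin.combine p t) k))
             (≡.cong (λ { (p , t) → mid (suc p) t }) (Finₚ.remQuot-combine p t)))
  pick-place (extra t) = ≡.trans (≡.cong pick′ (Finₚ.splitAt-↑ʳ 3 _ ((5 ℕ.* k) Fin.↑ʳ t)))
    (≡.cong pick-leaf (Finₚ.splitAt-↑ʳ (5 ℕ.* k) k t))

  toℕ-hubD : ∀ a → toℕ (hubD a) ≡ toℕ a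
  toℕ-hubD a = Finₚ.toℕ-↑ˡ a _

  hubD<3 : ∀ a → toℕ (hubD a) < 3
  hubD<3 a = ≡.subst (_< 3) (≡.sym (toℕ-hubD a)) (Finₚ.toℕ<n a)

  outer : ∀ l → 3 ≤ toℕ (place l) → Outer l
  outer (core a)        le = ⊥-elim (ℕₚ.<⇒≱ (hubD<3 (η a)) le)
  outer (mid (suc p) t) le = mid p t
  outer (extra t)       le = extra t

  outer-pick : ∀ b → 3 ≤ toℕ b → Outer (pick b)
  outer-pick b le = outer (pick b) (≡.subst (λ z → 3 ≤ toℕ z) (≡.sym (place-pick b)) le)

  outer-place : ∀ {l} → Outer l → 3 ≤ toℕ (place l)
  outer-place (mid p t) = ℕₚ.m≤m+n 3 _
  outer-place (extra t) = ℕₚ.m≤m+n 3 _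

  pick-inner : ∀ b → toℕ b < 3 → ∃ λ a → pick b ≡ core a
  pick-inner b b<3 = representative a , ≡.trans (≡.cong pick b≡) (pick-hubD a)
    where
    a : Fin 3
    a = Fin.fromℕ< b<3
    b≡ : b ≡ hubD a
    b≡ = Finₚ.toℕ-injective (≡.sym (≡.trans (toℕ-hubD a) (Finₚ.toℕ-fromℕ< b<3)))

  -- An extra vertex is adjacent to 1, 2 and 3, of which 1 and 2 are now the same hub. It is left
  -- with two neighbours, just like the vertices attached to pairs other than {1,2}.
  innerEnds : Label k → List (Fin 3)
  innerEnds (core _)        = []
  innerEnds (mid zero _)    = []
  innerEnds (mid (suc p) _) = η (pairFst (suc p)) ∷ η (pairSnd (suc p)) ∷ []
  innerEnds (extra _)       = # 0 ∷ # 1 ∷ []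

  innerEnds-unique : ∀ l → Unique (innerEnds l)
  innerEnds-unique (core _)        = []
  innerEnds-unique (mid zero _)    = []
  innerEnds-unique (mid (suc p) _) = (distinct p ∷ []) ∷ [] ∷ []
    where
    distinct : ∀ p → η (pairFst (suc p)) ≢ η (pairSnd (suc p))
    distinct = toWitness {a? = Finₚ.all? λ p → ¬? (η (pairFst (suc p)) Fin.≟ η (pairSnd (suc p)))} tt
  innerEnds-unique (extra _)       = ((λ ()) ∷ []) ∷ [] ∷ []

  innerEnds-length : ∀ {l} → Outer l → length (innerEnds l) ≡ 2
  innerEnds-length (mid p t) = ≡.refl
  innerEnds-length (extra t) = ≡.refl

  innerEnds-adj : ∀ l {a} → a ∈ innerEnds l → ∃ λ c → η c ≡ a × LAdj l (core c)
  innerEnds-adj (mid (suc p) _) (here ≡.refl)         = _ , ≡.refl , inj₁ ≡.refl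
  innerEnds-adj (mid (suc p) _) (there (here ≡.refl)) = _ , ≡.refl , inj₂ ≡.refl
  innerEnds-adj (extra _)       (here ≡.refl)         = # 0 , ≡.refl , s≤s z≤n
  innerEnds-adj (extra _)       (there (here ≡.refl)) = # 2 , ≡.refl , s≤s (s≤s (s≤s z≤n))

  adj-innerEnds : ∀ {l l′} → Outer l → LAdj l l′ → ∃ λ c → l′ ≡ core c × η c ∈ innerEnds l
  adj-innerEnds {l′ = core c} (mid p t) (inj₁ eq) = c , ≡.refl , here (≡.cong η eq)
  adj-innerEnds {l′ = core c} (mid p t) (inj₂ eq) = c , ≡.refl , there (here (≡.cong η eq))
  adj-innerEnds {l′ = core zero}             (extra t) _ = _ , ≡.refl , here ≡.refl
  adj-innerEnds {l′ = core (suc zero)}       (extra t) _ = _ , ≡.refl , here ≡.refl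
  adj-innerEnds {l′ = core (suc (suc zero))} (extra t) _ = _ , ≡.refl , there (here ≡.refl)
  adj-innerEnds {l′ = core (suc (suc (suc zero)))} (extra t) (s≤s (s≤s (s≤s ())))

  parentCore : Label k → Fin 4
  parentCore (core _)  = zero
  parentCore (mid p _) = pairFst p
  parentCore (extra _) = zero

  parentCore-adj : ∀ {l} → Outer l → LAdj l (core (parentCore l))
  parentCore-adj (mid p t) = inj₁ ≡.refl
  parentCore-adj (extra t) = s≤s z≤n

  parent : Fin D → Fin 3
  parent b = η (parentCore (pick b))

  parent-hubD : ∀ a → parent (hubD a) ≡ zero
  parent-hubD a rewrite pick-hubD a = ≡.refl

  module Cut (d : ℕ) (1≤d : 1 ≤ d) where
    cut″ : ∀ {q} → Dec (q < d) → Fin d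
    cut″ (yes q<d) = Fin.fromℕ< q<d
    cut″ (no _)    = Fin.fromℕ< 1≤d

    cut′ : ∀ {l q} → Dec (l < d) → Dec (q < d) → Fin d
    cut′ (yes l<d) _   = Fin.fromℕ< l<d
    cut′ (no _)    q<d? = cut″ q<d?

    -- A position from `d` on moves to its parent hub, and to position 0 if that hub is cut off too,
    -- which can happen only for d < 3.
    cut : Fin D → Fin d
    cut b = cut′ (toℕ b ℕ.<? d) (toℕ (parent b) ℕ.<? d)

    cut-< : ∀ b → toℕ b < d → toℕ (cut b) ≡ toℕ b
    cut-< b b<d with toℕ b ℕ.<? d
    ... | yes p = Finₚ.toℕ-fromℕ< p
    ... | no ≮  = ⊥-elim (≮ b<d)

    cut-≥ : ∀ b → d ≤ toℕ b → cut b ≡ cut″ (toℕ (parent b) ℕ.<? d)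
    cut-≥ b d≤b with toℕ b ℕ.<? d
    ... | yes p = ⊥-elim (ℕₚ.<⇒≱ p d≤b)
    ... | no _  = ≡.refl

    cut″-<3 : ∀ {q} (q<d? : Dec (q < d)) → q < 3 → toℕ (cut″ q<d?) < 3
    cut″-<3 (yes p) q<3 = ≡.subst (_< 3) (≡.sym (Finₚ.toℕ-fromℕ< p)) q<3
    cut″-<3 (no _)  q<3 = ≡.subst (_< 3) (≡.sym (Finₚ.toℕ-fromℕ< 1≤d)) (s≤s z≤n)

    cut″-0 : ∀ (0<d? : Dec (0 < d)) → cut″ 0<d? ≡ Fin.fromℕ< 1≤d
    cut″-0 (yes p) = ≡.cong (λ z → Fin.fromℕ< z) (ℕₚ.≤-irrelevant p 1≤d)
    cut″-0 (no _)  = ≡.refl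

    cut-hubD : ∀ a → cut (hubD a) ≡ cut″ (toℕ a ℕ.<? d)
    cut-hubD a with toℕ (hubD a) ℕ.<? d | toℕ a ℕ.<? d
    ... | yes p | yes q = Finₚ.toℕ-injective (≡.trans (Finₚ.toℕ-fromℕ< p) (≡.trans (toℕ-hubD a) (≡.sym (Finₚ.toℕ-fromℕ< q))))
    ... | yes p | no ≮  = ⊥-elim (≮ (≡.subst (_< d) (toℕ-hubD a) p))
    ... | no ≮  | yes q = ⊥-elim (≮ (≡.subst (_< d) (≡.sym (toℕ-hubD a)) q))
    ... | no _  | no _  = ≡.trans (≡.cong (λ z → cut″ (toℕ z ℕ.<? d)) (parent-hubD a)) (cut″-0 (0 ℕ.<? d))

    cut-parent : ∀ b → d ≤ toℕ b → cut (hubD (parent b)) ≡ cut b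
    cut-parent b d≤b = ≡.trans (cut-hubD (parent b)) (≡.sym (cut-≥ b d≤b))

  -- The map `red` cuts once more, at `a`. A vertex that `b` sends to its parent has the same image
  -- as this parent under the cut at `a`. If `b` sends it to 0 because the parent is not below `b`,
  -- then the parent is not below `a` either.
  cut-factor : ∀ {a b} (1≤a : 1 ≤ a) (1≤b : 1 ≤ b) → a ≤ b → ∀ x y →
               Cut.cut b 1≤b x ≡ Cut.cut b 1≤b y → Cut.cut a 1≤a x ≡ Cut.cut a 1≤a y
  cut-factor {a} {b} 1≤a 1≤b a≤b x y eq =
    ≡.trans (≡.sym (through x)) (≡.trans (≡.cong red eq) (through y))
    where
    module A = Cut a 1≤a
    module B = Cut b 1≤b
    -- No bound of `b` by `D` is assumed; from `D` on the value is a mere default.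
    red : Fin b → Fin a
    red z with toℕ z ℕ.<? D
    ... | yes p = A.cut (Fin.fromℕ< p)
    ... | no _  = A.cut zero
    red-≡ : ∀ z x → toℕ z ≡ toℕ x → red z ≡ A.cut x
    red-≡ z x eq with toℕ z ℕ.<? D
    ... | yes p = ≡.cong A.cut (Finₚ.toℕ-injective (≡.trans (Finₚ.toℕ-fromℕ< p) eq))
    ... | no ≮  = ⊥-elim (≮ (≡.subst (_< D) (≡.sym eq) (Finₚ.toℕ<n x)))
    through : ∀ x → red (B.cut x) ≡ A.cut x
    through x with toℕ x ℕ.<? b
    ... | yes p = red-≡ _ x (Finₚ.toℕ-fromℕ< p)
    ... | no ≮  = far (toℕ (parent x) ℕ.<? b)
      where
      a≤x : a ≤ toℕ x
      a≤x = ℕₚ.≤-trans a≤b (ℕₚ.≮⇒≥ ≮)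
      far : ∀ q? → red (B.cut″ {toℕ (parent x)} q?) ≡ A.cut x
      far (yes p) = ≡.trans (red-≡ _ (hubD (parent x)) (≡.trans (Finₚ.toℕ-fromℕ< p) (≡.sym (toℕ-hubD (parent x)))))
                      (A.cut-parent x a≤x)
      far (no ≮q) = ≡.trans (red-≡ _ (hubD zero) (Finₚ.toℕ-fromℕ< 1≤b))
                      (≡.trans (A.cut-hubD zero) (≡.trans (A.cut″-0 (0 ℕ.<? a)) (≡.sym (≡.trans (A.cut-≥ x a≤x) (nowhere (toℕ (parent x) ℕ.<? a))))))
        where
        nowhere : ∀ q? → A.cut″ {toℕ (parent x)} q? ≡ Fin.fromℕ< 1≤a
        nowhere (yes q) = ⊥-elim (≮q (ℕₚ.<-≤-trans q a≤b))
        nowhere (no _)  = ≡.refl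

module LowDimension (k d : ℕ) (1≤d : 1 ≤ d) (d≤D : d ≤ Placement.D k) where
  open Graph k
  open Placement k
  open Cut d 1≤d

  ι : Fin d → Fin D
  ι b = Fin.inject≤ b d≤D

  toℕ-ι : ∀ b → toℕ (ι b) ≡ toℕ b
  toℕ-ι b = Finₚ.toℕ-inject≤ b d≤D

  π : Fin n → Fin d
  π i = cut (place (decode k i))

  π-encode : ∀ l → π (encode l) ≡ cut (place l)
  π-encode l = ≡.cong (cut ∘ place) (decode-encode l)

  section : Fin d → Fin n
  section b = encode (pick (ι b))

  π-section : ∀ b → π (section b) ≡ b
  π-section b = Finₚ.toℕ-injective (begin
    toℕ (π (section b))             ≡⟨ ≡.cong toℕ (π-encode (pick (ι b))) ⟩
    toℕ (cut (place (pick (ι b))))  ≡⟨ ≡.cong (toℕ ∘ cut) (place-pick (ι b)) ⟩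
    toℕ (cut (ι b))                 ≡⟨ cut-< (ι b) (≡.subst (_< d) (≡.sym (toℕ-ι b)) (Finₚ.toℕ<n b)) ⟩
    toℕ (ι b)                       ≡⟨ toℕ-ι b ⟩
    toℕ b                           ∎)
    where open ≡.≡-Reasoning

  -- Vertices moved by the cut land below position 3, so whatever sits at position 3 or later has
  -- stayed in place.
  π-outer : ∀ j → 3 ≤ toℕ (π j) → toℕ (π j) ≡ toℕ (place (decode k j))
  π-outer j le = go (toℕ (place (decode k j)) ℕ.<? d)
    where
    go : Dec (toℕ (place (decode k j)) < d) → toℕ (π j) ≡ toℕ (place (decode k j))
    go (yes p) = cut-< (place (decode k j)) p
    go (no ≮)  = ⊥-elim (ℕₚ.<⇒≱ (cut″-<3 (_ ℕ.<? d) (Finₚ.toℕ<n (parent (place (decode k j)))))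
                   (≡.subst (λ z → 3 ≤ toℕ z) (cut-≥ (place (decode k j)) (ℕₚ.≮⇒≥ ≮)) le))

  decode-outer : ∀ j → 3 ≤ toℕ (π j) → decode k j ≡ pick (ι (π j))
  decode-outer j le = ≡.trans (≡.sym (pick-place (outer (decode k j) (≡.subst (3 ≤_) (π-outer j le) le))))
    (≡.cong pick (Finₚ.toℕ-injective (≡.trans (≡.sym (π-outer j le)) (≡.sym (toℕ-ι (π j))))))

  -- A vertex that stays is alone in its class. One that is moved ends in the class of `parentCore`,
  -- to which it is adjacent.
  anchor-outer : ∀ i → Outer (decode k i) → Anchored π i
  anchor-outer i out = go (toℕ (place l) ℕ.<? d)
    where
    l : Label k
    l = decode k i
    go : Dec (toℕ (place l) < d) → Anchored π i
    go (yes p) = inj₂ λ j eq → ≡.trans (encode-of i (decode-outer i le))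
        (≡.trans (≡.cong (encode ∘ pick ∘ ι) eq) (≡.sym (encode-of j (decode-outer j (≡.subst (λ z → 3 ≤ toℕ z) eq le)))))
      where
      le : 3 ≤ toℕ (π i)
      le = ≡.subst (3 ≤_) (≡.sym (cut-< (place l) p)) (outer-place out)
    go (no ≮)  = inj₁ (parentCore l , same , inj₂ (≡.subst (λ z → Adj z (vcore (parentCore l))) (encode-decode i)
                   (adj-encode (parentCore-adj out))))
      where
      same : π (vcore (parentCore l)) ≡ π i
      same = ≡.trans (π-encode (core (parentCore l)))
        (≡.trans (≡.cong (λ z → cut (hubD (η (parentCore z)))) (≡.sym (pick-place out)))
                 (cut-parent (place l) (ℕₚ.≮⇒≥ ≮)))

  anchor-at : ∀ i l → decode k i ≡ l → Anchored π i
  anchor-at i (core c)        eq = inj₁ (c , ≡.cong π (≡.sym (encode-of i eq)) , inj₁ (encode-of i eq))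
  anchor-at i (mid zero t)    eq = inj₁ (zero , ≡.trans (π-encode (core zero)) (≡.cong (cut ∘ place) (≡.sym eq))
                                        , inj₂ (≡.subst₂ LAdj (≡.sym eq) (≡.sym (decode-encode (core zero))) (inj₁ ≡.refl)))
  anchor-at i (mid (suc p) t) eq = anchor-outer i (≡.subst Outer (≡.sym eq) (mid p t))
  anchor-at i (extra t)       eq = anchor-outer i (≡.subst Outer (≡.sym eq) (extra t))

  contraction : Contraction k d
  contraction = record
    { π = π ; section = section ; π-section = π-section ; anchor = λ i → anchor-at i (decode k i) ≡.refl }

  open Contraction contraction using (Contracted)

  Contracted-sym : ∀ {a b} → Contracted a b → Contracted b a
  Contracted-sym (i , j , adj , πi , πj , ne) = j , i , Adj-sym {i} {j} adj , πj , πi , ne ∘ ≡.sym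

  inner-adj : ∀ {a b} → toℕ a < 3 → toℕ b < 3 → a ≢ b → Contracted a b
  inner-adj {a} {b} a<3 b<3 a≢b =
    let c  , eq  = pick-inner (ι a) (≡.subst (_< 3) (≡.sym (toℕ-ι a)) a<3)
        c′ , eq′ = pick-inner (ι b) (≡.subst (_< 3) (≡.sym (toℕ-ι b)) b<3)
    in section a , section b
     , adj-encode (≡.subst₂ LAdj (≡.sym eq) (≡.sym eq′) λ c≡c′ → a≢b
         (≡.trans (≡.sym (π-section a)) (≡.trans (≡.cong (π ∘ encode) (≡.trans eq (≡.trans (≡.cong core c≡c′) (≡.sym eq′)))) (π-section b))))
     , π-section a , π-section b , a≢b

  D≡ : D ≡ 3 ℕ.+ 6 ℕ.* k
  D≡ = ≡.cong (3 ℕ.+_) (ℕₚ.+-comm (5 ℕ.* k) k)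

  exponent-≡ : ∀ (v : Fin d) → exponent k (toℕ v) ≡ toℕ v ℕ.⊓ 2
  exponent-≡ v = exponent-low k (ℕ.s≤s⁻¹ (≡.subst (toℕ v <_) D≡ (ℕₚ.<-≤-trans (Finₚ.toℕ<n v) d≤D)))

  module _ {c ℓ : Level} (K : Field c ℓ) where

    free-complete : d ≤ 3 → FreeWithExps K Contracted (exponent k ∘ toℕ)
    free-complete d≤3 = SystemBases.free K system Perm.id degrees
      (N-elim Contracted (λ {i} {j} j<i → inner-adj (small i) (small j) λ { ≡.refl → ℕₚ.<-irrefl ≡.refl j<i })
        (λ { {v} ¬h _ → ⊥-elim (¬h (v , ≡.refl)) }))
      (λ a ¬h → ⊥-elim (¬h (a , ≡.refl)))
      where
      small : ∀ (i : Fin d) → toℕ i < 3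
      small i = ℕₚ.<-≤-trans (Finₚ.toℕ<n i) d≤3
      system : System d
      system = record { r = d ; hub = id ; hub-inj = id ; nbrs = λ _ → [] ; nbrs-unique = λ _ → [] }
      open System system using (deg; deg-hub; N-elim)
      degrees : ∀ b → deg b ≡ exponent k (toℕ b)
      degrees b = ≡.trans (deg-hub b) (≡.sym (≡.trans (exponent-≡ b) (ℕₚ.m≤n⇒m⊓n≡m (ℕ.s≤s⁻¹ (small b)))))

    free-triangle : 3 ≤ d → FreeWithExps K Contracted (exponent k ∘ toℕ)
    free-triangle 3≤d = SystemBases.free K system Perm.id degrees
      (N-elim Contracted
        (λ {i} {j} j<i → inner-adj (hub<3 i) (hub<3 j) λ eq →
          ℕₚ.<-irrefl (≡.cong toℕ (Finₚ.inject≤-injective 3≤d 3≤d j i (≡.sym eq))) j<i)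
        leaf-edge)
      closed
      where
      hub : Fin 3 → Fin d
      hub a = Fin.inject≤ a 3≤d
      system : System d
      system = record
        { r = 3 ; hub = hub ; hub-inj = Finₚ.inject≤-injective 3≤d 3≤d _ _
        ; nbrs = λ v → innerEnds (pick (ι v)) ; nbrs-unique = λ v → innerEnds-unique (pick (ι v)) }
      open System system using (IsHub; N; deg; deg-hub; deg-leaf; N-elim; N-intro)

      toℕ-hub : ∀ a → toℕ (hub a) ≡ toℕ a
      toℕ-hub a = Finₚ.toℕ-inject≤ a 3≤d

      hub<3 : ∀ a → toℕ (hub a) < 3
      hub<3 a = ≡.subst (_< 3) (≡.sym (toℕ-hub a)) (Finₚ.toℕ<n a)

      inner-hub : ∀ v (v<3 : toℕ v < 3) → hub (Fin.fromℕ< v<3) ≡ v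
      inner-hub v v<3 = Finₚ.toℕ-injective (≡.trans (toℕ-hub _) (Finₚ.toℕ-fromℕ< v<3))

      leaf≥3 : ∀ {v} → ¬ IsHub v → 3 ≤ toℕ v
      leaf≥3 {v} ¬h = ℕₚ.≮⇒≥ λ v<3 → ¬h (Fin.fromℕ< v<3 , inner-hub v v<3)

      π-core : ∀ c → π (vcore c) ≡ hub (η c)
      π-core c = Finₚ.toℕ-injective (≡.trans (≡.cong toℕ (π-encode (core c)))
        (≡.trans (cut-< (hubD (η c)) (ℕₚ.<-≤-trans (hubD<3 (η c)) 3≤d)) (≡.trans (toℕ-hubD (η c)) (≡.sym (toℕ-hub (η c))))))

      leaf-edge : ∀ {v j} → ¬ IsHub v → j ∈ innerEnds (pick (ι v)) → Contracted v (hub j)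
      leaf-edge {v} {j} ¬h j∈ with innerEnds-adj (pick (ι v)) j∈
      ... | c , ηc , adj = section v , vcore c , adj-encode adj , π-section v
            , ≡.trans (π-core c) (≡.cong hub ηc) , λ eq → ¬h (j , ≡.sym eq)

      -- Over a leaf position there is a single vertex, so the neighbours of the position are images
      -- of neighbours of this vertex.
      closed′ : ∀ {v i} → ¬ IsHub v → Contracted v i → i ∈ N v
      closed′ ¬h (x , y , adj , ≡.refl , ≡.refl , _) = go (adj-innerEnds {l′ = decode k y} out (≡.subst (λ l → LAdj l (decode k y)) dx adj))
        where
        dx : decode k x ≡ pick (ι (π x))
        dx = decode-outer x (leaf≥3 ¬h)
        out : Outer (pick (ι (π x)))
        out = outer-pick (ι (π x)) (≡.subst (3 ≤_) (≡.sym (toℕ-ι (π x))) (leaf≥3 ¬h))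
        go : (∃ λ c → decode k y ≡ core c × η c ∈ innerEnds (pick (ι (π x)))) → π y ∈ N (π x)
        go (c , dy , c∈) = ≡.subst (_∈ N (π x)) (≡.trans (≡.sym (π-core c)) (≡.cong π (≡.sym (encode-of y dy)))) (N-intro ¬h c∈)

      closed : ∀ v → ¬ IsHub v → ∀ i → Contracted i v ⊎ Contracted v i → i ∈ N v
      closed v ¬h i (inj₁ iv) = closed′ ¬h (Contracted-sym iv)
      closed v ¬h i (inj₂ vi) = closed′ ¬h vi

      degrees : ∀ v → deg v ≡ exponent k (toℕ v)
      degrees v = ≡.trans (go (toℕ v ℕ.<? 3)) (≡.sym (exponent-≡ v))
        where
        go : Dec (toℕ v < 3) → deg v ≡ toℕ v ℕ.⊓ 2
        go (yes v<3) = ≡.trans (≡.cong deg (≡.sym (inner-hub v v<3))) (≡.trans (deg-hub _)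
          (≡.trans (Finₚ.toℕ-fromℕ< v<3) (≡.sym (ℕₚ.m≤n⇒m⊓n≡m (ℕ.s≤s⁻¹ v<3)))))
        go (no ≮) = ≡.trans (deg-leaf λ { (a , ≡.refl) → ≮ (hub<3 a) })
          (≡.trans (innerEnds-length (outer-pick (ι v) (≡.subst (3 ≤_) (≡.sym (toℕ-ι v)) (ℕₚ.≮⇒≥ ≮))))
            (≡.sym (ℕₚ.m≥n⇒m⊓n≡n (ℕₚ.≤-trans (ℕₚ.n≤1+n 2) (ℕₚ.≮⇒≥ ≮)))))

    free-low : FreeWithExps K Contracted (exponent k ∘ toℕ)
    free-low = go (d ℕ.≤? 3)
      where
      go : Dec (d ≤ 3) → FreeWithExps K Contracted (exponent k ∘ toℕ)
      go (yes d≤3) = free-complete d≤3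
      go (no d≰3)  = free-triangle (ℕₚ.<⇒≤ (ℕₚ.≰⇒> d≰3))

-- Here the extra vertices beyond the first d vertices are contracted into the vertex 1.
module HighDimension (k d : ℕ) (1≤k : 1 ≤ k) (Q≤d : 4 ℕ.+ 6 ℕ.* k ≤ d) (d≤n : d ≤ Graph.n k) where
  open Graph k
  open Prefix d Q≤d d≤n

  π′ : (i : Fin n) → Dec (toℕ i < d) → Fin d
  π′ i (yes p) = Fin.fromℕ< p
  π′ i (no _)  = hub zero

  π : Fin n → Fin d
  π i = π′ i (toℕ i ℕ.<? d)

  ι-π : ∀ i → toℕ i < d → ι (π i) ≡ i
  ι-π i i<d = go (toℕ i ℕ.<? d)
    where
    go : (i<d? : Dec (toℕ i < d)) → ι (π′ i i<d?) ≡ i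
    go (yes p) = Finₚ.toℕ-injective (≡.trans (Finₚ.toℕ-inject≤ _ d≤n) (Finₚ.toℕ-fromℕ< p))
    go (no ≮)  = ⊥-elim (≮ i<d)

  π-far : ∀ i → d ≤ toℕ i → π i ≡ hub zero
  π-far i d≤i = go (toℕ i ℕ.<? d)
    where
    go : (i<d? : Dec (toℕ i < d)) → π′ i i<d? ≡ hub zero
    go (yes p) = ⊥-elim (ℕₚ.<⇒≱ p d≤i)
    go (no _)  = ≡.refl

  π-ι : ∀ b → π (ι b) ≡ b
  π-ι b = ι-injective (ι-π (ι b) (≡.subst (_< d) (≡.sym (Finₚ.toℕ-inject≤ b d≤n)) (Finₚ.toℕ<n b)))

  π-vcore : ∀ c → π (vcore c) ≡ hub c
  π-vcore c = ≡.trans (≡.cong π (≡.sym (ι-hub c))) (π-ι (hub c))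

  far-extra : ∀ i l → decode k i ≡ l → d ≤ toℕ i → ∃ λ t → decode k i ≡ extra t
  far-extra i (core a)  eq d≤i = ⊥-elim (ℕₚ.<⇒≱ (Finₚ.toℕ<n a) (≡.subst (4 ≤_)
    (≡.trans (≡.cong toℕ (encode-of i eq)) (toℕ-vcore a)) (ℕₚ.≤-trans 4≤d d≤i)))
  far-extra i (mid p t) eq d≤i = ⊥-elim (ℕₚ.<⇒≱ (Finₚ.toℕ<n (Fin.combine p t)) (ℕₚ.+-cancelˡ-≤ 4 _ _
    (≡.subst (4 ℕ.+ 6 ℕ.* k ≤_) (≡.trans (≡.cong toℕ (encode-of i eq)) (toℕ-encode-mid p t)) (ℕₚ.≤-trans Q≤d d≤i))))
  far-extra i (extra t) eq d≤i = t , eq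

  anchor-far : ∀ i → d ≤ toℕ i → Anchored π i
  anchor-far i d≤i = let t , eq = far-extra i (decode k i) ≡.refl d≤i in
    inj₁ (zero , ≡.trans (π-vcore zero) (≡.sym (π-far i d≤i))
         , inj₂ (≡.subst (λ z → Adj z (vcore zero)) (≡.sym (encode-of i eq)) (adj-encode {extra t} {core zero} (s≤s z≤n))))

  anchor-near : ∀ i → toℕ i < d → (∃ λ c → decode k i ≡ core c) ⊎ Leaf (decode k i) → Anchored π i
  anchor-near i i<d (inj₁ (c , eq)) = inj₁ (c , ≡.cong π (≡.sym (encode-of i eq)) , inj₁ (encode-of i eq))
  anchor-near i i<d (inj₂ leaf)     = inj₂ λ j eq → alone j eq (toℕ j ℕ.<? d)
    where
    alone : ∀ j → π i ≡ π j → Dec (toℕ j < d) → i ≡ j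
    alone j eq (yes j<d) = ≡.trans (≡.sym (ι-π i i<d)) (≡.trans (≡.cong ι eq) (ι-π j j<d))
    alone j eq (no ≮)    = ⊥-elim (≡.subst Leaf (≡.trans (≡.cong (decode k)
      (≡.trans (≡.sym (ι-π i i<d)) (≡.cong ι (≡.trans eq (π-far j (ℕₚ.≮⇒≥ ≮)))))) (hub-label zero)) leaf)

  contraction : Contraction k d
  contraction = record { π = π ; section = ι ; π-section = π-ι ; anchor = λ i → go i (toℕ i ℕ.<? d) }
    where
    go : ∀ i → Dec (toℕ i < d) → Anchored π i
    go i (yes i<d) = anchor-near i i<d (core? (decode k i))
    go i (no ≮)    = anchor-far i (ℕₚ.≮⇒≥ ≮)

  open Contraction contraction using (Contracted)

  label-π : ∀ i → label (π i) ≡ decode k i ⊎ (∃ λ t → decode k i ≡ extra t × π i ≡ hub zero)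
  label-π i = go (toℕ i ℕ.<? d)
    where
    go : Dec (toℕ i < d) → label (π i) ≡ decode k i ⊎ (∃ λ t → decode k i ≡ extra t × π i ≡ hub zero)
    go (yes i<d) = inj₁ (≡.cong (decode k) (ι-π i i<d))
    go (no ≮)    = let t , eq = far-extra i (decode k i) ≡.refl (ℕₚ.≮⇒≥ ≮) in inj₂ (t , eq , π-far i (ℕₚ.≮⇒≥ ≮))

  core-∼-zero : ∀ i {t} → π i ≢ hub zero → LAdj (extra t) (decode k i) → π i ∼ hub zero
  core-∼-zero i {t} ne adj = let c , eq , _ = leaf-adj {l = extra t} tt adj in
    ≡.subst₂ LAdj
      (≡.sym (≡.trans (≡.cong label (≡.trans (≡.cong π (encode-of i eq)) (π-vcore c))) (hub-label c)))
      (≡.sym (hub-label zero))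
      λ c≡0 → ne (≡.trans (≡.cong π (encode-of i eq)) (≡.trans (π-vcore c) (≡.cong hub c≡0)))

  -- A contracted vertex is adjacent to cores only and becomes the vertex 1, so it adds no edge.
  Contracted→∼ : ∀ {a b} → Contracted a b → a ∼ b
  Contracted→∼ (i , j , adj , ≡.refl , ≡.refl , ne) = go (label-π i) (label-π j)
    where
    go : label (π i) ≡ decode k i ⊎ (∃ λ t → decode k i ≡ extra t × π i ≡ hub zero) →
         label (π j) ≡ decode k j ⊎ (∃ λ t → decode k j ≡ extra t × π j ≡ hub zero) → π i ∼ π j
    go (inj₁ eq) (inj₁ eq′) = ≡.subst₂ LAdj (≡.sym eq) (≡.sym eq′) adj
    go (inj₂ (t , eq , πi)) _ = LAdj-sym (label (π j)) (label (π i)) (≡.subst (π j ∼_) (≡.sym πi)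
      (core-∼-zero j {t} (λ πj → ne (≡.trans πi (≡.sym πj))) (≡.subst (λ l → LAdj l (decode k j)) eq adj)))
    go (inj₁ _) (inj₂ (t , eq , πj)) = ≡.subst (π i ∼_) (≡.sym πj)
      (core-∼-zero i {t} (λ πi → ne (≡.trans πi (≡.sym πj)))
        (LAdj-sym (decode k i) (extra t) (≡.subst (LAdj (decode k i)) eq adj)))

  ∼→Contracted : ∀ {a b} → a ≢ b → a ∼ b → Contracted a b
  ∼→Contracted {a} {b} ne a∼b = ι a , ι b , a∼b , π-ι a , π-ι b , ne

  -- Vertex 4 of K₄, and the last vertex of degree 2; the latter precedes all extra vertices, at
  -- index 6k + 3.
  i₃ iₘ : Fin d
  i₃ = hub (# 3)
  iₘ = Fin.fromℕ< {3 ℕ.+ 6 ℕ.* k} Q≤d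

  toℕ-i₃ : toℕ i₃ ≡ 3
  toℕ-i₃ = Finₚ.toℕ-inject≤ (# 3) 4≤d

  toℕ-iₘ : toℕ iₘ ≡ 3 ℕ.+ 6 ℕ.* k
  toℕ-iₘ = Finₚ.toℕ-fromℕ< Q≤d

  1≤6k : 1 ≤ 6 ℕ.* k
  1≤6k = ℕₚ.≤-trans 1≤k (ℕₚ.m≤n*m k 6)

  -- Vertex 4 of K₄ has degree 3 but comes before the vertices of degree 2; exchanging it with the
  -- last of these sorts the degrees.
  sort : Permutation d d
  sort = Perm.transpose i₃ iₘ

  sorted : ∀ b → deg (sort ⟨$⟩ʳ b) ≡ exponent k (toℕ b)
  sorted b with b Fin.≟ i₃
  -- Here k ≥ 1 separates `iₘ` from `i₃`, so that index 3 receives a vertex of degree 2.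
  ... | yes ≡.refl = ≡.trans (deg-mid iₘ (≡.subst (4 ≤_) (≡.sym toℕ-iₘ) (ℕₚ.+-monoʳ-≤ 3 1≤6k))
                                         (≡.subst (_< 4 ℕ.+ 6 ℕ.* k) (≡.sym toℕ-iₘ) ℕₚ.≤-refl))
                       (≡.sym (≡.trans (≡.cong (exponent k) toℕ-i₃) (exponent-low k (ℕₚ.+-monoʳ-≤ 2 1≤6k))))
  ... | no b≢i₃ with b Fin.≟ iₘ
  ...   | yes ≡.refl = ≡.trans (deg-core i₃ (≡.subst (_< 4) (≡.sym toℕ-i₃) ℕₚ.≤-refl))
                         (≡.trans toℕ-i₃ (≡.sym (exponent-high k (ℕₚ.≤-reflexive (≡.sym toℕ-iₘ)))))
  ...   | no b≢iₘ = go (toℕ b ℕ.<? 3) (toℕ b ℕ.<? 4 ℕ.+ 6 ℕ.* k)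
    where
    b≢3 : toℕ b ≢ 3
    b≢3 eq = b≢i₃ (Finₚ.toℕ-injective (≡.trans eq (≡.sym toℕ-i₃)))
    b≢m : toℕ b ≢ 3 ℕ.+ 6 ℕ.* k
    b≢m eq = b≢iₘ (Finₚ.toℕ-injective (≡.trans eq (≡.sym toℕ-iₘ)))
    go : Dec (toℕ b < 3) → Dec (toℕ b < 4 ℕ.+ 6 ℕ.* k) → deg b ≡ exponent k (toℕ b)
    go (yes b<3) _ = ≡.trans (deg-core b (ℕₚ.m≤n⇒m≤1+n b<3)) (≡.sym (≡.trans
      (exponent-low k (ℕₚ.≤-trans (ℕ.s≤s⁻¹ b<3) (ℕₚ.m≤m+n 2 _))) (ℕₚ.m≤n⇒m⊓n≡m (ℕ.s≤s⁻¹ b<3))))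
    go (no b≮3) (yes b<m) = ≡.trans (deg-mid b (ℕₚ.≤∧≢⇒< (ℕₚ.≮⇒≥ b≮3) (b≢3 ∘ ≡.sym)) b<m) (≡.sym (≡.trans
      (exponent-low k (ℕ.s≤s⁻¹ (ℕₚ.≤∧≢⇒< (ℕ.s≤s⁻¹ b<m) b≢m)))
      (ℕₚ.m≥n⇒m⊓n≡n (ℕₚ.≤-trans (ℕₚ.n≤1+n 2) (ℕₚ.≮⇒≥ b≮3)))))
    go (no _) (no b≮m) = ≡.trans (deg-extra b (ℕₚ.≮⇒≥ b≮m))
      (≡.sym (exponent-high k (ℕₚ.≤-trans (ℕₚ.n≤1+n _) (ℕₚ.≮⇒≥ b≮m))))

  module _ {c ℓ : Level} (K : Field c ℓ) where

    free-prefix : FreeWithExps K _∼_ (exponent k ∘ toℕ)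
    free-prefix = SystemBases.free K system sort sorted N⊆∼ ∼-closed

    free-high : FreeWithExps K Contracted (exponent k ∘ toℕ)
    free-high = SystemBases.free K system sort sorted
      (λ {a} {u} u∈ → ∼→Contracted {a} {u} (λ { ≡.refl → System.v∉N system a u∈ }) (N⊆∼ u∈))
      (λ a ¬h i adj → ∼-closed a ¬h i (Sum.map (Contracted→∼ {i} {a}) (Contracted→∼ {a} {i}) adj))

relation-resp : ∀ {c ℓ} (K : Field c ℓ) {d} {ρ ρ′ : Fin d → Fin d → Set} {e} →
                (∀ {a b} → ρ a b → ρ′ a b) → (∀ {a b} → ρ′ a b → ρ a b) →
                FreeWithExps K ρ e → FreeWithExps K ρ′ e
relation-resp K to from (θ , θ∈D , hom , spans , indep) =
  θ , (λ a i j r → θ∈D a i j (from r)) , hom , (λ φ φ∈D → spans φ (λ i j r → φ∈D i j (to r))) , indep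

module Whole (k : ℕ) where
  open Graph k

  Q≤n : 4 ℕ.+ 6 ℕ.* k ≤ n
  Q≤n = ℕₚ.+-monoʳ-≤ 4 (ℕₚ.m≤m+n (6 ℕ.* k) k)

  open Prefix n Q≤n ℕₚ.≤-refl public

  ι-id : ∀ a → ι a ≡ a
  ι-id a = Finₚ.toℕ-injective (Finₚ.toℕ-inject≤ a ℕₚ.≤-refl)

  ∼→Adj : ∀ a b → a ∼ b → Adj a b
  ∼→Adj a b = ≡.subst₂ Adj (ι-id a) (ι-id b)

  Adj→∼ : ∀ a b → Adj a b → a ∼ b
  Adj→∼ a b = ≡.subst₂ Adj (≡.sym (ι-id a)) (≡.sym (ι-id b))

-- Assembling the witness

module _ {c ℓ : Level} (K : Field c ℓ) (k : ℕ) (1≤k : 1 ≤ k) where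
  open Graph k
  open Flats K k

  private
    Q≤ : ∀ {m} → ¬ m ≤ Placement.D k → 4 ℕ.+ 6 ℕ.* k ≤ m
    Q≤ {m} m≰ = ≡.subst (λ z → suc z ≤ m) (≡.cong (3 ℕ.+_) (ℕₚ.+-comm (5 ℕ.* k) k)) (ℕₚ.≰⇒> m≰)

    contraction′ : (a : Fin n) → Dec (suc (toℕ a) ≤ Placement.D k) → Contraction k (suc (toℕ a))
    contraction′ a (yes a≤D) = LowDimension.contraction k (suc (toℕ a)) (s≤s z≤n) a≤D
    contraction′ a (no a≰D)  = HighDimension.contraction k (suc (toℕ a)) 1≤k (Q≤ a≰D) (Finₚ.toℕ<n a)

    contraction : (a : Fin n) → Contraction k (suc (toℕ a))
    contraction a = contraction′ a (suc (toℕ a) ℕ.≤? Placement.D k)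

    free-contraction : ∀ a a≤D? → FreeWithExps K (Contraction.Contracted (contraction′ a a≤D?)) (exponent k ∘ toℕ)
    free-contraction a (yes a≤D) = LowDimension.free-low k (suc (toℕ a)) (s≤s z≤n) a≤D K
    free-contraction a (no a≰D)  = HighDimension.free-high k (suc (toℕ a)) 1≤k (Q≤ a≰D) (Finₚ.toℕ<n a) K

    exponents-resp : ∀ {d} {ρ : Fin d → Fin d → Set} {e e′} → (∀ b → e b ≡ e′ b) →
                     FreeWithExps K ρ e → FreeWithExps K ρ e′
    exponents-resp eq (θ , θ∈D , hom , rest) =
      θ , θ∈D , (λ b i → ≡.subst (λ e → Homogeneous K e (θ b i)) (eq b) (hom b i)) , rest

    chain-low : ∀ a b (a≤D? : Dec (suc (toℕ a) ≤ Placement.D k)) (b≤D? : Dec (suc (toℕ b) ≤ Placement.D k)) →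
                toℕ a ≤ toℕ b → suc (toℕ b) ≤ Placement.D k →
                _⊆F_ K Adj (flat (contraction′ a a≤D?)) (flat (contraction′ b b≤D?))
    chain-low a b (yes a≤D) (yes b≤D) a≤b _ =
      chain (contraction′ a (yes a≤D)) (contraction′ b (yes b≤D)) λ i j →
        Placement.cut-factor k (s≤s z≤n) (s≤s z≤n) (s≤s a≤b) (Placement.place k (decode k i)) (Placement.place k (decode k j))
    chain-low a b (no a≰D) _        a≤b b≤D = ⊥-elim (a≰D (ℕₚ.≤-trans (s≤s a≤b) b≤D))
    chain-low a b _        (no b≰D) a≤b b≤D = ⊥-elim (b≰D b≤D)

    -- The required chain ends exactly at dimension `D`, so nesting is checked among the flats of
    -- low dimension only.
    n∸[1+k] : n ∸ suc k ≡ Placement.D k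
    n∸[1+k] = ≡.trans (ℕₚ.m+n∸n≡m (3 ℕ.+ 6 ℕ.* k) k) (≡.cong (3 ℕ.+_) (ℕₚ.+-comm k (5 ℕ.* k)))

  coaccurate : Coaccurate K Adj (suc k)
  coaccurate = exponent k ∘ toℕ
    , (λ a b → exponent-mono k)
    , relation-resp K (λ {a} {b} → Whole.∼→Adj k a b) (λ {a} {b} → Whole.Adj→∼ k a b)
        (HighDimension.free-prefix k n 1≤k (Whole.Q≤n k) ℕₚ.≤-refl K)
    , (λ a → flat (contraction a))
    , (λ a → exponents-resp (λ b → ≡.cong (exponent k) (≡.sym (Finₚ.toℕ-inject≤ b (Finₚ.toℕ<n a))))
               (free-contraction a (suc (toℕ a) ℕ.≤? Placement.D k)))
    , (λ a b a≤b b≤ → chain-low a b (suc (toℕ a) ℕ.≤? Placement.D k) (suc (toℕ b) ℕ.≤? Placement.D k) a≤b (≡.subst (suc (toℕ b) ≤_) n∸[1+k] b≤))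

-- Obstructions to longer chains

-- Vertices other than the hubs and `v` are left isolated: a test subgraph records just the edges
-- known to occur in the restriction.
module OneLeaf {d r : ℕ} (hub : Fin r → Fin d) (hub-inj : ∀ {i j} → hub i ≡ hub j → i ≡ j)
               (v : Fin d) (us : List (Fin r)) (us-unique : Unique us) where

  nbrs′ : ∀ {z} → Dec (z ≡ v) → List (Fin r)
  nbrs′ (yes _) = us
  nbrs′ (no _)  = []

  nbrs′-unique : ∀ {z} (z≟v : Dec (z ≡ v)) → Unique (nbrs′ z≟v)
  nbrs′-unique (yes _) = us-unique
  nbrs′-unique (no _)  = []

  ∈-nbrs′ : ∀ {z j} (z≟v : Dec (z ≡ v)) → j ∈ nbrs′ z≟v → z ≡ v × j ∈ us
  ∈-nbrs′ (yes eq) j∈ = eq , j∈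

  nbrs′-v : (v≟v : Dec (v ≡ v)) → nbrs′ v≟v ≡ us
  nbrs′-v (yes _) = ≡.refl
  nbrs′-v (no ne) = ⊥-elim (ne ≡.refl)

  system : System d
  system = record
    { r = r ; hub = hub ; hub-inj = hub-inj
    ; nbrs = λ z → nbrs′ (z Fin.≟ v) ; nbrs-unique = λ z → nbrs′-unique (z Fin.≟ v) }

  open System system public using (IsHub; N; deg; deg-hub; deg-leaf; N-intro; N-elim)

  N-⊆ : ∀ (ρ : Fin d → Fin d → Set) → (∀ {i j} → i ≢ j → ρ (hub i) (hub j)) →
        (∀ {j} → j ∈ us → ρ v (hub j)) → ∀ {a u} → u ∈ N a → ρ a u
  N-⊆ ρ hubs leaf = N-elim ρ (λ j<i → hubs λ { ≡.refl → ℕₚ.<-irrefl ≡.refl j<i })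
    (λ {z} {j} _ j∈ → let z≡v , j∈us = ∈-nbrs′ (z Fin.≟ v) j∈ in ≡.subst (λ z → ρ z (hub j)) (≡.sym z≡v) (leaf j∈us))

  v-intro : ¬ IsHub v → ∀ {j} → j ∈ us → hub j ∈ N v
  v-intro ¬h j∈ = N-intro ¬h (≡.subst (_ ∈_) (≡.sym (nbrs′-v (v Fin.≟ v))) j∈)

  deg-v : ¬ IsHub v → deg v ≡ length us
  deg-v ¬h = ≡.trans (deg-leaf ¬h) (≡.cong length (nbrs′-v (v Fin.≟ v)))

-- Flats are given by equations over K, so the combinatorics of their classes is recovered by
-- testing with indicator functions.
module FlatLemmas {c ℓ : Level} (K : Field c ℓ) {n : ℕ} {Adj : Fin n → Fin n → Set} where
  open Field K using (Carrier; _≈_; 0#; 1#; refl; sym; reflexive; 0≉1)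

  χ : ∀ {A : Set} → Dec A → Carrier
  χ (yes _) = 1#
  χ (no _)  = 0#

  χ-≈ : ∀ {A B : Set} (a? : Dec A) (b? : Dec B) → χ a? ≈ χ b? → A → B
  χ-≈ a?      (yes b) _  _ = b
  χ-≈ (yes _) (no _)  eq _ = ⊥-elim (0≉1 (sym eq))
  χ-≈ (no ¬a) (no _)  _  a = ⊥-elim (¬a a)

  χ-both-no : ∀ {A B : Set} (a? : Dec A) (b? : Dec B) → ¬ A → ¬ B → χ a? ≈ χ b?
  χ-both-no (yes a) _       ¬a _  = ⊥-elim (¬a a)
  χ-both-no (no _)  (yes b) _  ¬b = ⊥-elim (¬b b)
  χ-both-no (no _)  (no _)  _  _  = refl

  χ-class : ∀ {d} (X : Flat K Adj d) i → _∈F_ K Adj (λ w → χ (Flat.π X w Fin.≟ Flat.π X i)) X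
  χ-class X i a b eq = reflexive (≡.cong (λ z → χ (z Fin.≟ Flat.π X i)) eq)

  edge-class : ∀ {d} (X : Flat K Adj d) i j → T (Flat.S X i j) → Flat.π X j ≡ Flat.π X i
  edge-class X i j t = χ-≈ (π i Fin.≟ π i) (π j Fin.≟ π i) (Flat.X⊆∩S X _ (χ-class X i) i j t) ≡.refl
    where open Flat X using (π)

  refines : ∀ {d d′} (X : Flat K Adj d) (Y : Flat K Adj d′) → _⊆F_ K Adj X Y →
            ∀ i j → Flat.π Y i ≡ Flat.π Y j → Flat.π X j ≡ Flat.π X i
  refines X Y X⊆Y i j eq = χ-≈ (π i Fin.≟ π i) (π j Fin.≟ π i) (X⊆Y _ (χ-class X i) i j eq) ≡.refl
    where open Flat X using (π)

  -- The indicator of `m` is constant along the edges that define the flat, because such an edge at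
  -- `m` would lead to a neighbour inside its class. Hence it is constant on classes.
  alone : ∀ {d} (X : Flat K Adj d) m → (∀ w → Adj m w ⊎ Adj w m → Flat.π X w ≢ Flat.π X m) →
          ∀ w → Flat.π X w ≡ Flat.π X m → w ≡ m
  alone X m far w eq = χ-≈ (m Fin.≟ m) (w Fin.≟ m) (∩S⊆X (λ w → χ (w Fin.≟ m)) on-edges m w (≡.sym eq)) ≡.refl
    where
    open Flat X
    on-edges : ∀ i j → T (S i j) → χ (i Fin.≟ m) ≈ χ (j Fin.≟ m)
    on-edges i j t = χ-both-no (i Fin.≟ m) (j Fin.≟ m)
      (λ { ≡.refl → far j (inj₁ (S⊆A i j t)) (edge-class X i j t) })
      (λ { ≡.refl → far i (inj₂ (S⊆A i j t)) (≡.sym (edge-class X i j t)) })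

-- Every class has a representative outside the image of `f`. These d representatives and the q
-- values of `f` are distinct vertices.
redundant-bound : ∀ {n d q} (π : Fin n → Fin d) → (∀ b → ∃ λ i → π i ≡ b) →
  (f : Fin q → Fin n) → (∀ {i j} → f i ≡ f j → i ≡ j) →
  (∀ j → ∃ λ i → π i ≡ π (f j) × (∀ j′ → f j′ ≢ i)) → d ℕ.+ q ≤ n
redundant-bound {n} {d} {q} π surj f f-inj spare = Finₚ.injective⇒≤ {f = g} g-inj
  where
  avoid : ∀ i → ∃ λ i′ → π i′ ≡ π i × (∀ j → f j ≢ i′)
  avoid i with Finₚ.any? (λ j → f j Fin.≟ i)
  ... | yes (j , ≡.refl) = spare j
  ... | no ¬f            = i , ≡.refl , λ j eq → ¬f (j , eq)
  s : Fin d → Fin n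
  s b = proj₁ (avoid (proj₁ (surj b)))
  π-s : ∀ b → π (s b) ≡ b
  π-s b = ≡.trans (proj₁ (proj₂ (avoid (proj₁ (surj b))))) (proj₂ (surj b))
  s-≢ : ∀ b j → f j ≢ s b
  s-≢ b = proj₂ (proj₂ (avoid (proj₁ (surj b))))
  g′ : Fin d ⊎ Fin q → Fin n
  g′ = Sum.[ s , f ]
  g′-inj : ∀ x y → g′ x ≡ g′ y → x ≡ y
  g′-inj (inj₁ b) (inj₁ b′) eq = ≡.cong inj₁ (≡.trans (≡.sym (π-s b)) (≡.trans (≡.cong π eq) (π-s b′)))
  g′-inj (inj₁ b) (inj₂ j)  eq = ⊥-elim (s-≢ b j (≡.sym eq))
  g′-inj (inj₂ j) (inj₁ b)  eq = ⊥-elim (s-≢ b j eq)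
  g′-inj (inj₂ j) (inj₂ j′) eq = ≡.cong inj₂ (f-inj eq)
  g : Fin (d ℕ.+ q) → Fin n
  g = g′ ∘ Fin.splitAt d
  g-inj : ∀ {x y} → g x ≡ g y → x ≡ y
  g-inj {x} {y} eq = ≡.trans (≡.sym (Finₚ.join-splitAt d q x))
    (≡.trans (≡.cong (Fin.join d q) (g′-inj (Fin.splitAt d x) (Fin.splitAt d y) eq)) (Finₚ.join-splitAt d q y))

third : ∀ {d} → 3 ≤ d → (u v : Fin d) → ∃ λ w → w ≢ u × w ≢ v
third (s≤s (s≤s (s≤s _))) zero    zero          = # 1 , (λ ()) , (λ ())
third (s≤s (s≤s (s≤s _))) zero    (suc zero)    = # 2 , (λ ()) , (λ ())
third (s≤s (s≤s (s≤s _))) zero    (suc (suc v)) = # 1 , (λ ()) , (λ ())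
third (s≤s (s≤s (s≤s _))) (suc zero)    zero    = # 2 , (λ ()) , (λ ())
third (s≤s (s≤s (s≤s _))) (suc (suc u)) zero    = # 1 , (λ ()) , (λ ())
third (s≤s (s≤s (s≤s _))) (suc u)       (suc v) = # 0 , (λ ()) , (λ ())

-- Bounds on an unknown exponent sequence

module Exponents {c ℓ : Level} (K : Field c ℓ) (k : ℕ) (e : Fin (Graph.n k) → ℕ)
                 (mono : ∀ a b → toℕ a ≤ toℕ b → e a ≤ e b) (F : FreeWithExps K (Whole._∼_ k) e) where
  open Graph k
  private module W = Whole k

  private
    bound : ∀ {l m} (b : Fin l → Fin n) → (∀ {j j′} → b j ≡ b j′ → j ≡ j′) → (c : Fin m → Fin n) → m < l →
            (∀ a → (∃ λ i → c i ≡ a) ⊎ (∀ j → e a ≢ W.deg (b j))) → ⊥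
    bound b b-inj = SystemBases.exponents-bound K W.system F (λ {a} {u} → W.N⊆∼ {a} {u}) b b-inj (λ j → W.∼-closed (b j))

    deg≥2 : ∀ v → 2 ≤ toℕ v → 2 ≤ W.deg v
    deg≥2 v le = go (toℕ v ℕ.<? 4) (toℕ v ℕ.<? 4 ℕ.+ 6 ℕ.* k)
      where
      go : Dec (toℕ v < 4) → Dec (toℕ v < 4 ℕ.+ 6 ℕ.* k) → 2 ≤ W.deg v
      go (yes lt) _       = ≡.subst (2 ≤_) (≡.sym (W.deg-core v lt)) le
      go (no ≮) (yes lt)  = ℕₚ.≤-reflexive (≡.sym (W.deg-mid v (ℕₚ.≮⇒≥ ≮) lt))
      go (no _) (no ≮)    = ≡.subst (2 ≤_) (≡.sym (W.deg-extra v (ℕₚ.≮⇒≥ ≮))) (ℕₚ.n≤1+n 2)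

    deg≤2 : ∀ v → toℕ v ≢ 3 → toℕ v < 4 ℕ.+ 6 ℕ.* k → W.deg v ≤ 2
    deg≤2 v ≢3 lt = go (toℕ v ℕ.<? 4)
      where
      go : Dec (toℕ v < 4) → W.deg v ≤ 2
      go (yes v<4) = ≡.subst (_≤ 2) (≡.sym (W.deg-core v v<4)) (ℕ.s≤s⁻¹ (ℕₚ.≤∧≢⇒< (ℕ.s≤s⁻¹ v<4) ≢3))
      go (no ≮)    = ℕₚ.≤-reflexive (W.deg-mid v (ℕₚ.≮⇒≥ ≮) lt)

  -- The first hub has a Newton element of degree 0, so the exponent 0 occurs, and by monotonicity
  -- it occurs at the first index.
  first : ∀ a → toℕ a ≡ 0 → e a ≡ 0
  first a a≡0 = decidable-stable (e a ℕ.≟ 0) λ ea≢0 →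
    bound {1} {0} (λ _ → a) (λ { {zero} {zero} _ → ≡.refl }) (λ ()) (s≤s z≤n) λ b → inj₂ λ _ eq →
      ea≢0 (ℕₚ.n≤0⇒n≡0 (≡.subst (e a ≤_) (≡.trans eq deg-a) (mono a b (≡.subst (_≤ toℕ b) (≡.sym a≡0) z≤n))))
    where
    deg-a : W.deg a ≡ 0
    deg-a = ≡.trans (W.deg-core a (≡.subst (_< 4) (≡.sym a≡0) (s≤s z≤n))) a≡0

  -- There are n - 2 vertices of degree at least 2. An exponent below 2 at index 2 would leave at
  -- most n - 3 exponents to match them.
  third-onwards : ∀ a → 2 ≤ toℕ a → 2 ≤ e a
  third-onwards a 2≤a = ℕₚ.≤-trans (ℕₚ.≮⇒≥ λ e₂<2 →
    bound (λ j → suc (suc j)) (Finₚ.suc-injective ∘ Finₚ.suc-injective) (λ i → suc (suc (suc i))) ℕₚ.≤-refl (cover e₂<2))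
    (mono (# 2) a 2≤a)
    where
    low : e (# 2) < 2 → ∀ a → toℕ a ≤ 2 → (j : Fin (2 ℕ.+ (6 ℕ.* k ℕ.+ k))) → e a ≢ W.deg (suc (suc j))
    low e₂<2 a a≤2 j eq = ℕₚ.<⇒≱ (ℕₚ.≤-<-trans (mono a (# 2) a≤2) e₂<2)
      (≡.subst (2 ≤_) (≡.sym eq) (deg≥2 (suc (suc j)) (s≤s (s≤s z≤n))))
    cover : e (# 2) < 2 → ∀ a → (∃ λ i → suc (suc (suc i)) ≡ a) ⊎ (∀ j → e a ≢ W.deg (suc (suc j)))
    cover e₂<2 zero                = inj₂ (low e₂<2 (# 0) z≤n)
    cover e₂<2 (suc zero)          = inj₂ (low e₂<2 (# 1) (s≤s z≤n))
    cover e₂<2 (suc (suc zero))    = inj₂ (low e₂<2 (# 2) (s≤s (s≤s z≤n)))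
    cover e₂<2 (suc (suc (suc a))) = inj₁ (a , ≡.refl)

  -- There are 6k + 3 vertices of degree at most 2. An exponent above 2 at index 6k + 2 would leave
  -- only 6k + 2 indices to match them.
  up-to : ∀ a → toℕ a ≤ 2 ℕ.+ 6 ℕ.* k → e a ≤ 2
  up-to a a≤ = ℕₚ.≤-trans (mono a last (≡.subst (toℕ a ≤_) (≡.sym toℕ-last) a≤)) (ℕₚ.≮⇒≥ λ 2<e →
    bound b b-inj (λ i → Fin.inject≤ i 2+6k≤n) ℕₚ.≤-refl (cover 2<e))
    where
    2+6k<n : 2 ℕ.+ 6 ℕ.* k < n
    2+6k<n = ℕₚ.≤-trans (ℕₚ.n≤1+n _) W.Q≤n
    2+6k≤n : 2 ℕ.+ 6 ℕ.* k ≤ n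
    2+6k≤n = ℕₚ.<⇒≤ 2+6k<n
    last : Fin n
    last = Fin.fromℕ< 2+6k<n
    toℕ-last : toℕ last ≡ 2 ℕ.+ 6 ℕ.* k
    toℕ-last = Finₚ.toℕ-fromℕ< 2+6k<n
    -- All vertices of Q₄(M) except vertex 4, whose degree is 3.
    b : Fin (3 ℕ.+ 6 ℕ.* k) → Fin n
    b j = Fin.punchIn (# 3) j Fin.↑ˡ k
    b-inj : ∀ {j j′} → b j ≡ b j′ → j ≡ j′
    b-inj {j} {j′} eq = Finₚ.punchIn-injective (# 3) j j′ (Finₚ.↑ˡ-injective k _ _ eq)
    toℕ-b : ∀ j → toℕ (b j) ≡ toℕ (Fin.punchIn (# 3) j)
    toℕ-b j = Finₚ.toℕ-↑ˡ (Fin.punchIn (# 3) j) k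
    deg-b : ∀ j → W.deg (b j) ≤ 2
    deg-b j = deg≤2 (b j)
      (λ eq → Finₚ.punchInᵢ≢i (# 3) j (Finₚ.toℕ-injective (≡.trans (≡.sym (toℕ-b j)) eq)))
      (≡.subst (_< 4 ℕ.+ 6 ℕ.* k) (≡.sym (toℕ-b j)) (Finₚ.toℕ<n (Fin.punchIn (# 3) j)))
    cover : 2 < e last → ∀ a → (∃ λ i → Fin.inject≤ i 2+6k≤n ≡ a) ⊎ (∀ j → e a ≢ W.deg (b j))
    cover 2<e a = go (toℕ a ℕ.<? 2 ℕ.+ 6 ℕ.* k)
      where
      go : Dec (toℕ a < 2 ℕ.+ 6 ℕ.* k) → (∃ λ i → Fin.inject≤ i 2+6k≤n ≡ a) ⊎ (∀ j → e a ≢ W.deg (b j))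
      go (yes lt) = inj₁ (Fin.fromℕ< lt , Finₚ.toℕ-injective (≡.trans (Finₚ.toℕ-inject≤ _ 2+6k≤n) (Finₚ.toℕ-fromℕ< lt)))
      go (no ≮)   = inj₂ λ j eq → ℕₚ.<⇒≱ 2<e (ℕₚ.≤-trans (mono last a (≡.subst (_≤ toℕ a) (≡.sym toℕ-last) (ℕₚ.≮⇒≥ ≮)))
                      (≡.subst (_≤ 2) (≡.sym eq) (deg-b j)))

  -- Constraints on a single flat

  module AtFlat (a : Fin n) (Z : Flat K Adj (suc (toℕ a)))
                (FZ : FreeWithExps K (Restr K Adj Z) (λ b → e (Fin.inject≤ b (Finₚ.toℕ<n a)))) where
    open Flat Z using (π; surj)
    open FlatLemmas K {n} {Adj} using (alone)

    d : ℕ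
    d = suc (toℕ a)

    ε : Fin d → Fin n
    ε b = Fin.inject≤ b (Finₚ.toℕ<n a)

    toℕ-ε : ∀ b → toℕ (ε b) ≡ toℕ b
    toℕ-ε b = Finₚ.toℕ-inject≤ b (Finₚ.toℕ<n a)

    _⌢_ : Fin d → Fin d → Set
    _⌢_ = Restr K Adj Z

    ⌢-sym : ∀ {i j} → i ⌢ j → j ⌢ i
    ⌢-sym (x , y , adj , πx , πy , ne) = y , x , Adj-sym {x} {y} adj , πy , πx , ne ∘ ≡.sym

    -- Two vertices adjacent to u, one of them pendant, would give two exponents equal to 1.
    no-pendant : 3 ≤ d → ∀ {u v w} → v ≢ w → v ⌢ u → w ⌢ u → (∀ i → v ⌢ i → i ≡ u) → ⊥
    no-pendant 3≤d {u} {v} {w} v≢w vu@(_ , _ , _ , _ , _ , v≢u) wu@(_ , _ , _ , _ , _ , w≢u) pendant =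
      SystemBases.exponents-bound K system FZ
        (N-⊆ _⌢_ hubs (λ { (here ≡.refl) → vu }))
        b b-inj closed (λ _ → i₁) (s≤s (s≤s z≤n)) cover
      where
      hub : Fin 2 → Fin d
      hub zero    = u
      hub (suc _) = w
      hub-inj : ∀ {i j} → hub i ≡ hub j → i ≡ j
      hub-inj {zero}     {zero}     _  = ≡.refl
      hub-inj {zero}     {suc zero} eq = ⊥-elim (w≢u (≡.sym eq))
      hub-inj {suc zero} {zero}     eq = ⊥-elim (w≢u eq)
      hub-inj {suc zero} {suc zero} _  = ≡.refl
      open OneLeaf hub hub-inj v (zero ∷ []) ([] ∷ [])
      hubs : ∀ {i j} → i ≢ j → hub i ⌢ hub j
      hubs {zero}     {zero}     ne = ⊥-elim (ne ≡.refl)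
      hubs {zero}     {suc zero} _  = ⌢-sym wu
      hubs {suc zero} {zero}     _  = wu
      hubs {suc zero} {suc zero} ne = ⊥-elim (ne ≡.refl)
      v-leaf : ¬ IsHub v
      v-leaf (zero     , eq) = v≢u (≡.sym eq)
      v-leaf (suc zero , eq) = v≢w (≡.sym eq)
      b : Fin 2 → Fin d
      b zero    = w
      b (suc _) = v
      b-inj : ∀ {i j} → b i ≡ b j → i ≡ j
      b-inj {zero}     {zero}     _  = ≡.refl
      b-inj {zero}     {suc zero} eq = ⊥-elim (v≢w (≡.sym eq))
      b-inj {suc zero} {zero}     eq = ⊥-elim (v≢w eq)
      b-inj {suc zero} {suc zero} _  = ≡.refl
      deg-b : ∀ j → deg (b j) ≡ 1
      deg-b zero       = deg-hub (# 1)
      deg-b (suc zero) = deg-v v-leaf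
      closed : ∀ j → ¬ IsHub (b j) → ∀ i → i ⌢ b j ⊎ b j ⌢ i → i ∈ N (b j)
      closed zero       ¬h i _   = ⊥-elim (¬h (# 1 , ≡.refl))
      closed (suc zero) ¬h i adj = ≡.subst (_∈ N v) (≡.sym (pendant i (Sum.[ ⌢-sym , id ] adj))) (v-intro ¬h (here ≡.refl))
      1<d : 1 < d
      1<d = ℕₚ.<⇒≤ 3≤d
      i₁ : Fin d
      i₁ = Fin.fromℕ< 1<d
      cover : ∀ x → (∃ λ (i : Fin 1) → i₁ ≡ x) ⊎ (∀ j → e (ε x) ≢ deg (b j))
      cover x = go (toℕ x) ≡.refl
        where
        go : ∀ s → toℕ x ≡ s → (∃ λ (i : Fin 1) → i₁ ≡ x) ⊎ (∀ j → e (ε x) ≢ deg (b j))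
        go zero          x≡ = inj₂ λ j eq → ℕₚ.0≢1+n (≡.trans (≡.sym (first (ε x) (≡.trans (toℕ-ε x) x≡))) (≡.trans eq (deg-b j)))
        go (suc zero)    x≡ = inj₁ (zero , Finₚ.toℕ-injective (≡.trans (Finₚ.toℕ-fromℕ< 1<d) (≡.sym x≡)))
        go (suc (suc s)) x≡ = inj₂ λ j eq → ℕₚ.<⇒≱ (s≤s (ℕₚ.≤-reflexive (≡.trans eq (deg-b j))))
          (third-onwards (ε x) (≡.subst (2 ≤_) (≡.sym (≡.trans (toℕ-ε x) x≡)) (s≤s (s≤s z≤n))))

    core-⌢ : ∀ {b c} → π (vcore b) ≢ π (vcore c) → π (vcore b) ⌢ π (vcore c)
    core-⌢ {b} {c} ne = vcore b , vcore c , adj-encode {core b} {core c} (λ { ≡.refl → ne ≡.refl }) , ≡.refl , ≡.refl , ne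

    leaf-core : ∀ {l} → Leaf l → ∃ λ a → LAdj l (core a)
    leaf-core {mid p t} _ = pairFst p , inj₁ ≡.refl
    leaf-core {extra t} _ = zero , s≤s z≤n

    -- If the cores form several classes, another core class serves. Otherwise any third class
    -- contains a leaf, whose neighbours are cores and thus lie in the class of `b`.
    third-class : 3 ≤ d → ∀ b v → (∀ c → π (vcore c) ≢ v) → ∃ λ w → v ≢ w × w ⌢ π (vcore b)
    third-class 3≤d b v not-core = go (Finₚ.any? λ c → ¬? (π (vcore c) Fin.≟ u))
      where
      u : Fin d
      u = π (vcore b)
      go : Dec (∃ λ c → π (vcore c) ≢ u) → ∃ λ w → v ≢ w × w ⌢ u
      go (yes (c , ne)) = π (vcore c) , not-core c ∘ ≡.sym , core-⌢ {c} {b} ne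
      go (no none) = w , w≢v ∘ ≡.sym , outer (core? (decode k y))
        where
        all-u : ∀ c → π (vcore c) ≡ u
        all-u c = decidable-stable (π (vcore c) Fin.≟ u) (λ ne → none (c , ne))
        w : Fin d
        w = proj₁ (third 3≤d u v)
        w≢u : w ≢ u
        w≢u = proj₁ (proj₂ (third 3≤d u v))
        w≢v : w ≢ v
        w≢v = proj₂ (proj₂ (third 3≤d u v))
        y : Fin n
        y = proj₁ (surj w)
        πy : π y ≡ w
        πy = proj₂ (surj w)
        outer : (∃ λ c → decode k y ≡ core c) ⊎ Leaf (decode k y) → w ⌢ u
        outer (inj₁ (c , eq)) = ⊥-elim (w≢u (≡.trans (≡.sym πy) (≡.trans (≡.cong π (encode-of y eq)) (all-u c))))
        outer (inj₂ leaf)     = let c , adj = leaf-core {decode k y} leaf in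
          y , vcore c , ≡.subst (LAdj (decode k y)) (≡.sym (decode-encode (core c))) adj , πy , all-u c , w≢u

    adj-leaf : ∀ {l} → Leaf l → ∀ w → Adj (encode l) w ⊎ Adj w (encode l) → ∃ λ c → w ≡ vcore c × c ∈ ends l
    adj-leaf {l} leaf w adj =
      let c , eq , c∈ = leaf-adj leaf (≡.subst (λ z → LAdj z (decode k w)) (decode-encode l)
                          (Sum.[ id , Adj-sym {w} {encode l} ] adj))
      in c , encode-of w eq , c∈

    -- If the attached vertex stayed outside the class of its two neighbours, nothing would be
    -- contracted into it, and that class would be its only neighbour: a pendant vertex, excluded by
    -- `no-pendant`.
    absorbed : 3 ≤ d → ∀ p → π (vcore (pairFst p)) ≡ π (vcore (pairSnd p)) →
               ∀ t → π (encode (mid p t)) ≡ π (vcore (pairFst p))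
    absorbed 3≤d p collapse t = decidable-stable (v Fin.≟ u) λ v≢u →
      let on-ends : ∀ c → c ∈ ends (mid {k} p t) → π (vcore c) ≡ u
          on-ends c = λ { (here ≡.refl) → ≡.refl ; (there (here ≡.refl)) → ≡.sym collapse }
          single : ∀ w → π w ≡ v → w ≡ m
          single = alone Z m λ w adj πw → let c , eq , c∈ = adj-leaf {mid p t} tt w adj in
            v≢u (≡.trans (≡.sym πw) (≡.trans (≡.cong π eq) (on-ends c c∈)))
          not-core : ∀ c → π (vcore c) ≢ v
          not-core c eq = core≢mid (encode-injective {core c} {mid p t} (single (vcore c) eq))
          w , v≢w , wu = third-class 3≤d (pairFst p) v not-core
      in no-pendant 3≤d v≢w
           (m , vcore (pairFst p) , adj-encode {mid p t} {core (pairFst p)} (inj₁ ≡.refl) , ≡.refl , ≡.refl , v≢u) wu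
           λ i → λ { (x , y , adj , πx , πy , _) →
             let c , eq , c∈ = adj-leaf {mid p t} tt y (inj₁ (≡.subst (λ z → Adj z y) (single x πx) adj)) in
             ≡.trans (≡.sym πy) (≡.trans (≡.cong π eq) (on-ends c c∈)) }
      where
      m : Fin n
      m = encode (mid p t)
      u v : Fin d
      u = π (vcore (pairFst p))
      v = π m
      core≢mid : ∀ {c} → core {k} c ≢ mid p t
      core≢mid ()

    Distinct : Set
    Distinct = ∀ {b c} → π (vcore b) ≡ π (vcore c) → b ≡ c

    Collapsed : Set
    Collapsed = ∃ λ p → π (vcore (pairFst p)) ≡ π (vcore (pairSnd p))

    collapsed? : Collapsed ⊎ Distinct
    collapsed? = go (Finₚ.any? λ p → π (vcore (pairFst p)) Fin.≟ π (vcore (pairSnd p)))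
      where
      pair-of : ∀ b c → b ≡ c ⊎ ∃ λ p → (pairFst p ≡ b × pairSnd p ≡ c) ⊎ (pairFst p ≡ c × pairSnd p ≡ b)
      pair-of = toWitness {a? = Finₚ.all? λ b → Finₚ.all? λ c → (b Fin.≟ c) ⊎-dec Finₚ.any? λ p →
        ((pairFst p Fin.≟ b) ×-dec (pairSnd p Fin.≟ c)) ⊎-dec ((pairFst p Fin.≟ c) ×-dec (pairSnd p Fin.≟ b))} tt
      go : Dec Collapsed → Collapsed ⊎ Distinct
      go (yes coll) = inj₁ coll
      go (no ¬coll) = inj₂ λ {b} {c} eq → distinct eq (pair-of b c)
        where
        distinct : ∀ {b c} → π (vcore b) ≡ π (vcore c) →
                   b ≡ c ⊎ (∃ λ p → (pairFst p ≡ b × pairSnd p ≡ c) ⊎ (pairFst p ≡ c × pairSnd p ≡ b)) → b ≡ c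
        distinct eq (inj₁ b≡c)                            = b≡c
        distinct eq (inj₂ (p , inj₁ (≡.refl , ≡.refl)))   = ⊥-elim (¬coll (p , eq))
        distinct eq (inj₂ (p , inj₂ (≡.refl , ≡.refl)))   = ⊥-elim (¬coll (p , ≡.sym eq))

    module _ (distinct : Distinct) where
      hub : Fin 4 → Fin d
      hub = π ∘ vcore

      hubs : ∀ {i j} → i ≢ j → hub i ⌢ hub j
      hubs {i} {j} ne = core-⌢ {i} {j} (ne ∘ distinct)

      -- Four distinct core classes form a K₄, whose last hub yields an element of degree 3 in D,
      -- whatever the other edges are.
      clique-exponent : (∀ b → e (ε b) ≢ 3) → ⊥
      clique-exponent e≢3 = SystemBases.exponents-bound K system FZ (N-⊆ _⌢_ hubs λ ())
        (λ (_ : Fin 1) → hub (# 3)) (λ { {zero} {zero} _ → ≡.refl })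
        (λ _ ¬h → ⊥-elim (¬h (# 3 , ≡.refl))) no-columns (s≤s z≤n)
        (λ b → inj₂ λ _ eq → e≢3 b (≡.trans eq (deg-hub (# 3))))
        where
        -- A clique without a leaf: a hub is passed in the place of the leaf.
        open OneLeaf hub distinct (hub zero) [] []
        no-columns : Fin 0 → Fin d
        no-columns ()

      -- The last hub of K₄ and the extra vertex both have degree 3. The extra vertex is alone in
      -- its class, because its neighbours are cores of other classes, so its element lies in D as
      -- well. One index `i₀` cannot account for two elements.
      clique-leaf-exponents : ∀ t → (∀ c → hub c ≢ π (encode (extra t))) →
                              (i₀ : Fin d) → (∀ b → i₀ ≡ b ⊎ e (ε b) ≢ 3) → ⊥
      clique-leaf-exponents t not-core i₀ cover = SystemBases.exponents-bound K system FZ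
        (N-⊆ _⌢_ hubs (λ {j} j∈ → x , vcore j , adj-encode {extra t} {core j} (ends-adj (extra t) j∈) , ≡.refl , ≡.refl
          , not-core j ∘ ≡.sym))
        b b-inj closed (λ _ → i₀) (s≤s (s≤s z≤n))
        (λ y → Sum.map (λ eq → zero , eq) (λ ne j eq → ne (≡.trans eq (deg-b j))) (cover y))
        where
        x : Fin n
        x = encode (extra t)
        v : Fin d
        v = π x
        open OneLeaf hub distinct v (ends (extra {k} t)) (ends-unique (extra {k} t))
        v-leaf : ¬ IsHub v
        v-leaf (c , eq) = not-core c eq
        single : ∀ w → π w ≡ v → w ≡ x
        single = alone Z x λ w adj πw → let c , eq , _ = adj-leaf {extra t} tt w adj in
          not-core c (≡.trans (≡.cong π (≡.sym eq)) πw)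
        b : Fin 2 → Fin d
        b zero    = hub (# 3)
        b (suc _) = v
        b-inj : ∀ {i j} → b i ≡ b j → i ≡ j
        b-inj {zero}     {zero}     _  = ≡.refl
        b-inj {zero}     {suc zero} eq = ⊥-elim (not-core (# 3) eq)
        b-inj {suc zero} {zero}     eq = ⊥-elim (not-core (# 3) (≡.sym eq))
        b-inj {suc zero} {suc zero} _  = ≡.refl
        deg-b : ∀ j → deg (b j) ≡ 3
        deg-b zero       = deg-hub (# 3)
        deg-b (suc zero) = deg-v v-leaf
        adjacent : ∀ {i} → v ⌢ i → i ∈ N v
        adjacent (y , z , adj , πy , πz , _) =
          let c , eq , c∈ = adj-leaf {extra t} tt z (inj₁ (≡.subst (λ y → Adj y z) (single y πy) adj)) in
          ≡.subst (_∈ N v) (≡.trans (≡.cong π (≡.sym eq)) πz) (v-intro v-leaf c∈)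
        closed : ∀ j → ¬ IsHub (b j) → ∀ i → i ⌢ b j ⊎ b j ⌢ i → i ∈ N (b j)
        closed zero       ¬h i _   = ⊥-elim (¬h (# 3 , ≡.refl))
        closed (suc zero) ¬h i adj = adjacent (Sum.[ ⌢-sym , id ] adj)

-- No chain reaches dimension 6k + 4

module _ {c ℓ : Level} (K : Field c ℓ) (k : ℕ) (1≤k : 1 ≤ k) where
  open Graph k
  open FlatLemmas K {n} {Adj} using (refines)

  -- Collapsing the edge p makes vertex pairSnd p and the k vertices attached to p redundant.
  block : Fin 6 → Fin (suc k) → Fin n
  block p zero    = vcore (pairSnd p)
  block p (suc t) = encode (mid p t)

  block-injective : ∀ p {i j} → block p i ≡ block p j → i ≡ j
  block-injective p {zero}  {zero}  _  = ≡.refl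
  block-injective p {zero}  {suc t} eq with () ← encode-injective {core (pairSnd p)} {mid p t} eq
  block-injective p {suc t} {zero}  eq with () ← encode-injective {mid p t} {core (pairSnd p)} eq
  block-injective p {suc t} {suc u} eq = ≡.cong suc (mid-injective (encode-injective {mid p t} {mid p u} eq))

  block-≢-core : ∀ p {a} → a ≢ pairSnd p → ∀ j → block p j ≢ vcore a
  block-≢-core p {a} ne zero    eq = ne (≡.sym (core-injective (encode-injective {core (pairSnd p)} {core a} eq)))
  block-≢-core p {a} ne (suc t) eq with () ← encode-injective {mid p t} {core a} eq

  block-≢-extra : ∀ p t j → block p j ≢ encode (extra t)
  block-≢-extra p t zero    eq with () ← encode-injective {core (pairSnd p)} {extra t} eq
  block-≢-extra p t (suc u) eq with () ← encode-injective {mid p u} {extra t} eq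

  extra≢core : ∀ {t a} → encode (extra t) ≢ vcore a
  extra≢core {t} {a} eq with () ← encode-injective {extra t} {core a} eq

  block-class : ∀ {d} (π : Fin n → Fin d) p → π (vcore (pairFst p)) ≡ π (vcore (pairSnd p)) →
                (∀ t → π (encode (mid p t)) ≡ π (vcore (pairFst p))) → ∀ j → π (vcore (pairFst p)) ≡ π (block p j)
  block-class π p collapse mids zero    = collapse
  block-class π p collapse mids (suc t) = ≡.sym (mids t)

  not-coaccurate : ¬ Coaccurate K Adj k
  not-coaccurate (e , mono , F , X , FX , nested) = dichotomy X₁.collapsed? X₂.collapsed?
    where
    module E = Exponents K k e mono (relation-resp K (λ {a} {b} → Whole.Adj→∼ k a b) (λ {a} {b} → Whole.∼→Adj k a b) F)

    -- Flats are indexed from 0: index 6k + 3 means dimension 6k + 4 = n - k, where the chain ends.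
    -- The other index is one lower.
    a₂<n : 3 ℕ.+ 6 ℕ.* k < n
    a₂<n = Whole.Q≤n k

    a₁<n : 2 ℕ.+ 6 ℕ.* k < n
    a₁<n = ℕₚ.<-trans (ℕₚ.n<1+n _) a₂<n

    a₁ a₂ : Fin n
    a₁ = Fin.fromℕ< a₁<n
    a₂ = Fin.fromℕ< a₂<n

    toℕ-a₁ : toℕ a₁ ≡ 2 ℕ.+ 6 ℕ.* k
    toℕ-a₁ = Finₚ.toℕ-fromℕ< a₁<n

    toℕ-a₂ : toℕ a₂ ≡ 3 ℕ.+ 6 ℕ.* k
    toℕ-a₂ = Finₚ.toℕ-fromℕ< a₂<n

    module X₁ = E.AtFlat a₁ (X a₁) (FX a₁)
    module X₂ = E.AtFlat a₂ (X a₂) (FX a₂)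

    π₁ : Fin n → Fin X₁.d
    π₁ = Flat.π (X a₁)

    π₂ : Fin n → Fin X₂.d
    π₂ = Flat.π (X a₂)

    π₂⇒π₁ : ∀ i j → π₂ i ≡ π₂ j → π₁ j ≡ π₁ i
    π₂⇒π₁ = refines (X a₁) (X a₂) (nested a₁ a₂
      (≡.subst₂ _≤_ (≡.sym toℕ-a₁) (≡.sym toℕ-a₂) (ℕₚ.n≤1+n _))
      (ℕₚ.≤-reflexive (≡.trans (≡.cong suc toℕ-a₂) (≡.sym (ℕₚ.m+n∸n≡m (4 ℕ.+ 6 ℕ.* k) k)))))

    3≤ : ∀ {m} → 2 ℕ.+ 6 ℕ.* k ≤ m → 3 ≤ suc m
    3≤ le = s≤s (ℕₚ.≤-trans (ℕₚ.m≤m+n 2 _) le)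

    3≤d₁ : 3 ≤ X₁.d
    3≤d₁ = 3≤ (ℕₚ.≤-reflexive (≡.sym toℕ-a₁))

    3≤d₂ : 3 ≤ X₂.d
    3≤d₂ = 3≤ (ℕₚ.≤-trans (ℕₚ.n≤1+n _) (ℕₚ.≤-reflexive (≡.sym toℕ-a₂)))

    low-exponent : ∀ b → e (X₁.ε b) ≢ 3
    low-exponent b eq = ℕₚ.<⇒≱ (s≤s (E.up-to (X₁.ε b) (≡.subst₂ _≤_ (≡.sym (X₁.toℕ-ε b)) toℕ-a₁ (ℕ.s≤s⁻¹ (Finₚ.toℕ<n b)))))
      (ℕₚ.≤-reflexive (≡.sym eq))

    -- The block of a collapsed edge consists of k + 1 redundant vertices, but the codimension is k.
    not-collapsed₂ : ¬ X₂.Collapsed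
    not-collapsed₂ (p , collapse) = ℕₚ.<⇒≱ too-big (redundant-bound π₂ (Flat.surj (X a₂)) (block p) (block-injective p)
      (λ j → vcore (pairFst p) , block-class π₂ p collapse (X₂.absorbed 3≤d₂ p collapse) j
           , block-≢-core p (pairFst≢pairSnd p)))
      where
      too-big : n < X₂.d ℕ.+ suc k
      too-big = ≡.subst (λ z → n < suc z ℕ.+ suc k) (≡.sym toℕ-a₂)
        (ℕₚ.≤-reflexive (≡.sym (ℕₚ.+-suc (4 ℕ.+ 6 ℕ.* k) k)))

    -- The class of the collapsed edge already has codimension k + 1 in X a₁.
    extra-apart : X₁.Collapsed → ∀ t a → π₁ (encode (extra t)) ≢ π₁ (vcore a)
    extra-apart (p , collapse) t a eq = ℕₚ.<⇒≱ too-big (redundant-bound π₁ (Flat.surj (X a₁)) f f-inj spare)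
      where
      f : Fin (suc (suc k)) → Fin n
      f zero    = encode (extra t)
      f (suc j) = block p j
      f-inj : ∀ {i j} → f i ≡ f j → i ≡ j
      f-inj {zero}  {zero}  _  = ≡.refl
      f-inj {zero}  {suc j} eq = ⊥-elim (block-≢-extra p t j (≡.sym eq))
      f-inj {suc i} {zero}  eq = ⊥-elim (block-≢-extra p t i eq)
      f-inj {suc i} {suc j} eq = ≡.cong suc (block-injective p eq)
      f-≢-core : ∀ {b} → b ≢ pairSnd p → ∀ j → f j ≢ vcore b
      f-≢-core {b} ne zero    = extra≢core {t} {b}
      f-≢-core     ne (suc j) = block-≢-core p ne j
      spare : ∀ j → ∃ λ i → π₁ i ≡ π₁ (f j) × (∀ j′ → f j′ ≢ i)
      spare (suc j) = vcore (pairFst p) , block-class π₁ p collapse (X₁.absorbed 3≤d₁ p collapse) j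
                    , f-≢-core (pairFst≢pairSnd p)
      -- The core that shares the class of the extra vertex may itself lie in the block; then the
      -- other end of the collapsed edge takes over.
      spare zero with a Fin.≟ pairSnd p
      ... | yes ≡.refl = vcore (pairFst p) , ≡.trans collapse (≡.sym eq) , f-≢-core (pairFst≢pairSnd p)
      ... | no ne      = vcore a , ≡.sym eq , f-≢-core ne
      too-big : n < X₁.d ℕ.+ suc (suc k)
      too-big = ≡.subst (λ z → n < suc z ℕ.+ suc (suc k)) (≡.sym toℕ-a₁) (ℕₚ.≤-reflexive (≡.sym
        (≡.trans (ℕₚ.+-suc (3 ℕ.+ 6 ℕ.* k) (suc k)) (ℕₚ.+-suc (4 ℕ.+ 6 ℕ.* k) k))))

    dichotomy : X₁.Collapsed ⊎ X₁.Distinct → X₂.Collapsed ⊎ X₂.Distinct → ⊥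
    dichotomy (inj₂ distinct₁) _                = X₁.clique-exponent distinct₁ low-exponent
    dichotomy (inj₁ _) (inj₁ collapsed₂)        = not-collapsed₂ collapsed₂
    dichotomy (inj₁ collapsed₁) (inj₂ distinct₂) =
      X₂.clique-leaf-exponents distinct₂ t₀ (λ a eq → extra-apart collapsed₁ t₀ a (π₂⇒π₁ (vcore a) (encode (extra t₀)) eq))
        top (λ b → cover b (toℕ b ℕ.≟ 3 ℕ.+ 6 ℕ.* k))
      where
      t₀ : Fin k
      t₀ = Fin.fromℕ< 1≤k
      -- The last index is the only one in dimension 6k + 4 where the exponent can be 3.
      top : Fin X₂.d
      top = Fin.fromℕ (toℕ a₂)
      cover : ∀ b → Dec (toℕ b ≡ 3 ℕ.+ 6 ℕ.* k) → top ≡ b ⊎ e (X₂.ε b) ≢ 3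
      cover b (yes eq) = inj₁ (Finₚ.toℕ-injective (≡.trans (Finₚ.toℕ-fromℕ (toℕ a₂)) (≡.trans toℕ-a₂ (≡.sym eq))))
      cover b (no ne)  = inj₂ λ eq → ℕₚ.<⇒≱ (s≤s (E.up-to (X₂.ε b) (≡.subst (_≤ 2 ℕ.+ 6 ℕ.* k) (≡.sym (X₂.toℕ-ε b))
        (ℕ.s≤s⁻¹ (ℕₚ.≤∧≢⇒< (≡.subst (toℕ b ≤_) toℕ-a₂ (ℕ.s≤s⁻¹ (Finₚ.toℕ<n b))) ne)))))
        (ℕₚ.≤-reflexive (≡.sym eq))

theorem6p12 : ∀ {c ℓ : Level} (K : Field c ℓ) (k : ℕ) → 1 ≤ k →
    Coaccurate K (GAdj k) (suc k) × ¬ Coaccurate K (GAdj k) k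
theorem6p12 K k 1≤k = coaccurate K k 1≤k , not-coaccurate K k 1≤k
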